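{- Let $\Gamma=(G_0,\ldots,G_{n-1})$ be parametric games, $I\subseteq\mathrm{Par}$ a self-dual set of parameters, $G=\forall I.\Gamma$, and assume $\mathrm{FV}(G)=\emptyset$. Then: (1) $G$ is determined. (2) Assume that $\eta(G_0),\ldots,\eta(G_{n-1})$ are determined for every $I$-assignment $\eta$. Then the following are equivalent: (a) there is a $\mathsf P$-winning strategy for $G$; (b) $\mathrm{EXH}$ is a primitive recursive $\mathsf P$-winning strategy for $G$; (c) for every $I$-assignment $\eta$ there are $i<n$ and a $\mathsf P$-winning strategy $\sigma_i:\eta(G_i)$.
   Context: Players: $\mathsf P$ (Player), $\mathsf O$ (Opponent), $\mathsf P^\bot=\mathsf O$, $\mathsf O^\bot=\mathsf P$. Fix a countable set $M$ of moves and a countable set $\mathrm{Par}$ with an involution $a\mapsto a^\bot$ without fixed points; $J\subseteq\mathrm{Par}$ is self-dual if $J^\bot=J$. $\langle\rangle$ is the empty list, $x@y$ concatenation, $x@S=\{x@s:s\in S\}$. A tree support is a set $T$ of finite lists over $M$ containing $\langle\rangle$ and closed under prefixes; leaves are nodes without one-step extension in $T$; $T_\infty$ is the set of infinite sequences with all finite prefixes in $T$. A parametric game $G$: a tree support $|G|$ with an enumeration of the children of each node, $\mathrm{turn}_G$: non-leaves $\to\{\mathsf P,\mathsf O\}$, $\mathrm{win}_G$: leaves $\to\{\mathsf P,\mathsf O\}\cup\mathrm{Par}$, a partition $(G_{\mathsf P},G_{\mathsf O})$ of $|G|_\infty$. $\mathrm{FV}(G)$ is the smallest self-dual set containing $\mathrm{win}_G(\text{leaves})\cap\mathrm{Par}$.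 A $J$-assignment ($J$ self-dual) is $\rho:J\to\{\mathsf P,\mathsf O\}$ with $\rho(a^\bot)=\rho(a)^\bot$, extended by $\rho(g)=g$; $\rho(G)$ is $G$ with $\mathrm{win}_G$ replaced by $\rho\circ\mathrm{win}_G$. $G_x$ is the subgame at $x$. $\mathrm{END}(x)$ is the one-position game with root leaf labelled $x$; $G$ is atomic if $|G|=\{\langle\rangle\}$. A strategy $\sigma:G$ is a tree support $\sigma\subseteq|G|$; it is a $g$-strategy if for every non-leaf $p\in\sigma$ with $\mathrm{turn}_G(p)=g^\bot$ all one-step extensions of $p$ in $|G|$ lie in $\sigma$; $g$-total if moreover each non-leaf $p\in\sigma$ with $\mathrm{turn}_G(p)=g$ has a one-step extension in $\sigma$; $g$-partially winning if moreover $\mathrm{win}_G(p)=g$ for each leaf $p$ of $|G|$ in $\sigma$; $g$-winning if moreover all infinite branches of $\sigma$ lie in $G_g$. $G$ is determined if it has a $g$-winning strategy for some player $g$. The game $\forall I.\Gamma$: $M$ contains primitive recursive injective constructors $\mathrm{DROP}(n),\mathrm{EM}(n,m),\mathrm{STOP}(n),\mathrm{JUST}(n,m),\mathrm{nth}(n)$ with disjoint ranges covering $M$. $\mathrm{FV}(\Gamma)=\bigcup_i\mathrm{FV}(G_i)$. The root has local positions $G_0,\ldots,G_{n-1}$. If $p=\langle\mathrm{JUST}(i_0,n),m_0,\ldots,\mathrm{JUST}(i_{k-1},n+k-1),m_{k-1}\rangle$ has local positions $G_0,\ldots,G_{n+k-1}$, then $\mathrm{turn}(p)=\mathsf P$ and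 $p@m$ is a position iff: $m=\mathrm{DROP}(n+k)$; or $m=\mathrm{EM}(i,j)$ with $i,j<n+k$, $G_i=\mathrm{END}(a)$, $G_j=\mathrm{END}(a^\bot)$, $a\in I$; or $m=\mathrm{STOP}(i)$ with $i<n+k$, $G_i=\mathrm{END}(x)$, $x\in\{\mathsf P,\mathsf O\}\cup(\mathrm{FV}(\Gamma)\setminus I)$; or $m=\mathrm{JUST}(i_k,n+k)$ with $i_k<n+k$, $G_{i_k}$ not atomic. The first three are leaves with winner $\mathsf O$, $\mathsf P$, $\mathrm{win}_{G_i}(\langle\rangle)$. If $p_1=p@\mathrm{JUST}(i_k,n+k)$, $\mathrm{turn}(p_1)=\mathrm{turn}_{G_{i_k}}(\langle\rangle)$, and $p_1@m_k$ is a position iff $\langle m_k\rangle\in|G_{i_k}|$; its local positions are $G_0,\ldots,G_{n+k}$ with $G_{n+k}=(G_{i_k})_{\langle m_k\rangle}$, and $i_k\vdash_{m_k}n+k$. For infinite plays use the union over finite prefixes. For finite $q=\langle m_0,\ldots,m_{r-1}\rangle$, $q\prec_i p$ if there are indices $i=j_0<\cdots<j_r$ with $j_s\vdash_{m_s}j_{s+1}$ in $p$; for infinite $q$, if there is an infinite such chain. $G_{\mathsf P}$: infinite $p$ with some infinite $q\prec_i p$ ($i<n$) in $(G_i)_{\mathsf P}$; $G_{\mathsf O}$: the other infinite plays. $\mathrm{FV}(\forall I.\Gamma)=\mathrm{FV}(\Gamma)\setminus I$. The strategy $\mathrm{EXH}=\mathrm{exh}(0,n,n,\emptyset)$, where $\mathrm{exh}(i,c,q,J)$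 ($i\le c\le q$, $J$ a list of triples; $G_0,\ldots,G_{q-1}$ the current local positions) is given by the first applicable clause: (REPEAT) $i=c<q$: $\mathrm{exh}(0,q,q,J)$. (DROP) $i=c=q$: $\{\langle\rangle,\langle\mathrm{DROP}(q)\rangle\}$. (EM) $i<c$, $G_i=\mathrm{END}(a)$, $a\in I$, with a least $j<c$ such that $G_j=\mathrm{END}(a^\bot)$: $\{\langle\rangle,\langle\mathrm{EM}(i,j)\rangle\}$. (STOP) $i<c$, $G_i=\mathrm{END}(\mathsf P)$: $\{\langle\rangle,\langle\mathrm{STOP}(i)\rangle\}$. (SKIP) $i<c$, $G_i$ atomic: $\mathrm{exh}(i+1,c,q,J)$. (TRYALL) $i<c$, $G_i$ not atomic, $K$ the set of moves from the root of $G_i$: (a) if $\mathrm{turn}_{G_i}(\langle\rangle)=\mathsf P$ and some $m\in K$ has no triple $(i,m,k)$ in $J$, take the first such $m$ and set $\mathrm{exh}=\{\langle\rangle,\langle\mathrm{JUST}(i,q)\rangle\}\cup\mathrm{JUST}(i,q)@m@\mathrm{exh}(i+1,c,q+1,J@(i,m,q))$, else $\mathrm{exh}(i+1,c,q,J)$; (b) if $\mathrm{turn}_{G_i}(\langle\rangle)=\mathsf O$ and $J$ has no triple $(i,m,k)$, set $\mathrm{exh}=\{\langle\rangle,\langle\mathrm{JUST}(i,q)\rangle\}\cup\bigcup_{m\in K}\mathrm{JUST}(i,q)@m@\mathrm{exh}(i+1,c,q+1,J@(i,m,q))$, else $\mathrm{exh}(i+1,c,q,J)$. (After the moves $\mathrm{JUST}(i,q),m$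 the local position $G_q=(G_i)_{\langle m\rangle}$ is added.) "Primitive recursive" means primitive recursive relative to the finitary parts (all data except the partitions) of $G_0,\ldots,G_{n-1}$. -}

module Defs where

open import Data.Nat using (ℕ; zero; suc; _+_; _*_; _^_; _<_)
open import Data.Bool using (Bool; true; false; not; T; if_then_else_)
open import Data.Fin using (Fin; toℕ) renaming (zero to fz; suc to fs)
open import Data.Vec using (Vec; []; _∷_) renaming (lookup to vlookup)
open import Data.List using (List; []; _∷_; _∷ʳ_; _++_; length; map; allFin)
open import Data.List.Relation.Unary.Any using (Any)
open import Data.Maybe using (Maybe; just; nothing)
open import Data.Product using (Σ; Σ-syntax; ∃; ∃-syntax; _×_; _,_; proj₁; proj₂)
open import Data.Unit using (⊤)
open import Data.Sum using (_⊎_)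
open import Data.Empty using (⊥)
open import Relation.Nullary using (¬_)
open import Relation.Binary.PropositionalEquality using (_≡_)

data Player : Set where
  P O : Player

opp : Player → Player
opp P = O
opp O = P

-- Parameters: a countable set with a fixed-point-free involution.
-- We take Par = ℕ × Bool with (k , b)^⊥ = (k , not b).

Par : Set
Par = ℕ × Bool

dual : Par → Par
dual (k , b) = (k , not b)

data Label : Set where
  pl  : Player → Label
  par : Par → Label

-- Moves: the set M, with the primitive recursive injective constructors
-- DROP, EM, STOP, JUST, nth with disjoint ranges covering M.

data Move : Set where
  DROP : ℕ → Move
  EM   : ℕ → ℕ → Move
  STOP : ℕ → Move
  JUST : ℕ → ℕ → Move
  nth  : ℕ → Move

-- Games (without enumeration of children).  Positions are finite lists
-- of moves; an infinite play is a function ℕ → Move.  The partition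
-- (G_P , G_O) of |G|_∞ is given by the predicate winP (G_P); G_O is
-- its complement within |G|_∞.

record Game : Set₁ where
  field
    pos  : List Move → Set
    turn : List Move → Player       -- meaningful on non-leaves only
    win  : List Move → Label        -- meaningful on leaves only
    winP : (ℕ → Move) → Set
open Game public

prefix : (ℕ → Move) → ℕ → List Move
prefix α zero    = []
prefix α (suc k) = α 0 ∷ prefix (λ i → α (suc i)) k

Leaf : Game → List Move → Set
Leaf G x = pos G x × (∀ m → ¬ pos G (x ∷ʳ m))

NonLeaf : Game → List Move → Set
NonLeaf G x = pos G x × (∃[ m ] pos G (x ∷ʳ m))

Side : Game → Player → (ℕ → Move) → Set
Side G P α = winP G α
Side G O α = ¬ winP G α

-- FV(G): smallest self-dual set containing the parameters labelling leaves
FV : Game → Par → Set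
FV G a = Σ[ x ∈ List Move ] Leaf G x × (win G x ≡ par a ⊎ win G x ≡ par (dual a))

record PGame : Set₁ where
  field
    game     : Game
    enum     : List Move → ℕ → Maybe Move
    pos-root   : pos game []
    pos-prefix : ∀ x y → pos game (x ++ y) → pos game x
    enum-sound : ∀ x k m → pos game x → enum x k ≡ just m → pos game (x ∷ʳ m)
    enum-compl : ∀ x m → pos game (x ∷ʳ m) → ∃[ k ] enum x k ≡ just m
    enum-stop  : ∀ x k → enum x k ≡ nothing → enum x (suc k) ≡ nothing
    enum-inj   : ∀ x k k' m → enum x k ≡ just m → enum x k' ≡ just m → k ≡ k'
open PGame public

IsStrategy : Game → (List Move → Set) → Set
IsStrategy G σ = σ [] × (∀ x y → σ (x ++ y) → σ x) × (∀ x → σ x → pos G x)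

IsGStrategy : Player → Game → (List Move → Set) → Set
IsGStrategy g G σ = IsStrategy G σ ×
  (∀ x → σ x → NonLeaf G x → turn G x ≡ opp g → ∀ m → pos G (x ∷ʳ m) → σ (x ∷ʳ m))

IsTotal : Player → Game → (List Move → Set) → Set
IsTotal g G σ = IsGStrategy g G σ ×
  (∀ x → σ x → NonLeaf G x → turn G x ≡ g → ∃[ m ] σ (x ∷ʳ m))

IsPartiallyWinning : Player → Game → (List Move → Set) → Set
IsPartiallyWinning g G σ = IsTotal g G σ × (∀ x → σ x → Leaf G x → win G x ≡ pl g)

IsWinning : Player → Game → (List Move → Set) → Set
IsWinning g G σ = IsPartiallyWinning g G σ ×
  (∀ α → (∀ k → σ (prefix α k)) → Side G g α)

HasWinning : Player → Game → Set₁
HasWinning g G = Σ[ σ ∈ (List Move → Set) ] IsWinning g G σ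

Determined : Game → Set₁
Determined G = Σ[ g ∈ Player ] HasWinning g G

-- Self-dual sets of parameters (as characteristic functions) and
-- assignments.  An I-assignment is given by a total η : Par → Player
-- whose values outside I are irrelevant.

SelfDual : (Par → Bool) → Set
SelfDual I = ∀ a → I (dual a) ≡ I a

IsAssignment : (Par → Bool) → (Par → Player) → Set
IsAssignment I η = ∀ a → T (I a) → η (dual a) ≡ opp (η a)

assignLabel : (Par → Bool) → (Par → Player) → Label → Label
assignLabel I η (pl g)  = pl g
assignLabel I η (par a) = if I a then pl (η a) else par a

assign : (Par → Bool) → (Par → Player) → Game → Game
assign I η G = record
  { pos = pos G ; turn = turn G ; win = λ x → assignLabel I η (win G x) ; winP = winP G }

-- a local position (G_j)_y of the root game G_j, j < n
LP : ℕ → Set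
LP n = Fin n × List Move

Ctx : ℕ → Set
Ctx n = List (LP n)

lk : ∀ {A : Set} → List A → ℕ → Maybe A
lk []       _       = nothing
lk (a ∷ as) zero    = just a
lk (a ∷ as) (suc i) = lk as i

extLP : ∀ {n} → LP n → Move → LP n
extLP (j , y) m = (j , y ∷ʳ m)

module _ {n : ℕ} (Γ : Fin n → Game) where

  Atomic : LP n → Set
  Atomic (j , y) = ∀ m → ¬ pos (Γ j) (y ∷ʳ m)

  IsEND : LP n → Label → Set
  IsEND (j , y) x = Atomic (j , y) × win (Γ j) y ≡ x

  ENDat : Ctx n → ℕ → Label → Set
  ENDat ctx i x = Σ[ lp ∈ LP n ] lk ctx i ≡ just lp × IsEND lp x

  AtomicAt : Ctx n → ℕ → Set
  AtomicAt ctx i = Σ[ lp ∈ LP n ] lk ctx i ≡ just lp × Atomic lp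

  FVΓ : Par → Set
  FVΓ a = Σ[ i ∈ Fin n ] FV (Γ i) a

  rootCtx : Ctx n
  rootCtx = map (λ j → (j , [])) (allFin n)

  module _ (I : Par → Bool) where

    StopOK : Label → Set
    StopOK (pl g)  = ⊤
    StopOK (par a) = FVΓ a × ¬ T (I a)

    -- positions of ∀I.Γ from a P-position with local positions ctx
    ForPos : Ctx n → List Move → Set
    ForPos ctx [] = ⊤
    ForPos ctx (DROP q ∷ r) = q ≡ length ctx × r ≡ []
    ForPos ctx (EM i j ∷ r) =
      Σ[ a ∈ Par ] ENDat ctx i (par a) × ENDat ctx j (par (dual a)) × T (I a) × r ≡ []
    ForPos ctx (STOP i ∷ r) = Σ[ x ∈ Label ] ENDat ctx i x × StopOK x × r ≡ []
    ForPos ctx (JUST i q ∷ []) =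
      q ≡ length ctx × (Σ[ lp ∈ LP n ] lk ctx i ≡ just lp × ¬ Atomic lp)
    ForPos ctx (JUST i q ∷ m ∷ r) =
      q ≡ length ctx ×
      (Σ[ lp ∈ LP n ] lk ctx i ≡ just lp × ¬ Atomic lp ×
         pos (Γ (proj₁ lp)) (proj₂ lp ∷ʳ m) × ForPos (ctx ∷ʳ extLP lp m) r)
    ForPos ctx (nth _ ∷ r) = ⊥

    turnF : Ctx n → List Move → Player
    turnF ctx (JUST i q ∷ []) with lk ctx i
    ... | just (j , y) = turn (Γ j) y
    ... | nothing      = P
    turnF ctx (JUST i q ∷ m ∷ r) with lk ctx i
    ... | just lp = turnF (ctx ∷ʳ extLP lp m) r
    ... | nothing = P
    turnF ctx _ = P

    winF : Ctx n → List Move → Label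
    winF ctx (DROP _ ∷ _) = pl O
    winF ctx (EM _ _ ∷ _) = pl P
    winF ctx (STOP i ∷ _) with lk ctx i
    ... | just (j , y) = win (Γ j) y
    ... | nothing      = pl O
    winF ctx (JUST i q ∷ m ∷ r) with lk ctx i
    ... | just lp = winF (ctx ∷ʳ extLP lp m) r
    ... | nothing = pl O
    winF ctx _ = pl O

    -- G_P of ∀I.Γ: some infinite q ≺_i α (i < n) with q ∈ (G_i)_P
    winPF : (ℕ → Move) → Set
    winPF α = Σ[ i ∈ Fin n ] Σ[ q ∈ (ℕ → Move) ] Σ[ js ∈ (ℕ → ℕ) ]
      js 0 ≡ toℕ i ×
      (∀ s → Σ[ k ∈ ℕ ] α (2 * k) ≡ JUST (js s) (js (suc s)) × α (suc (2 * k)) ≡ q s) ×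
      winP (Γ i) q

    ForAll : Game
    ForAll = record
      { pos = ForPos rootCtx ; turn = turnF rootCtx ; win = winF rootCtx ; winP = winPF }

Triple : Set
Triple = ℕ × Move × ℕ

module _ {n : ℕ} (Γ : Fin n → PGame) (I : Par → Bool) where

  private
    Γ' : Fin n → Game
    Γ' j = game (Γ j)

  InJ : ℕ → Move → List Triple → Set
  InJ i m J = Any (λ t → proj₁ t ≡ i × proj₁ (proj₂ t) ≡ m) J

  NoTriple : ℕ → List Triple → Set
  NoTriple i J = ¬ Any (λ t → proj₁ t ≡ i) J

  FirstFresh : LP n → ℕ → List Triple → Move → Set
  FirstFresh (j , y) i J m = Σ[ k ∈ ℕ ] enum (Γ j) y k ≡ just m × ¬ InJ i m J ×
    (∀ k' m' → k' < k → enum (Γ j) y k' ≡ just m' → InJ i m' J)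

  EMcond : Ctx n → ℕ → ℕ → Par → ℕ → Set
  EMcond ctx c i a j = ENDat Γ' ctx i (par a) × T (I a) × j < c ×
    ENDat Γ' ctx j (par (dual a)) × (∀ j' → j' < j → ¬ ENDat Γ' ctx j' (par (dual a)))

  -- Exh i c ctx J p :  p ∈ exh(i , c , q , J) where q = length ctx and
  -- ctx = G_0 , … , G_{q-1} are the current local positions.
  data Exh : ℕ → ℕ → Ctx n → List Triple → List Move → Set where
    repeat : ∀ {i c ctx J p} → i ≡ c → c < length ctx →
      Exh 0 (length ctx) ctx J p → Exh i c ctx J p
    drop0 : ∀ {i c ctx J} → i ≡ c → c ≡ length ctx → Exh i c ctx J []
    drop1 : ∀ {i c ctx J} → i ≡ c → c ≡ length ctx →
      Exh i c ctx J (DROP (length ctx) ∷ [])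
    em0 : ∀ {i c ctx J} a j → i < c → EMcond ctx c i a j → Exh i c ctx J []
    em1 : ∀ {i c ctx J} a j → i < c → EMcond ctx c i a j → Exh i c ctx J (EM i j ∷ [])
    stop0 : ∀ {i c ctx J} → i < c → ENDat Γ' ctx i (pl P) → Exh i c ctx J []
    stop1 : ∀ {i c ctx J} → i < c → ENDat Γ' ctx i (pl P) → Exh i c ctx J (STOP i ∷ [])
    skip : ∀ {i c ctx J p} → i < c → AtomicAt Γ' ctx i →
      (∀ a j → ¬ EMcond ctx c i a j) → ¬ ENDat Γ' ctx i (pl P) →
      Exh (suc i) c ctx J p → Exh i c ctx J p
    tryP0 : ∀ {i c ctx J} j y m → i < c → lk ctx i ≡ just (j , y) → ¬ Atomic Γ' (j , y) →
      turn (Γ' j) y ≡ P → FirstFresh (j , y) i J m → Exh i c ctx J []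
    tryP1 : ∀ {i c ctx J} j y m → i < c → lk ctx i ≡ just (j , y) → ¬ Atomic Γ' (j , y) →
      turn (Γ' j) y ≡ P → FirstFresh (j , y) i J m →
      Exh i c ctx J (JUST i (length ctx) ∷ [])
    tryP2 : ∀ {i c ctx J p} j y m → i < c → lk ctx i ≡ just (j , y) → ¬ Atomic Γ' (j , y) →
      turn (Γ' j) y ≡ P → FirstFresh (j , y) i J m →
      Exh (suc i) c (ctx ∷ʳ (j , y ∷ʳ m)) (J ∷ʳ (i , m , length ctx)) p →
      Exh i c ctx J (JUST i (length ctx) ∷ m ∷ p)
    tryPskip : ∀ {i c ctx J p} j y → i < c → lk ctx i ≡ just (j , y) → ¬ Atomic Γ' (j , y) →
      turn (Γ' j) y ≡ P → (∀ m → pos (Γ' j) (y ∷ʳ m) → InJ i m J) →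
      Exh (suc i) c ctx J p → Exh i c ctx J p
    tryO0 : ∀ {i c ctx J} j y → i < c → lk ctx i ≡ just (j , y) → ¬ Atomic Γ' (j , y) →
      turn (Γ' j) y ≡ O → NoTriple i J → Exh i c ctx J []
    tryO1 : ∀ {i c ctx J} j y → i < c → lk ctx i ≡ just (j , y) → ¬ Atomic Γ' (j , y) →
      turn (Γ' j) y ≡ O → NoTriple i J → Exh i c ctx J (JUST i (length ctx) ∷ [])
    tryO2 : ∀ {i c ctx J p} j y m → i < c → lk ctx i ≡ just (j , y) → ¬ Atomic Γ' (j , y) →
      turn (Γ' j) y ≡ O → NoTriple i J → pos (Γ' j) (y ∷ʳ m) →
      Exh (suc i) c (ctx ∷ʳ (j , y ∷ʳ m)) (J ∷ʳ (i , m , length ctx)) p →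
      Exh i c ctx J (JUST i (length ctx) ∷ m ∷ p)
    tryOskip : ∀ {i c ctx J p} j y → i < c → lk ctx i ≡ just (j , y) → ¬ Atomic Γ' (j , y) →
      turn (Γ' j) y ≡ O → ¬ NoTriple i J →
      Exh (suc i) c ctx J p → Exh i c ctx J p

  EXH : List Move → Set
  EXH p = Exh 0 n (rootCtx Γ') [] p

-- Primitive recursive functions relative to oracles.
-- Four unary oracles encode the finitary parts of G_0 … G_{n-1}:
--   oracle 0 : |G_i|  (characteristic function),   oracle 1 : turn_{G_i},
--   oracle 2 : win_{G_i},                          oracle 3 : enumeration of children.

data PR : ℕ → Set where
  zer : ∀ {k} → PR k
  sc  : PR 1
  prj : ∀ {k} → Fin k → PR k
  cmp : ∀ {k m} → PR m → Vec (PR k) m → PR k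
  rec : ∀ {k} → PR k → PR (suc (suc k)) → PR (suc k)
  orc : Fin 4 → PR 1

Oracles : Set
Oracles = Fin 4 → ℕ → ℕ

mutual
  evalPR : ∀ {k} → Oracles → PR k → Vec ℕ k → ℕ
  evalPR or zer       xs       = 0
  evalPR or sc        (x ∷ []) = suc x
  evalPR or (prj i)   xs       = vlookup xs i
  evalPR or (cmp f gs) xs      = evalPR or f (evalVec or gs xs)
  evalPR or (rec g h) (y ∷ xs) = iterPR or g h y xs
  evalPR or (orc o)   (x ∷ []) = or o x

  evalVec : ∀ {k m} → Oracles → Vec (PR k) m → Vec ℕ k → Vec ℕ m
  evalVec or []       xs = []
  evalVec or (g ∷ gs) xs = evalPR or g xs ∷ evalVec or gs xs

  iterPR : ∀ {k} → Oracles → PR k → PR (suc (suc k)) → ℕ → Vec ℕ k → ℕ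
  iterPR or g h zero    xs = evalPR or g xs
  iterPR or g h (suc y) xs = evalPR or h (y ∷ iterPR or g h y xs ∷ xs)

pair : ℕ → ℕ → ℕ
pair a b = 2 ^ a * suc (2 * b)

codeMove : Move → ℕ
codeMove (DROP a)   = 5 * a
codeMove (EM a b)   = suc (5 * pair a b)
codeMove (STOP a)   = 2 + 5 * a
codeMove (JUST a b) = 3 + 5 * pair a b
codeMove (nth a)    = 4 + 5 * a

codeList : List Move → ℕ
codeList []       = 0
codeList (m ∷ x) = suc (pair (codeMove m) (codeList x))

codePlayer : Player → ℕ
codePlayer P = 0
codePlayer O = 1

codeBool : Bool → ℕ
codeBool false = 0
codeBool true  = 1

codeLabel : Label → ℕ
codeLabel (pl g)        = codePlayer g
codeLabel (par (k , b)) = 2 + (2 * k + codeBool b)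

codeMaybe : Maybe Move → ℕ
codeMaybe nothing  = 0
codeMaybe (just m) = suc (codeMove m)

o0 o1 o2 o3 : Fin 4
o0 = fz
o1 = fs fz
o2 = fs (fs fz)
o3 = fs (fs (fs fz))

Agrees : ∀ {n} → (Fin n → PGame) → Oracles → Set
Agrees {n} Γ or =
  (∀ i x → (pos (game (Γ i)) x → or o0 (pair (toℕ i) (codeList x)) ≡ 1) ×
           (¬ pos (game (Γ i)) x → or o0 (pair (toℕ i) (codeList x)) ≡ 0)) ×
  (∀ i x → NonLeaf (game (Γ i)) x →
           or o1 (pair (toℕ i) (codeList x)) ≡ codePlayer (turn (game (Γ i)) x)) ×
  (∀ i x → Leaf (game (Γ i)) x →
           or o2 (pair (toℕ i) (codeList x)) ≡ codeLabel (win (game (Γ i)) x)) ×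
  (∀ i x k → pos (game (Γ i)) x →
           or o3 (pair (toℕ i) (pair (codeList x) k)) ≡ codeMaybe (enum (Γ i) x k))

PrimRecRel : ∀ {n} → (Fin n → PGame) → (List Move → Set) → Set
PrimRecRel Γ σ = Σ[ e ∈ PR 1 ] ∀ or → Agrees Γ or → ∀ x →
  (σ x → evalPR or e (codeList x ∷ []) ≡ 1) × (¬ σ x → evalPR or e (codeList x ∷ []) ≡ 0)

{-# OPTIONS --safe #-}
module Submission where

-- If some play of EXH is not won by P, the local positions it reaches form, in each
-- G_j, a strategy for O: EXH tries every move at a local P-position and meets one
-- answer at a local O-position. Since EXH never found END(P) nor a dual pair END(a),
-- END(a^⊥), there is an assignment η sending every parameter met on that play to O;
-- it makes these strategies O-winning in η(G_j), and O wins ∀I.Γ by answering inside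
-- them. So either EXH or that strategy of O wins, and both players cannot win.
--
-- Membership in EXH is decided by simulating its clauses on the given list of moves,
-- with fuel quadratic in n plus its length. No oracle for I is needed: since
-- FV(∀I.Γ) = ∅, every parameter labelling a leaf of some G_j lies in I.

open import Defs
open import Level using (Level; 0ℓ)
open import Axiom.ExcludedMiddle using (ExcludedMiddle)
open import Data.Nat
open import Data.Nat.Properties
open import Data.Nat.DivMod using (_%_; [m+kn]%n≡m%n)
open import Data.Bool using (Bool; true; false; T; if_then_else_)
open import Data.Fin using (Fin; toℕ) renaming (zero to fz; suc to fs)
open import Data.Fin.Properties using (toℕ<n; toℕ-injective; injective⇒≤)
open import Data.List using (List; []; _∷_; _∷ʳ_; _++_; length; map; allFin; tabulate; lookup; foldl; reverse)
open import Data.List.Properties using (++-assoc; ++-identityʳ; length-++; length-map; length-tabulate; map-++; unfold-reverse; reverse-involutive)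
open import Data.List.Membership.Propositional using (_∈_; find; lose)
open import Data.List.Membership.Propositional.Properties using (∈-++⁺ˡ; ∈-++⁺ʳ; ∈-++⁻)
open import Data.List.Relation.Unary.Any as Any using (Any; here; there; index)
open import Data.List.Relation.Unary.Any.Properties using (lookup-index)
open import Data.Maybe using (Maybe; just; nothing)
open import Data.Maybe.Properties using (just-injective)
open import Data.Product using (Σ-syntax; ∃-syntax; _×_; _,_; proj₁; proj₂)
open import Data.Unit using (⊤; tt)
open import Data.Sum using (_⊎_; inj₁; inj₂)
open import Data.Empty using (⊥; ⊥-elim)
open import Relation.Binary.Definitions using (tri<; tri≈; tri>)
open import Relation.Nullary using (¬_; yes; no)
open import Relation.Binary.PropositionalEquality using (_≡_; refl; sym; trans; cong; cong₂; subst)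

-- The sets `winP` are arbitrary, so no topological determinacy theorem applies; the alternative is
-- whether a `LostRun` exists. In a single play P may follow many branches of each G_j in parallel,
-- so the play is read through its triples `(l , m , k)`: move m from index l led to index k. As exh
-- never tries a move twice at the same index, a list of moves determines its chain of indices. An
-- infinite branch of a local O-strategy is therefore one infinite chain, exactly what `winPF`
-- speaks of, and no compactness argument intervenes. Fairness rests on the bound c, frozen during a
-- pass: each pass ends, and the next one covers every index added meanwhile.
--
-- REPEAT and SKIP consume no move. Hence neither the membership of the empty position in the
-- inductive `Exh` nor a decision by reading the list is immediate. Both depend on one observation:
-- a pass begun by REPEAT that adds no local position, and meets no EM or STOP, ends in DROP.

LEM : Set₁
LEM = ExcludedMiddle 0ℓ

dne : LEM → {A : Set} → ¬ ¬ A → A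
dne lem {A} nn with lem {A}
... | yes a = a
... | no na = ⊥-elim (nn na)

least : LEM → (Q : ℕ → Set) → ∀ k → Q k → Σ[ j ∈ ℕ ] j ≤ k × Q j × (∀ i → i < j → ¬ Q i)
least lem Q zero q = 0 , z≤n , q , λ _ ()
least lem Q (suc k) q with lem {Q 0}
... | yes q0 = 0 , z≤n , q0 , λ _ ()
... | no ¬q0 with least lem (λ i → Q (suc i)) k q
... | j , j≤k , qj , min = suc j , s≤s j≤k , qj , λ { zero _ → ¬q0 ; (suc i) (s≤s i<j) → min i i<j }

-- Lists and infinite sequences

++-[]ˡ : ∀ {A : Set} (x : List A) {y} → x ++ y ≡ [] → x ≡ []
++-[]ˡ [] _ = refl

prefix-snoc : ∀ α k → prefix α (suc k) ≡ prefix α k ∷ʳ α k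
prefix-snoc α zero = refl
prefix-snoc α (suc k) = cong (α 0 ∷_) (prefix-snoc (λ i → α (suc i)) k)

prefix-cong : ∀ {α β : ℕ → Move} → (∀ i → α i ≡ β i) → ∀ k → prefix α k ≡ prefix β k
prefix-cong e zero = refl
prefix-cong e (suc k) = cong₂ _∷_ (e 0) (prefix-cong (λ i → e (suc i)) k)

-- The rest of `α` after `u` rounds. A round takes two moves, a JUST and its answer, whence the
-- factor 2.
shift : ℕ → (ℕ → Move) → ℕ → Move
shift u α s = α (2 * u + s)

shift-suc : ∀ u α k → prefix (λ s → shift u α (2 + s)) k ≡ prefix (shift (suc u) α) k
shift-suc u α = prefix-cong λ s → cong α (trans (sym (+-assoc (2 * u) 2 s))
  (cong (_+ s) (trans (+-comm (2 * u) 2) (sym (*-suc 2 u)))))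

lk-< : ∀ {A : Set} (xs : List A) {l a} → lk xs l ≡ just a → l < length xs
lk-< (x ∷ xs) {zero} e = s≤s z≤n
lk-< (x ∷ xs) {suc l} e = s≤s (lk-< xs e)

lk-defined : ∀ {A : Set} (xs : List A) {l} → l < length xs → Σ[ a ∈ A ] lk xs l ≡ just a
lk-defined (x ∷ xs) {zero} _ = x , refl
lk-defined (x ∷ xs) {suc l} (s≤s p) = lk-defined xs p

lk-++ : ∀ {A : Set} (xs : List A) {ys l a} → lk xs l ≡ just a → lk (xs ++ ys) l ≡ just a
lk-++ (x ∷ xs) {l = zero} e = e
lk-++ (x ∷ xs) {l = suc l} e = lk-++ xs e

lk-last : ∀ {A : Set} (xs : List A) {a} → lk (xs ∷ʳ a) (length xs) ≡ just a
lk-last [] = refl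
lk-last (x ∷ xs) = lk-last xs

lk-snoc⁻ : ∀ {A : Set} (xs : List A) {b l a} → lk (xs ∷ʳ b) l ≡ just a →
  lk xs l ≡ just a ⊎ (l ≡ length xs × a ≡ b)
lk-snoc⁻ [] {l = zero} e = inj₂ (refl , sym (just-injective e))
lk-snoc⁻ (x ∷ xs) {l = zero} e = inj₁ e
lk-snoc⁻ (x ∷ xs) {l = suc l} e with lk-snoc⁻ xs e
... | inj₁ p = inj₁ p
... | inj₂ (p , q) = inj₂ (cong suc p , q)

lk-fun : ∀ {A : Set} {xs : List A} {l a b} → lk xs l ≡ just a → lk xs l ≡ just b → a ≡ b
lk-fun p q = just-injective (trans (sym p) q)

lk-map-tabulate : ∀ {A B : Set} {n} (f : A → B) (g : Fin n → A) i →
  lk (map f (tabulate g)) (toℕ i) ≡ just (f (g i))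
lk-map-tabulate f g fz = refl
lk-map-tabulate f g (fs i) = lk-map-tabulate f (λ j → g (fs j)) i

lk-map-tabulate⁻ : ∀ {A B : Set} {n} (f : A → B) (g : Fin n → A) {l b} →
  lk (map f (tabulate g)) l ≡ just b → Σ[ i ∈ Fin n ] l ≡ toℕ i × b ≡ f (g i)
lk-map-tabulate⁻ {n = suc n} f g {zero} e = fz , refl , sym (just-injective e)
lk-map-tabulate⁻ {n = suc n} f g {suc l} e with lk-map-tabulate⁻ f (λ j → g (fs j)) e
... | i , p , q = fs i , cong suc p , q

length-snoc : ∀ {A : Set} (xs : List A) {a} → length (xs ∷ʳ a) ≡ suc (length xs)
length-snoc xs = trans (length-++ xs) (+-comm (length xs) 1)

module Root {n : ℕ} (Γ : Fin n → Game) where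

  rootCtx-lk : ∀ j → lk (rootCtx Γ) (toℕ j) ≡ just (j , [])
  rootCtx-lk = lk-map-tabulate (λ j → (j , [])) (λ j → j)

  rootCtx-lk⁻ : ∀ {l lp} → lk (rootCtx Γ) l ≡ just lp → Σ[ j ∈ Fin n ] l ≡ toℕ j × lp ≡ (j , [])
  rootCtx-lk⁻ = lk-map-tabulate⁻ (λ j → (j , [])) (λ j → j)

  rootCtx-length : length (rootCtx Γ) ≡ n
  rootCtx-length = trans (length-map _ (allFin n)) (length-tabulate (λ j → j))

-- Plays of two strategies against each other

leaf? : LEM → ∀ G x → pos G x → Leaf G x ⊎ NonLeaf G x
leaf? lem G x px with lem {∃[ m ] pos G (x ∷ʳ m)}
... | yes e = inj₂ (px , e)
... | no ¬e = inj₁ (px , λ m q → ¬e (m , q))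

module Exclusive (lem : LEM) (G : Game) {σ τ : List Move → Set}
  (wσ : IsWinning P G σ) (wτ : IsWinning O G τ) where

  private
    gσ : IsGStrategy P G σ
    gσ = proj₁ (proj₁ (proj₁ wσ))
    gτ : IsGStrategy O G τ
    gτ = proj₁ (proj₁ (proj₁ wτ))

    Common : Set
    Common = Σ[ x ∈ List Move ] σ x × τ x

    pos-σ : ∀ x → σ x → pos G x
    pos-σ = proj₂ (proj₂ (proj₁ gσ))
    pos-τ : ∀ x → τ x → pos G x
    pos-τ = proj₂ (proj₂ (proj₁ gτ))

    -- A common leaf would carry both labels, so somebody is to move. The mover's totality gives a
    -- move, and the other strategy contains it because it admits every move of its opponent.
    move : ∀ x → σ x → τ x → Σ[ m ∈ Move ] σ (x ∷ʳ m) × τ (x ∷ʳ m)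
    move x sx tx with leaf? lem G x (pos-σ x sx)
    ... | inj₁ lf with trans (sym (proj₂ (proj₁ wσ) x sx lf)) (proj₂ (proj₁ wτ) x tx lf)
    ...   | ()
    move x sx tx | inj₂ nl with turn G x in eq
    ... | P = let (m , s) = proj₂ (proj₁ (proj₁ wσ)) x sx nl eq in
              m , s , proj₂ gτ x tx nl eq m (pos-σ _ s)
    ... | O = let (m , t) = proj₂ (proj₁ (proj₁ wτ)) x tx nl eq in
              m , proj₂ gσ x sx nl eq m (pos-τ _ t) , t

    play : ℕ → Common
    play zero = [] , proj₁ (proj₁ gσ) , proj₁ (proj₁ gτ)
    play (suc k) = let (x , s , t) = play k ; (m , s' , t') = move x s t in x ∷ʳ m , s' , t'

    α : ℕ → Move
    α k = let (x , s , t) = play k in proj₁ (move x s t)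

    play-prefix : ∀ k → prefix α k ≡ proj₁ (play k)
    play-prefix zero = refl
    play-prefix (suc k) = trans (prefix-snoc α k) (cong (_∷ʳ α k) (play-prefix k))

  exclusive : ⊥
  exclusive = proj₂ wτ α (λ k → subst τ (sym (play-prefix k)) (proj₂ (proj₂ (play k))))
                (proj₂ wσ α (λ k → subst σ (sym (play-prefix k)) (proj₁ (proj₂ (play k)))))

-- Positions and infinite plays of ∀I.Γ

module Play {n : ℕ} (Γ : Fin n → Game) (I : Par → Bool) where

  open Root Γ

  Pos : Ctx n → List Move → Set
  Pos = ForPos Γ I

  turnF-answer : ∀ {ctx i q j y} → lk ctx i ≡ just (j , y) →
    turnF Γ I ctx (JUST i q ∷ []) ≡ turn (Γ j) y
  turnF-answer e rewrite e = refl

  turnF-later : ∀ {ctx i q m r lp} → lk ctx i ≡ just lp →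
    turnF Γ I ctx (JUST i q ∷ m ∷ r) ≡ turnF Γ I (ctx ∷ʳ extLP lp m) r
  turnF-later e rewrite e = refl

  winF-later : ∀ {ctx i q m r lp} → lk ctx i ≡ just lp →
    winF Γ I ctx (JUST i q ∷ m ∷ r) ≡ winF Γ I (ctx ∷ʳ extLP lp m) r
  winF-later e rewrite e = refl

  winF-stop : ∀ {ctx i r j y} → lk ctx i ≡ just (j , y) → winF Γ I ctx (STOP i ∷ r) ≡ win (Γ j) y
  winF-stop e rewrite e = refl

  forPos-prefix : ∀ ctx x y → Pos ctx (x ++ y) → Pos ctx x
  forPos-prefix ctx [] y p = tt
  forPos-prefix ctx (DROP q ∷ x) y (e , r) = e , ++-[]ˡ x r
  forPos-prefix ctx (EM i j ∷ x) y (a , p , q , t , r) = a , p , q , t , ++-[]ˡ x r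
  forPos-prefix ctx (STOP i ∷ x) y (a , p , q , r) = a , p , q , ++-[]ˡ x r
  forPos-prefix ctx (JUST i q ∷ []) [] p = p
  forPos-prefix ctx (JUST i q ∷ []) (m ∷ y) (e , lp , l , na , _) = e , lp , l , na
  forPos-prefix ctx (JUST i q ∷ m ∷ x) y (e , lp , l , na , p , r) =
    e , lp , l , na , p , forPos-prefix (ctx ∷ʳ extLP lp m) x y r

  -- The game as seen from a P-position with local positions `ctx`: statements about leaves can then
  -- follow the play by recursion, with the context as a parameter.
  FA : Ctx n → Game
  FA ctx = record { pos = Pos ctx ; turn = turnF Γ I ctx ; win = winF Γ I ctx ; winP = winPF Γ I }

  no-leaf-root : ∀ {ctx} → ¬ Leaf (FA ctx) []
  no-leaf-root {ctx} (_ , f) = f (DROP (length ctx)) (refl , refl)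

  module _ (α : ℕ → Move) where

    record Stage (ctx : Ctx n) (u : ℕ) : Set where
      field
        legal : ∀ k → Pos ctx (prefix (shift u α) k)

    record Round (ctx : Ctx n) (u : ℕ) : Set where
      field
        idx    : ℕ
        lp     : LP n
        move₀  : shift u α 0 ≡ JUST idx (length ctx)
        found  : lk ctx idx ≡ just lp
        after  : Stage (ctx ∷ʳ extLP lp (shift u α 1)) (suc u)

    -- Looking two moves ahead rules out DROP, EM and STOP, after which nothing may follow. An
    -- infinite play thus consists of JUST moves and their answers.
    round : ∀ {ctx u} → Stage ctx u → Round ctx u
    round {ctx} {u} st with shift u α 0 in eq | Stage.legal st 2 | (λ k → Stage.legal st (2 + k))
    ... | DROP _  | _ , () | _
    ... | EM _ _  | _ , _ , _ , _ , () | _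
    ... | STOP _  | _ , _ , _ , () | _
    ... | JUST i q | refl , lp , l , na , _ , _ | all = record
      { idx = i ; lp = lp ; move₀ = eq ; found = l
      ; after = record { legal = λ k → go k (all k) } }
      where
      go : ∀ k → Pos ctx (JUST i q ∷ prefix (λ s → shift u α (suc s)) (suc k)) → Pos (ctx ∷ʳ extLP lp (shift u α 1)) (prefix (shift (suc u) α) k)
      go k (_ , lp' , l' , _ , _ , r) with lk-fun {xs = ctx} l l'
      ... | refl = subst (Pos _) (shift-suc u α k) r

    module _ (all : ∀ k → Pos (rootCtx Γ) (prefix α k)) where

      stages : ℕ → Σ[ ctx ∈ Ctx n ] Σ[ u ∈ ℕ ] Stage ctx u
      stages zero = rootCtx Γ , 0 , record { legal = all }
      stages (suc k) = let (ctx , u , st) = stages k in _ , suc u , Round.after (round st)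

      ctxAt : ℕ → Ctx n
      ctxAt k = proj₁ (stages k)

      stage-index : ∀ k → proj₁ (proj₂ (stages k)) ≡ k
      stage-index zero = refl
      stage-index (suc k) = cong suc (stage-index k)

      ctxAt-mono : ∀ {k k' l lp} → k ≤′ k' → lk (ctxAt k) l ≡ just lp → lk (ctxAt k') l ≡ just lp
      ctxAt-mono ≤′-refl e = e
      ctxAt-mono {k' = suc k'} (≤′-step p) e = lk-++ (ctxAt k') (ctxAt-mono p e)

      At : ℕ → LP n → Set
      At l lp = Σ[ k ∈ ℕ ] lk (ctxAt k) l ≡ just lp

      at-fun : ∀ {l a b} → At l a → At l b → a ≡ b
      at-fun {l} (k , p) (k' , q) with ≤-total k k'
      ... | inj₁ le = lk-fun {xs = ctxAt k'} (ctxAt-mono (≤⇒≤′ le) p) q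
      ... | inj₂ le = lk-fun {xs = ctxAt k} p (ctxAt-mono (≤⇒≤′ le) q)

      at-step : ∀ {l l' lp m} k → α (2 * k) ≡ JUST l l' → α (suc (2 * k)) ≡ m → At l lp →
        At l' (extLP lp m)
      at-step {l} {l'} {lp} {m} k e₀ e₁ at with stages k in eq | stage-index k
      ... | ctx , u , st | refl = suc k , subst (λ s → lk (proj₁ s) l' ≡ just (extLP lp m)) (sym eq') added
        where
        R = round st
        just-eq : JUST (Round.idx R) (length ctx) ≡ JUST l l'
        just-eq = trans (sym (Round.move₀ R)) (trans (cong α (+-identityʳ (2 * k))) e₀)
        at-idx : ∀ {i q} → JUST i q ≡ JUST l l' → lk ctx i ≡ just (Round.lp R) → Round.lp R ≡ lp
        at-idx refl f = at-fun (k , trans (cong (λ s → lk (proj₁ s) l) eq) f) at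
        ext-eq : extLP (Round.lp R) (shift u α 1) ≡ extLP lp m
        ext-eq = cong₂ extLP (at-idx just-eq (Round.found R)) (trans (cong α (+-comm (2 * k) 1)) e₁)
        eq' : stages (suc k) ≡ (ctx ∷ʳ extLP (Round.lp R) (shift u α 1) , suc u , Round.after R)
        eq' rewrite eq = refl
        idx-eq : ∀ {i q} → JUST i q ≡ JUST l l' → q ≡ l'
        idx-eq refl = refl
        added : lk (ctx ∷ʳ extLP (Round.lp R) (shift u α 1)) l' ≡ just (extLP lp m)
        added = trans (cong (lk (ctx ∷ʳ extLP (Round.lp R) (shift u α 1))) (sym (idx-eq just-eq))) (trans (lk-last ctx) (cong just ext-eq))

      -- Justifies reading a witness of `winPF` as a branch of one game: the two moves of a round
      -- are a link j ⊢ k, so the index `js s` must name the node `prefix q s` of `Γ i`.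
      thread-at : ∀ {i} {q : ℕ → Move} {js : ℕ → ℕ} → js 0 ≡ toℕ i →
        (∀ s → Σ[ k ∈ ℕ ] α (2 * k) ≡ JUST (js s) (js (suc s)) × α (suc (2 * k)) ≡ q s) →
        ∀ s → At (js s) (i , prefix q s)
      thread-at {i} e st zero = 0 , trans (cong (lk (rootCtx Γ)) e) (rootCtx-lk i)
      thread-at {i} {q} {js} e st (suc s) = let (k , e₀ , e₁) = st s in
        subst (λ z → At (js (suc s)) (i , z)) (sym (prefix-snoc q s))
          (at-step k e₀ e₁ (thread-at {i} {q} {js} e st s))

-- O answers each JUST(i , q) inside the strategy for the game that G_i comes from.

module Opponent (lem : LEM) {n : ℕ} (Γ : Fin n → Game) (I : Par → Bool) (sd : SelfDual I)
  (η : Par → Player) (asg : IsAssignment I η)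
  (τ : ∀ j → HasWinning O (assign I η (Γ j))) where

  open Play Γ I
  open Root Γ

  Inτ : LP n → Set
  Inτ (j , y) = proj₁ (τ j) y

  private
    isG : ∀ j → IsGStrategy O (assign I η (Γ j)) (proj₁ (τ j))
    isG j = proj₁ (proj₁ (proj₁ (proj₂ (τ j))))
    t-pos : ∀ j y → Inτ (j , y) → pos (Γ j) y
    t-pos j = proj₂ (proj₂ (proj₁ (isG j)))

  record Inside (ctx : Ctx n) : Set where
    constructor mkInside
    field ins : ∀ {l lp} → lk ctx l ≡ just lp → Inτ lp

  inside-root : Inside (rootCtx Γ)
  inside-root = mkInside go
    where
    go : ∀ {l lp} → lk (rootCtx Γ) l ≡ just lp → Inτ lp
    go e with rootCtx-lk⁻ e
    ... | j , _ , refl = proj₁ (proj₁ (isG j))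

  inside-snoc : ∀ {ctx lp} → Inside ctx → Inτ lp → Inside (ctx ∷ʳ lp)
  inside-snoc {ctx} {lp₀} (mkInside ins) t = mkInside go
    where
    go : ∀ {l lp} → lk (ctx ∷ʳ lp₀) l ≡ just lp → Inτ lp
    go e with lk-snoc⁻ ctx e
    ... | inj₁ p = ins p
    ... | inj₂ (_ , refl) = t

  Ok : Ctx n → List Move → Set
  Ok ctx (JUST i q ∷ m ∷ r) =
    ∀ lp → lk ctx i ≡ just lp → Inτ (extLP lp m) × Ok (ctx ∷ʳ extLP lp m) r
  Ok ctx _ = ⊤

  ok-prefix : ∀ ctx x y → Ok ctx (x ++ y) → Ok ctx x
  ok-prefix ctx [] y p = tt
  ok-prefix ctx (DROP _ ∷ x) y p = tt
  ok-prefix ctx (EM _ _ ∷ x) y p = tt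
  ok-prefix ctx (STOP _ ∷ x) y p = tt
  ok-prefix ctx (nth _ ∷ x) y p = tt
  ok-prefix ctx (JUST i q ∷ []) y p = tt
  ok-prefix ctx (JUST i q ∷ m ∷ x) y p lp e =
    proj₁ (p lp e) , ok-prefix _ x y (proj₂ (p lp e))

  ok-single : ∀ ctx m → Ok ctx (m ∷ [])
  ok-single ctx (DROP _) = tt
  ok-single ctx (EM _ _) = tt
  ok-single ctx (STOP _) = tt
  ok-single ctx (nth _) = tt
  ok-single ctx (JUST _ _) = tt

  nonLeaf : ∀ {j y m} → pos (Γ j) y → pos (Γ j) (y ∷ʳ m) → NonLeaf (assign I η (Γ j)) y
  nonLeaf p q = p , _ , q

  ok-P : ∀ ctx x m → Inside ctx → Ok ctx x → turnF Γ I ctx x ≡ P → Pos ctx (x ∷ʳ m) → Ok ctx (x ∷ʳ m)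
  ok-P ctx [] m ins ok tu p = ok-single ctx m
  ok-P ctx (DROP _ ∷ x) m ins ok tu p = tt
  ok-P ctx (EM _ _ ∷ x) m ins ok tu p = tt
  ok-P ctx (STOP _ ∷ x) m ins ok tu p = tt
  ok-P ctx (nth _ ∷ x) m ins ok tu p = tt
  ok-P ctx (JUST i q ∷ []) m ins ok tu (_ , (j , y) , e , na , p , _) lp e'
    with lk-fun {xs = ctx} e e'
  ... | refl = proj₂ (isG j) y (Inside.ins ins e) (nonLeaf (t-pos j y (Inside.ins ins e)) p)
                 (trans (sym (turnF-answer {ctx} {i} {q} e)) tu) m p , tt
  ok-P ctx (JUST i q ∷ m' ∷ x) m ins ok tu (_ , (j , y) , e , na , p , r) lp e'
    with lk-fun {xs = ctx} e e'
  ... | refl = let (t , o) = ok lp e' in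
    t , ok-P _ x m (inside-snoc ins t) o (trans (sym (turnF-later {ctx} {i} {q} {m'} {x} e)) tu) r

  ok-O : ∀ ctx x → Inside ctx → Pos ctx x → Ok ctx x → turnF Γ I ctx x ≡ O →
    Σ[ m ∈ Move ] Pos ctx (x ∷ʳ m) × Ok ctx (x ∷ʳ m)
  ok-O ctx (JUST i q ∷ []) ins (c , (j , y) , e , na) ok tu =
    let (m , t) = proj₂ (proj₁ (proj₁ (proj₂ (τ j)))) y (Inside.ins ins e)
                    (t-pos j y (Inside.ins ins e) , dne lem λ no → na λ m p → no (m , p))
                    (trans (sym (turnF-answer {ctx} {i} {q} e)) tu) in
    m , (c , (j , y) , e , na , t-pos j _ t , tt) ,
    λ { lp e' → subst (λ lp → Inτ (extLP lp m)) (lk-fun {xs = ctx} e e') t , tt }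
  ok-O ctx (JUST i q ∷ m' ∷ x) ins (c , lp , e , na , p , r) ok tu =
    let (t , o) = ok lp e
        (m , r' , o') = ok-O _ x (inside-snoc ins t) r o
                          (trans (sym (turnF-later {ctx} {i} {q} {m'} {x} e)) tu) in
    m , (c , lp , e , na , p , r') ,
    λ lp' e' → subst (λ lp → Inτ (extLP lp m') × Ok (ctx ∷ʳ extLP lp m') (x ∷ʳ m))
                 (lk-fun {xs = ctx} e e') (t , o')

  end-label : ∀ {ctx i x} → Inside ctx → ENDat Γ ctx i x → assignLabel I η x ≡ pl O
  end-label ins ((j , y) , e , at , refl) =
    proj₂ (proj₁ (proj₂ (τ j))) y (Inside.ins ins e) (t-pos j y (Inside.ins ins e) , at)

  O-par : ∀ {a} → T (I a) → assignLabel I η (par a) ≡ pl O → η a ≡ O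
  O-par {a} t e with I a
  O-par {a} t e | true with η a
  O-par t e | true | O = refl

  -- EM is impossible: its two local positions lie in the O-winning strategies, so `η` would send
  -- both `a` and `dual a` to O. For STOP, the label becomes O under `η`, and `StopOK` excludes
  -- parameters of `I`, so it was O from the start.
  ok-leaf : ∀ ctx x → Inside ctx → Leaf (FA ctx) x → Ok ctx x → winF Γ I ctx x ≡ pl O
  ok-leaf ctx [] ins lf ok = ⊥-elim (no-leaf-root lf)
  ok-leaf ctx (DROP _ ∷ x) ins lf ok = refl
  ok-leaf ctx (EM i j ∷ x) ins ((a , ei , ej , t , _) , _) ok
    with O-par t (end-label ins ei) | O-par (subst T (sym (sd a)) t) (end-label ins ej) | asg a t
  ... | p | q | r with trans (sym q) (trans r (cong opp p))
  ...   | ()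
  ok-leaf ctx (STOP i ∷ x) ins ((l , (lp , e , at , refl) , s , _) , _) ok
    with end-label ins (lp , e , at , refl)
  ... | el with win (Γ (proj₁ lp)) (proj₂ lp) in w
  ...   | pl g = trans (winF-stop {ctx} {i} {x} e) (trans w el)
  ...   | par a with I a
  ...     | true = ⊥-elim (proj₂ s tt)
  ok-leaf ctx (STOP i ∷ x) ins ((l , (lp , e , at , refl) , s , _) , _) ok | () | par a | false
  ok-leaf ctx (nth _ ∷ x) ins (() , _) ok
  ok-leaf ctx (JUST i q ∷ []) ins ((c , (j , y) , e , na) , f) ok =
    ⊥-elim (na λ m p → f m (c , (j , y) , e , na , p , tt))
  ok-leaf ctx (JUST i q ∷ m ∷ x) ins ((c , lp , e , na , p , r) , f) ok =
    let (t , o) = ok lp e in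
    trans (winF-later {ctx} {i} {q} {m} {x} e)
      (ok-leaf _ x (inside-snoc ins t) (r , λ m' r' → f m' (c , lp , e , na , p , r')) o)

  σ : List Move → Set
  σ x = Pos (rootCtx Γ) x × Ok (rootCtx Γ) x

  module _ (α : ℕ → Move) (all : ∀ k → σ (prefix α k)) where

    private
      legal : ∀ k → Pos (rootCtx Γ) (prefix α k)
      legal k = proj₁ (all k)

    inside-at : ∀ k → let (ctx , u , _) = stages α legal k in
      Inside ctx × (∀ r → Ok ctx (prefix (shift u α) r))
    inside-at zero = inside-root , λ r → proj₂ (all r)
    inside-at (suc k) with stages α legal k | inside-at k
    ... | ctx , u , st | ins , ok = inside-snoc ins (proj₁ (go 0)) , λ r → subst (Ok _) (shift-suc u α r) (proj₂ (go r))
      where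
      R = round α st
      go : ∀ r → Inτ (extLP (Round.lp R) (shift u α 1)) ×
           Ok (ctx ∷ʳ extLP (Round.lp R) (shift u α 1)) (prefix (λ s → shift u α (2 + s)) r)
      go r = subst (λ m → Ok ctx (m ∷ prefix (λ s → shift u α (suc s)) (suc r))) (Round.move₀ R)
               (ok (2 + r)) (Round.lp R) (Round.found R)

    -- By `thread-at` every prefix of `q` is a local position of the play and hence in `τ i`; an
    -- infinite branch of that strategy is won by O.
    O-side : ¬ winPF Γ I α
    O-side (i , q , js , e , st , w) =
      proj₂ (proj₂ (τ i)) q (λ s → let (k , p) = thread-at α legal {i} {q} {js} e st s in Inside.ins (proj₁ (inside-at k)) p) w

  wins : IsWinning O (ForAll Γ I) σ
  wins = (((strategy , answers) , moves) , λ x (p , o) lf → ok-leaf _ x inside-root lf o) , O-side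
    where
    strategy : IsStrategy (ForAll Γ I) σ
    strategy = (tt , tt) , (λ x y (p , o) → forPos-prefix _ x y p , ok-prefix _ x y o) , λ x → proj₁
    answers : ∀ x → σ x → NonLeaf (ForAll Γ I) x → turnF Γ I (rootCtx Γ) x ≡ P →
      ∀ m → Pos (rootCtx Γ) (x ∷ʳ m) → σ (x ∷ʳ m)
    answers x (p , o) nl tu m q = q , ok-P _ x m inside-root o tu q
    moves : ∀ x → σ x → NonLeaf (ForAll Γ I) x → turnF Γ I (rootCtx Γ) x ≡ O →
      ∃[ m ] σ (x ∷ʳ m)
    moves x (p , o) nl tu = ok-O _ x inside-root p o tu

-- The clauses of exh as a deterministic transition system

module Machine (lem : LEM) {n : ℕ} (Γ : Fin n → PGame) (I : Par → Bool) where

  Γ' : Fin n → Game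
  Γ' j = game (Γ j)

  open Play Γ' I
  open Root Γ'

  E : ℕ → ℕ → Ctx n → List Triple → List Move → Set
  E = Exh Γ I

  NonAtomicAt : Ctx n → ℕ → LP n → Player → Set
  NonAtomicAt ctx i (j , y) g = lk ctx i ≡ just (j , y) × ¬ Atomic Γ' (j , y) × turn (Γ' j) y ≡ g

  -- SKIP and the two "else" cases of TRYALL
  data Skip (i c : ℕ) (ctx : Ctx n) (J : List Triple) : Set where
    atom  : AtomicAt Γ' ctx i → (∀ a j → ¬ EMcond Γ I ctx c i a j) → ¬ ENDat Γ' ctx i (pl P) →
            Skip i c ctx J
    allP  : ∀ j y → NonAtomicAt ctx i (j , y) P → (∀ m → pos (Γ' j) (y ∷ʳ m) → InJ Γ I i m J) →
            Skip i c ctx J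
    someO : ∀ j y → NonAtomicAt ctx i (j , y) O → ¬ NoTriple Γ I i J → Skip i c ctx J

  data Visit (i c : ℕ) (ctx : Ctx n) (J : List Triple) : Set where
    em    : ∀ a j → EMcond Γ I ctx c i a j → Visit i c ctx J
    stop  : ENDat Γ' ctx i (pl P) → Visit i c ctx J
    pass  : Skip i c ctx J → Visit i c ctx J
    takeP : ∀ j y m → NonAtomicAt ctx i (j , y) P → FirstFresh Γ I (j , y) i J m → Visit i c ctx J
    takeO : ∀ j y → NonAtomicAt ctx i (j , y) O → NoTriple Γ I i J → Visit i c ctx J

  -- The clause in force at a call of exh, without reference to a position; `Out` is the set that
  -- this clause prescribes. A derivation in `Exh` chooses its clause separately for each position,
  -- so the separation is needed to speak of the clause of a call.
  data Action (i c : ℕ) (ctx : Ctx n) (J : List Triple) : Set where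
    restart : i ≡ c → c < length ctx → Action i c ctx J
    finish  : i ≡ c → c ≡ length ctx → Action i c ctx J
    visit   : i < c → Visit i c ctx J → Action i c ctx J

  Added : ℕ → ℕ → Ctx n → List Triple → LP n → Move → List Move → Set
  Added i c ctx J lp m = E (suc i) c (ctx ∷ʳ extLP lp m) (J ∷ʳ (i , m , length ctx))

  data Try (i : ℕ) (ctx : Ctx n) (K : Move → List Move → Set) : List Move → Set where
    try0 : Try i ctx K []
    try1 : Try i ctx K (JUST i (length ctx) ∷ [])
    try2 : ∀ {m r} → K m r → Try i ctx K (JUST i (length ctx) ∷ m ∷ r)

  VisitOut : ∀ {i c ctx J} → Visit i c ctx J → List Move → Set
  VisitOut {i} (em a j _) p = p ≡ [] ⊎ p ≡ EM i j ∷ []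
  VisitOut {i} (stop _) p = p ≡ [] ⊎ p ≡ STOP i ∷ []
  VisitOut {i} {c} {ctx} {J} (pass _) p = E (suc i) c ctx J p
  VisitOut {i} {c} {ctx} {J} (takeP j y m _ _) p =
    Try i ctx (λ m' r → m' ≡ m × Added i c ctx J (j , y) m r) p
  VisitOut {i} {c} {ctx} {J} (takeO j y _ _) p =
    Try i ctx (λ m r → pos (Γ' j) (y ∷ʳ m) × Added i c ctx J (j , y) m r) p

  Out : ∀ {i c ctx J} → Action i c ctx J → List Move → Set
  Out {ctx = ctx} {J} (restart _ _) p = E 0 (length ctx) ctx J p
  Out {ctx = ctx} (finish _ _) p = p ≡ [] ⊎ p ≡ DROP (length ctx) ∷ []
  Out (visit _ v) p = VisitOut v p

  fromVisit : ∀ {i c ctx J p} → i < c → (v : Visit i c ctx J) → VisitOut v p → E i c ctx J p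
  fromVisit l (em a j e) (inj₁ refl) = em0 a j l e
  fromVisit l (em a j e) (inj₂ refl) = em1 a j l e
  fromVisit l (stop e) (inj₁ refl) = stop0 l e
  fromVisit l (stop e) (inj₂ refl) = stop1 l e
  fromVisit l (pass (atom at ne np)) o = skip l at ne np o
  fromVisit l (pass (allP j y (e , na , t) f)) o = tryPskip j y l e na t f o
  fromVisit l (pass (someO j y (e , na , t) f)) o = tryOskip j y l e na t f o
  fromVisit l (takeP j y m (e , na , t) f) try0 = tryP0 j y m l e na t f
  fromVisit l (takeP j y m (e , na , t) f) try1 = tryP1 j y m l e na t f
  fromVisit l (takeP j y m (e , na , t) f) (try2 (refl , o)) = tryP2 j y m l e na t f o
  fromVisit l (takeO j y (e , na , t) f) try0 = tryO0 j y l e na t f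
  fromVisit l (takeO j y (e , na , t) f) try1 = tryO1 j y l e na t f
  fromVisit l (takeO j y (e , na , t) f) (try2 (p , o)) = tryO2 j y _ l e na t f p o

  fromOut : ∀ {i c ctx J p} → (A : Action i c ctx J) → Out A p → E i c ctx J p
  fromOut (restart e l) o = repeat e l o
  fromOut (finish e l) (inj₁ refl) = drop0 e l
  fromOut (finish e l) (inj₂ refl) = drop1 e l
  fromOut (visit l v) o = fromVisit l v o

  clause : ∀ {i c ctx J p} → E i c ctx J p → Σ[ A ∈ Action i c ctx J ] Out A p
  clause (repeat e l d) = restart e l , d
  clause (drop0 e l) = finish e l , inj₁ refl
  clause (drop1 e l) = finish e l , inj₂ refl
  clause (em0 a j l e) = visit l (em a j e) , inj₁ refl
  clause (em1 a j l e) = visit l (em a j e) , inj₂ refl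
  clause (stop0 l e) = visit l (stop e) , inj₁ refl
  clause (stop1 l e) = visit l (stop e) , inj₂ refl
  clause (skip l at ne np d) = visit l (pass (atom at ne np)) , d
  clause (tryP0 j y m l e na t f) = visit l (takeP j y m (e , na , t) f) , try0
  clause (tryP1 j y m l e na t f) = visit l (takeP j y m (e , na , t) f) , try1
  clause (tryP2 j y m l e na t f d) = visit l (takeP j y m (e , na , t) f) , try2 (refl , d)
  clause (tryPskip j y l e na t f d) = visit l (pass (allP j y (e , na , t) f)) , d
  clause (tryO0 j y l e na t f) = visit l (takeO j y (e , na , t) f) , try0
  clause (tryO1 j y l e na t f) = visit l (takeO j y (e , na , t) f) , try1
  clause (tryO2 j y m l e na t f p d) = visit l (takeO j y (e , na , t) f) , try2 (p , d)
  clause (tryOskip j y l e na t f d) = visit l (pass (someO j y (e , na , t) f)) , d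

  Entries : Ctx n → Set
  Entries ctx = ∀ l j y → lk ctx l ≡ just (j , y) → pos (Γ' j) y

  fresh-pos : ∀ {j y i J m} → pos (Γ' j) y → FirstFresh Γ I (j , y) i J m → pos (Γ' j) (y ∷ʳ m)
  fresh-pos {j} {y} py (k , e , _) = enum-sound (Γ j) y k _ py e

  -- Determinism and totality of the clauses

  module _ {i c : ℕ} {ctx : Ctx n} {J : List Triple} where

    end-fun : ∀ {x x'} → ENDat Γ' ctx i x → ENDat Γ' ctx i x' → x ≡ x'
    end-fun (lp , e , _ , w) (lp' , e' , _ , w') with lk-fun {xs = ctx} e e'
    ... | refl = trans (sym w) w'

    end-atomic : ∀ {x} → ENDat Γ' ctx i x → AtomicAt Γ' ctx i
    end-atomic (lp , e , at , _) = lp , e , at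

    atomic-not : ∀ {lp g} {A : Set} → AtomicAt Γ' ctx i → NonAtomicAt ctx i lp g → A
    atomic-not (lp , e , at) (e' , na , _) with lk-fun {xs = ctx} e e'
    ... | refl = ⊥-elim (na at)

    turn-fun : ∀ {lp lp' g g'} → NonAtomicAt ctx i lp g → NonAtomicAt ctx i lp' g' →
      lp ≡ lp' × g ≡ g'
    turn-fun (e , _ , t) (e' , _ , t') with lk-fun {xs = ctx} e e'
    ... | refl = refl , trans (sym t) t'

    em-fun : ∀ {a j a' j'} → EMcond Γ I ctx c i a j → EMcond Γ I ctx c i a' j' → j ≡ j'
    em-fun {j = j} {j' = j'} (ea , _ , _ , ej , min) (ea' , _ , _ , ej' , min')
      with end-fun ea ea'
    ... | refl with <-cmp j j'
    ...   | tri< lt _ _ = ⊥-elim (min' j lt ej)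
    ...   | tri≈ _ eq _ = eq
    ...   | tri> _ _ gt = ⊥-elim (min j' gt ej')

    fresh-fun : ∀ {lp m m'} → FirstFresh Γ I lp i J m → FirstFresh Γ I lp i J m' → m ≡ m'
    fresh-fun (k , e , nj , min) (k' , e' , nj' , min') with <-cmp k k'
    ... | tri< lt _ _ = ⊥-elim (nj (min' k _ lt e))
    ... | tri≈ _ refl _ = just-injective (trans (sym e) e')
    ... | tri> _ _ gt = ⊥-elim (nj' (min k' _ gt e'))

    fresh-not-all : ∀ {j y m} → Entries ctx → NonAtomicAt ctx i (j , y) P →
      FirstFresh Γ I (j , y) i J m → ¬ Skip i c ctx J
    fresh-not-all en na f (atom at _ _) = atomic-not at na
    fresh-not-all en na f (allP j y na' all) with turn-fun na na'
    ... | refl , _ = proj₁ (proj₂ (proj₂ f)) (all _ (fresh-pos {i = i} (en _ _ _ (proj₁ na)) f))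
    fresh-not-all en na f (someO j y na' _) with turn-fun na na'
    ... | _ , ()

    none-not-some : ∀ {j y} → NonAtomicAt ctx i (j , y) O → NoTriple Γ I i J → ¬ Skip i c ctx J
    none-not-some na f (atom at _ _) = atomic-not at na
    none-not-some na f (allP j y na' _) with turn-fun na na'
    ... | _ , ()
    none-not-some na f (someO j y na' s) = s f

    end-not-skip : ENDat Γ' ctx i (pl P) → ¬ Skip i c ctx J
    end-not-skip e (atom _ _ np) = np e
    end-not-skip e (allP j y na _) = atomic-not (end-atomic e) na
    end-not-skip e (someO j y na _) = atomic-not (end-atomic e) na

    em-not-skip : ∀ {a j} → EMcond Γ I ctx c i a j → ¬ Skip i c ctx J
    em-not-skip e (atom _ ne _) = ne _ _ e
    em-not-skip e (allP j y na _) = atomic-not (end-atomic (proj₁ e)) na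
    em-not-skip e (someO j y na _) = atomic-not (end-atomic (proj₁ e)) na

    -- The clauses exclude one another: label, atomicity and turn at `i` are functions of the
    -- context, and the EM partner and the fresh move are least choices. `Entries` is needed to make
    -- a fresh move legal, so that it contradicts the claim that all legal moves were tried.
    transportVisit : ∀ {p} → Entries ctx → (v w : Visit i c ctx J) → VisitOut v p → VisitOut w p
    transportVisit en (em a j e) (em a' j' e') o with em-fun e e'
    ... | refl = o
    transportVisit en (em a j e) (stop e') o with end-fun (proj₁ e) e'
    ... | ()
    transportVisit en (em a j e) (pass s) o = ⊥-elim (em-not-skip e s)
    transportVisit en (em a j e) (takeP _ _ _ na _) o = atomic-not (end-atomic (proj₁ e)) na
    transportVisit en (em a j e) (takeO _ _ na _) o = atomic-not (end-atomic (proj₁ e)) na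
    transportVisit en (stop e') (em a j e) o with end-fun (proj₁ e) e'
    ... | ()
    transportVisit en (stop e) (stop e') o = o
    transportVisit en (stop e) (pass s) o = ⊥-elim (end-not-skip e s)
    transportVisit en (stop e) (takeP _ _ _ na _) o = atomic-not (end-atomic e) na
    transportVisit en (stop e) (takeO _ _ na _) o = atomic-not (end-atomic e) na
    transportVisit en (pass s) (em a j e) o = ⊥-elim (em-not-skip e s)
    transportVisit en (pass s) (stop e) o = ⊥-elim (end-not-skip e s)
    transportVisit en (pass s) (pass s') o = o
    transportVisit en (pass s) (takeP _ _ _ na f) o = ⊥-elim (fresh-not-all en na f s)
    transportVisit en (pass s) (takeO _ _ na f) o = ⊥-elim (none-not-some na f s)
    transportVisit en (takeP _ _ _ na f) (em a j e) o = atomic-not (end-atomic (proj₁ e)) na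
    transportVisit en (takeP _ _ _ na f) (stop e) o = atomic-not (end-atomic e) na
    transportVisit en (takeP _ _ _ na f) (pass s) o = ⊥-elim (fresh-not-all en na f s)
    transportVisit en (takeP _ _ _ na f) (takeP _ _ _ na' f') o with turn-fun na na'
    ... | refl , _ with fresh-fun f f'
    ...   | refl = o
    transportVisit en (takeP _ _ _ na f) (takeO _ _ na' _) o with turn-fun na na'
    ... | _ , ()
    transportVisit en (takeO _ _ na f) (em a j e) o = atomic-not (end-atomic (proj₁ e)) na
    transportVisit en (takeO _ _ na f) (stop e) o = atomic-not (end-atomic e) na
    transportVisit en (takeO _ _ na f) (pass s) o = ⊥-elim (none-not-some na f s)
    transportVisit en (takeO _ _ na f) (takeP _ _ _ na' _) o with turn-fun na na'
    ... | _ , ()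
    transportVisit en (takeO _ _ na f) (takeO _ _ na' f') o with turn-fun na na'
    ... | refl , _ = o

  transportOut : ∀ {i c ctx J p} → Entries ctx → (A B : Action i c ctx J) → Out A p → Out B p
  transportOut en (restart _ _) (restart _ _) o = o
  transportOut en (restart _ l) (finish _ e) o = ⊥-elim (<-irrefl e l)
  transportOut en (restart e _) (visit l _) o = ⊥-elim (<-irrefl e l)
  transportOut en (finish _ e) (restart _ l) o = ⊥-elim (<-irrefl e l)
  transportOut en (finish _ _) (finish _ _) o = o
  transportOut en (finish e _) (visit l _) o = ⊥-elim (<-irrefl e l)
  transportOut en (visit l _) (restart e _) o = ⊥-elim (<-irrefl e l)
  transportOut en (visit l _) (finish e _) o = ⊥-elim (<-irrefl e l)
  transportOut en (visit _ v) (visit _ w) o = transportVisit en v w o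

  -- Lets one action, chosen once, serve all positions of a call. For an infinite branch this
  -- matters: its prefixes come with unrelated derivations.
  toOut : ∀ {i c ctx J p} → Entries ctx → (A : Action i c ctx J) → E i c ctx J p → Out A p
  toOut en A d = let (B , o) = clause d in transportOut en B A o

  atom-or : ∀ {i c ctx J} lp → lk ctx i ≡ just lp → Atomic Γ' lp → Visit i c ctx J
  atom-or {i} {c} {ctx} lp e at with lem {ENDat Γ' ctx i (pl P)}
  ... | yes p = stop p
  ... | no np with lem {Σ[ a ∈ Par ] Σ[ j ∈ ℕ ] EMcond Γ I ctx c i a j}
  ...   | yes (a , j , x) = em a j x
  ...   | no nx = pass (atom (lp , e , at) (λ a j x → nx (a , j , x)) np)

  fresh-or : ∀ {i c ctx J} j y → Entries ctx → NonAtomicAt ctx i (j , y) P → Visit i c ctx J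
  fresh-or {i} {J = J} j y en na with lem {Σ[ k ∈ ℕ ] Σ[ m ∈ Move ] enum (Γ j) y k ≡ just m × ¬ InJ Γ I i m J}
  ... | no none = pass (allP j y na λ m pm → dne lem λ nj →
                    let (k , e) = enum-compl (Γ j) y m pm in none (k , m , e , nj))
  ... | yes (k , q) with least lem (λ k → Σ[ m ∈ Move ] enum (Γ j) y k ≡ just m × ¬ InJ Γ I i m J) k q
  ...   | k₀ , _ , (m , e , nj) , min = takeP j y m na
          (k₀ , e , nj , λ k' m' lt e' → dne lem λ nj' → min k' lt (m' , e' , nj'))

  visit-exists : ∀ {i c ctx J} → Entries ctx → i < c → c ≤ length ctx → Visit i c ctx J
  visit-exists {i} {c} {ctx} {J} en l l' with lk-defined ctx (<-≤-trans l l')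
  ... | (j , y) , e with lem {Atomic Γ' (j , y)}
  ...   | yes at = atom-or (j , y) e at
  ...   | no na with turn (Γ' j) y in t
  ...     | P = fresh-or j y en (e , na , t)
  ...     | O with lem {NoTriple Γ I i J}
  ...       | yes nt = takeO j y (e , na , t) nt
  ...       | no ¬nt = pass (someO j y (e , na , t) ¬nt)

  action-exists : ∀ {i c ctx J} → Entries ctx → i ≤ c → c ≤ length ctx → Action i c ctx J
  action-exists en p q with m≤n⇒m<n∨m≡n p | m≤n⇒m<n∨m≡n q
  ... | inj₁ l | _ = visit l (visit-exists en l q)
  ... | inj₂ e | inj₁ l = restart e l
  ... | inj₂ e | inj₂ e' = finish e e'

  nonempty-pass : ∀ d {i c ctx J} → Entries ctx → d + i ≡ c → c ≤ length ctx → E c c ctx J [] → E i c ctx J []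
  nonempty-pass zero en refl l b = b
  nonempty-pass (suc d) {i} {c} {ctx} {J} en refl l b = fromVisit lt v (go v)
    where
    lt : i < c
    lt = s≤s (m≤n+m i d)
    v : Visit i c ctx J
    v = visit-exists en lt l
    go : ∀ v → VisitOut v []
    go (em a j e) = inj₁ refl
    go (stop _) = inj₁ refl
    go (pass _) = nonempty-pass d en (+-suc d i) l b
    go (takeP _ _ _ _ _) = try0
    go (takeO _ _ _ _) = try0

  -- REPEAT and SKIP merely pass the empty position on, so some other clause must be reached. If the
  -- current pass reaches none, it restarts with bound `length ctx`; a second pass that again only
  -- skips ends in DROP.
  nonempty : ∀ {i c ctx J} → Entries ctx → i ≤ c → c ≤ length ctx → E i c ctx J []
  nonempty {i} {c} {ctx} en p q = nonempty-pass (c ∸ i) en (m∸n+n≡m p) q base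
    where
    base : ∀ {J} → E c c ctx J []
    base with m≤n⇒m<n∨m≡n q
    ... | inj₂ e = drop0 refl e
    ... | inj₁ l = repeat refl l (nonempty-pass (length ctx) en (+-identityʳ _) ≤-refl (drop0 refl refl))

  ∈-snoc⁻ : ∀ {A : Set} (xs : List A) {x a} → x ∈ xs ∷ʳ a → x ∈ xs ⊎ x ≡ a
  ∈-snoc⁻ xs p with ∈-++⁻ xs p
  ... | inj₁ q = inj₁ q
  ... | inj₂ (here e) = inj₂ e

  toInJ : ∀ {i m k J} → (i , m , k) ∈ J → InJ Γ I i m J
  toInJ p = lose p (refl , refl)

  fromInJ : ∀ {i m J} → InJ Γ I i m J → Σ[ k ∈ ℕ ] (i , m , k) ∈ J
  fromInJ p with find p
  ... | (_ , _ , k) , q , refl , refl = k , q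

  -- `l < k` makes chains of triples strictly increasing, which forbids infinite chains in a finite
  -- context. `unique` reflects that TRYALL tries a move at most once at an index; it makes a path
  -- of moves determine its end.
  record Sound (ctx : Ctx n) (J : List Triple) : Set where
    field
      root    : ∀ {l lp} → lk (rootCtx Γ') l ≡ just lp → lk ctx l ≡ just lp
      entries : Entries ctx
      triple  : ∀ {l m k} → (l , m , k) ∈ J → l < k × Σ[ j ∈ Fin n ] Σ[ y ∈ List Move ]
                  lk ctx l ≡ just (j , y) × lk ctx k ≡ just (j , y ∷ʳ m)
      unique  : ∀ {l m k k'} → (l , m , k) ∈ J → (l , m , k') ∈ J → k ≡ k'
  open Sound public

  sound-root : Sound (rootCtx Γ') []
  sound-root = record { root = λ e → e ; entries = en ; triple = λ () ; unique = λ () }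
    where
    en : Entries (rootCtx Γ')
    en l j y e with rootCtx-lk⁻ e
    ... | j , _ , refl = pos-root (Γ j)

  entries-snoc : ∀ {ctx j y} → Entries ctx → pos (Γ' j) y → Entries (ctx ∷ʳ (j , y))
  entries-snoc {ctx} en p l j' y' e with lk-snoc⁻ ctx e
  ... | inj₁ q = en l j' y' q
  ... | inj₂ (_ , refl) = p

  sound-snoc : ∀ {ctx J i j y m} → Sound ctx J → lk ctx i ≡ just (j , y) → pos (Γ' j) (y ∷ʳ m) →
    ¬ InJ Γ I i m J → Sound (ctx ∷ʳ (j , y ∷ʳ m)) (J ∷ʳ (i , m , length ctx))
  sound-snoc {ctx} {J} {i} {j} {y} {m} s e p nj = record
    { root = λ r → lk-++ ctx (root s r) ; entries = entries-snoc {ctx} (entries s) p ; triple = tr ; unique = un }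
    where
    tr : ∀ {l m' k} → (l , m' , k) ∈ J ∷ʳ (i , m , length ctx) → l < k × Σ[ j' ∈ Fin n ] Σ[ y' ∈ List Move ]
      lk (ctx ∷ʳ (j , y ∷ʳ m)) l ≡ just (j' , y') × lk (ctx ∷ʳ (j , y ∷ʳ m)) k ≡ just (j' , y' ∷ʳ m')
    tr q with ∈-snoc⁻ J q
    ... | inj₁ q' = let (lt , j' , y' , a , b) = triple s q' in lt , j' , y' , lk-++ ctx a , lk-++ ctx b
    ... | inj₂ refl = lk-< ctx e , j , y , lk-++ ctx e , lk-last ctx
    un : ∀ {l m' k k'} → (l , m' , k) ∈ J ∷ʳ (i , m , length ctx) → (l , m' , k') ∈ J ∷ʳ (i , m , length ctx) → k ≡ k'
    un q q' with ∈-snoc⁻ J q | ∈-snoc⁻ J q'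
    ... | inj₁ a | inj₁ b = unique s a b
    ... | inj₁ a | inj₂ refl = ⊥-elim (nj (toInJ a))
    ... | inj₂ refl | inj₁ b = ⊥-elim (nj (toInJ b))
    ... | inj₂ refl | inj₂ refl = refl

  none-fresh : ∀ {i m J} → NoTriple Γ I i J → ¬ InJ Γ I i m J
  none-fresh nt p with fromInJ p
  ... | k , q = nt (lose q refl)

  -- `done` is demanded only while `c ≡ length ctx`, that is, while the pass has added nothing: the
  -- earlier skips then concern the present context and triples. Adding a position makes the context
  -- longer than `c` and the condition vacuous. When DROP is reached, `done` covers all indices.
  record Inv (i c : ℕ) (ctx : Ctx n) (J : List Triple) : Set where
    field
      i≤c   : i ≤ c
      c≤len : c ≤ length ctx
      sound : Sound ctx J
      done  : c ≡ length ctx → ∀ l → l < i → Skip l c ctx J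
  open Inv public

  inv-init : Inv 0 n (rootCtx Γ') []
  inv-init = record { i≤c = z≤n ; c≤len = ≤-reflexive (sym rootCtx-length) ; sound = sound-root ; done = λ _ _ () }

  inv-restart : ∀ {i c ctx J} → Inv i c ctx J → Inv 0 (length ctx) ctx J
  inv-restart v = record { i≤c = z≤n ; c≤len = ≤-refl ; sound = sound v ; done = λ _ _ () }

  inv-skip : ∀ {i c ctx J} → Inv i c ctx J → i < c → Skip i c ctx J → Inv (suc i) c ctx J
  inv-skip {i} {c} {ctx} {J} v l s = record { i≤c = l ; c≤len = c≤len v ; sound = sound v ; done = d }
    where
    d : c ≡ length ctx → ∀ l → l < suc i → Skip l c ctx J
    d e l (s≤s lt) with m≤n⇒m<n∨m≡n lt
    ... | inj₁ lt' = done v e l lt'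
    ... | inj₂ refl = s

  inv-add : ∀ {i c ctx J j y m} → Inv i c ctx J → i < c → lk ctx i ≡ just (j , y) → pos (Γ' j) (y ∷ʳ m) →
    ¬ InJ Γ I i m J → Inv (suc i) c (ctx ∷ʳ (j , y ∷ʳ m)) (J ∷ʳ (i , m , length ctx))
  inv-add {c = c} {ctx} v l e p nj = record
    { i≤c = l ; c≤len = subst (c ≤_) (sym (length-snoc ctx)) (m≤n⇒m≤1+n (c≤len v)) ; sound = sound-snoc (sound v) e p nj
    ; done = λ eq _ _ → ⊥-elim (1+n≰n (subst (_≤ length ctx) (trans eq (length-snoc ctx)) (c≤len v))) }

  inv-takeP : ∀ {i c ctx J j y m} → Inv i c ctx J → i < c → NonAtomicAt ctx i (j , y) P →
    FirstFresh Γ I (j , y) i J m → Inv (suc i) c (ctx ∷ʳ (j , y ∷ʳ m)) (J ∷ʳ (i , m , length ctx))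
  inv-takeP {i} v l na f =
    inv-add v l (proj₁ na) (fresh-pos {i = i} (entries (sound v) _ _ _ (proj₁ na)) f) (proj₁ (proj₂ (proj₂ f)))

  inv-takeO : ∀ {i c ctx J j y m} → Inv i c ctx J → i < c → NonAtomicAt ctx i (j , y) O →
    NoTriple Γ I i J → pos (Γ' j) (y ∷ʳ m) → Inv (suc i) c (ctx ∷ʳ (j , y ∷ʳ m)) (J ∷ʳ (i , m , length ctx))
  inv-takeO v l na nt p = inv-add v l (proj₁ na) p (none-fresh nt)

-- EXH is a total strategy for P, and DROP is its only lost leaf

module Strategy (lem : LEM) {n : ℕ} (Γ : Fin n → PGame) (I : Par → Bool) where

  open Machine lem Γ I
  open Play Γ' I
  open Root Γ'

  singleton-prefix : ∀ {A : Set} {a b : A} {x y} → b ∷ x ++ y ≡ a ∷ [] → b ∷ x ≡ a ∷ []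
  singleton-prefix {x = []} refl = refl

  exh-[] : ∀ {i c ctx J} → Inv i c ctx J → E i c ctx J []
  exh-[] v = nonempty (entries (sound v)) (i≤c v) (c≤len v)

  exh-prefix : ∀ {i c ctx J p} → Inv i c ctx J → E i c ctx J p → ∀ x y → x ++ y ≡ p → E i c ctx J x
  exh-prefix v d [] y e = exh-[] v
  exh-prefix v (repeat e l d) x@(_ ∷ _) y q = repeat e l (exh-prefix (inv-restart v) d x y q)
  exh-prefix v d@(drop1 _ _) (_ ∷ x) y q = subst (E _ _ _ _) (sym (singleton-prefix q)) d
  exh-prefix v d@(em1 _ _ _ _) (_ ∷ x) y q = subst (E _ _ _ _) (sym (singleton-prefix q)) d
  exh-prefix v d@(stop1 _ _) (_ ∷ x) y q = subst (E _ _ _ _) (sym (singleton-prefix q)) d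
  exh-prefix v (skip l at ne np d) x@(_ ∷ _) y q =
    skip l at ne np (exh-prefix (inv-skip v l (atom at ne np)) d x y q)
  exh-prefix v d@(tryP1 _ _ _ _ _ _ _ _) (_ ∷ x) y q = subst (E _ _ _ _) (sym (singleton-prefix q)) d
  exh-prefix v (tryP2 j y m l e na t f d) (_ ∷ []) _ refl = tryP1 j y m l e na t f
  exh-prefix v (tryP2 j y m l e na t f d) (_ ∷ _ ∷ x) z refl =
    tryP2 j y m l e na t f (exh-prefix (inv-takeP v l (e , na , t) f) d x z refl)
  exh-prefix v (tryPskip j y l e na t f d) x@(_ ∷ _) z q =
    tryPskip j y l e na t f (exh-prefix (inv-skip v l (allP j y (e , na , t) f)) d x z q)
  exh-prefix v d@(tryO1 _ _ _ _ _ _ _) (_ ∷ x) y q = subst (E _ _ _ _) (sym (singleton-prefix q)) d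
  exh-prefix v (tryO2 j y m l e na t f p d) (_ ∷ []) _ refl = tryO1 j y l e na t f
  exh-prefix v (tryO2 j y m l e na t f p d) (_ ∷ _ ∷ x) z refl =
    tryO2 j y m l e na t f p (exh-prefix (inv-takeO v l (e , na , t) f p) d x z refl)
  exh-prefix v (tryOskip j y l e na t f d) x@(_ ∷ _) z q =
    tryOskip j y l e na t f (exh-prefix (inv-skip v l (someO j y (e , na , t) f)) d x z q)

  exh-pos : ∀ {i c ctx J p} → Inv i c ctx J → E i c ctx J p → Pos ctx p
  exh-pos v (repeat e l d) = exh-pos (inv-restart v) d
  exh-pos v (drop0 _ _) = tt
  exh-pos v (drop1 _ _) = refl , refl
  exh-pos v (em0 _ _ _ _) = tt
  exh-pos v (em1 a j _ (ei , t , _ , ej , _)) = a , ei , ej , t , refl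
  exh-pos v (stop0 _ _) = tt
  exh-pos v (stop1 _ e) = pl P , e , tt , refl
  exh-pos v (skip l at ne np d) = exh-pos (inv-skip v l (atom at ne np)) d
  exh-pos v (tryP0 _ _ _ _ _ _ _ _) = tt
  exh-pos v (tryP1 j y _ _ e na _ _) = refl , (j , y) , e , na
  exh-pos {i} v (tryP2 j y m l e na t f d) =
    refl , (j , y) , e , na , fresh-pos {i = i} (entries (sound v) _ _ _ e) f , exh-pos (inv-takeP v l (e , na , t) f) d
  exh-pos v (tryPskip j y l e na t f d) = exh-pos (inv-skip v l (allP j y (e , na , t) f)) d
  exh-pos v (tryO0 _ _ _ _ _ _ _) = tt
  exh-pos v (tryO1 j y _ e na _ _) = refl , (j , y) , e , na
  exh-pos v (tryO2 j y m l e na t f p d) =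
    refl , (j , y) , e , na , p , exh-pos (inv-takeO v l (e , na , t) f p) d
  exh-pos v (tryOskip j y l e na t f d) = exh-pos (inv-skip v l (someO j y (e , na , t) f)) d

  record Stuck : Set where
    field
      ctx   : Ctx n
      J     : List Triple
      sound : Sound ctx J
      skips : ∀ l → l < length ctx → Skip l (length ctx) ctx J

  Ended : Ctx n → List Move → Set
  Ended ctx x = ∀ m → ¬ Pos ctx (x ∷ʳ m)

  data Verdict (K : List Move → Set) (ctx : Ctx n) (x : List Move) : Set where
    plays : turnF Γ' I ctx x ≡ P → ∀ m → K (x ∷ʳ m) → Verdict K ctx x
    waits : turnF Γ' I ctx x ≡ O → (∀ m → Pos ctx (x ∷ʳ m) → K (x ∷ʳ m)) →
            Σ[ m ∈ Move ] Pos ctx (x ∷ʳ m) → Verdict K ctx x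
    won   : winF Γ' I ctx x ≡ pl P → Ended ctx x → Verdict K ctx x
    lost  : Stuck → Ended ctx x → Verdict K ctx x

  verdict-map : ∀ {K K' ctx x} → (∀ {p} → K p → K' p) → Verdict K ctx x → Verdict K' ctx x
  verdict-map h (plays t m k) = plays t m (h k)
  verdict-map h (waits t f e) = waits t (λ m p → h (f m p)) e
  verdict-map h (won w e) = won w e
  verdict-map h (lost s e) = lost s e

  verdict-later : ∀ {K K' ctx i j y m g x} → NonAtomicAt ctx i (j , y) g → pos (Γ' j) (y ∷ʳ m) →
    (∀ {r} → K r → K' (JUST i (length ctx) ∷ m ∷ r)) → Verdict K (ctx ∷ʳ (j , y ∷ʳ m)) x →
    Verdict K' ctx (JUST i (length ctx) ∷ m ∷ x)
  verdict-later {K} {K'} {ctx} {i} {j} {y} {m} {g} {x} (e , na , t) p h = go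
    where
    strip : ∀ {x} → Pos ctx (JUST i (length ctx) ∷ m ∷ x) → Pos (ctx ∷ʳ (j , y ∷ʳ m)) x
    strip (_ , lp , e' , _ , _ , r) with lk-fun {xs = ctx} e e'
    ... | refl = r
    wrap : ∀ {x} → Pos (ctx ∷ʳ (j , y ∷ʳ m)) x → Pos ctx (JUST i (length ctx) ∷ m ∷ x)
    wrap r = refl , (j , y) , e , na , p , r
    go : ∀ {x} → Verdict K (ctx ∷ʳ (j , y ∷ʳ m)) x → Verdict K' ctx (JUST i (length ctx) ∷ m ∷ x)
    go {x} (plays t m' k) = plays (trans (turnF-later {ctx} {i} {length ctx} {m} {x} e) t) m' (h k)
    go {x} (waits t f (m' , r)) =
      waits (trans (turnF-later {ctx} {i} {length ctx} {m} {x} e) t) (λ m' r' → h (f m' (strip r'))) (m' , wrap r)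
    go {x} (won w en) = won (trans (winF-later {ctx} {i} {length ctx} {m} {x} e) w) λ m' r → en m' (strip r)
    go {x} (lost s en) = lost s λ m' r → en m' (strip r)

  -- A derivation shows how its position can continue. EM and STOP end in leaves won by P, while at
  -- DROP the field `done` of the invariant says that every index is skipped, which is what `Stuck`
  -- records.
  verdict : ∀ {i c ctx J x} → Inv i c ctx J → E i c ctx J x → Verdict (E i c ctx J) ctx x
  verdict v (repeat e l d) = verdict-map (repeat e l) (verdict (inv-restart v) d)
  verdict v (drop0 e e') = plays refl _ (drop1 e e')
  verdict {ctx = ctx} {J} v (drop1 refl refl) = lost
    (record { ctx = ctx ; J = J ; sound = sound v ; skips = done v refl }) λ { m (_ , ()) }
  verdict v (em0 a j l e) = plays refl _ (em1 a j l e)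
  verdict v (em1 a j l e) = won refl λ { m (_ , _ , _ , _ , ()) }
  verdict v (stop0 l e) = plays refl _ (stop1 l e)
  verdict {i} {ctx = ctx} v (stop1 l ((j , y) , e , at , w)) =
    won (trans (winF-stop {ctx} {i} {[]} e) w) λ { m (_ , _ , _ , ()) }
  verdict v (skip l at ne np d) = verdict-map (skip l at ne np) (verdict (inv-skip v l (atom at ne np)) d)
  verdict v (tryP0 j y m l e na t f) = plays refl _ (tryP1 j y m l e na t f)
  verdict {i} {ctx = ctx} v (tryP1 j y m l e na t f) =
    plays (trans (turnF-answer {ctx} {i} {length ctx} e) t) m
      (tryP2 j y m l e na t f (exh-[] (inv-takeP v l (e , na , t) f)))
  verdict {i} v (tryP2 j y m l e na t f d) =
    verdict-later (e , na , t) (fresh-pos {i = i} (entries (sound v) _ _ _ e) f) (tryP2 j y m l e na t f)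
      (verdict (inv-takeP v l (e , na , t) f) d)
  verdict v (tryPskip j y l e na t f d) =
    verdict-map (tryPskip j y l e na t f) (verdict (inv-skip v l (allP j y (e , na , t) f)) d)
  verdict v (tryO0 j y l e na t f) = plays refl _ (tryO1 j y l e na t f)
  verdict {i} {c} {ctx} {J} v (tryO1 j y l e na t f) =
    waits (trans (turnF-answer {ctx} {i} {length ctx} e) t) answer
      (dne lem λ none → na λ m p → none (m , refl , (j , y) , e , na , p , tt))
    where
    answer : ∀ m → Pos ctx (JUST i (length ctx) ∷ m ∷ []) → E i c ctx J (JUST i (length ctx) ∷ m ∷ [])
    answer m (_ , lp , e' , _ , p , _) with lk-fun {xs = ctx} e e'
    ... | refl = tryO2 j y m l e na t f p (exh-[] (inv-takeO v l (e , na , t) f p))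
  verdict v (tryO2 j y m l e na t f p d) =
    verdict-later (e , na , t) p (tryO2 j y m l e na t f p) (verdict (inv-takeO v l (e , na , t) f p) d)
  verdict v (tryOskip j y l e na t f d) =
    verdict-map (tryOskip j y l e na t f) (verdict (inv-skip v l (someO j y (e , na , t) f)) d)

  exh-partially-winning : ¬ Stuck → IsPartiallyWinning P (ForAll Γ' I) (EXH Γ I)
  exh-partially-winning ns = ((strategy , answers) , moves) , leaves
    where
    strategy : IsStrategy (ForAll Γ' I) (EXH Γ I)
    strategy = exh-[] inv-init , (λ x y d → exh-prefix inv-init d x y refl) , λ x → exh-pos inv-init
    answers : ∀ x → EXH Γ I x → NonLeaf (ForAll Γ' I) x → turnF Γ' I (rootCtx Γ') x ≡ O →
      ∀ m → Pos (rootCtx Γ') (x ∷ʳ m) → EXH Γ I (x ∷ʳ m)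
    answers x d (_ , m' , p') t m p with verdict inv-init d
    ... | plays t' _ _ with trans (sym t) t'
    ...   | ()
    answers x d (_ , m' , p') t m p | waits _ f _ = f m p
    answers x d (_ , m' , p') t m p | won _ en = ⊥-elim (en m' p')
    answers x d (_ , m' , p') t m p | lost _ en = ⊥-elim (en m' p')
    moves : ∀ x → EXH Γ I x → NonLeaf (ForAll Γ' I) x → turnF Γ' I (rootCtx Γ') x ≡ P →
      ∃[ m ] EXH Γ I (x ∷ʳ m)
    moves x d (_ , m' , p') t with verdict inv-init d
    ... | plays _ m e = m , e
    ... | waits t' _ _ with trans (sym t) t'
    ...   | ()
    moves x d (_ , m' , p') t | won _ en = ⊥-elim (en m' p')
    moves x d (_ , m' , p') t | lost _ en = ⊥-elim (en m' p')
    leaves : ∀ x → EXH Γ I x → Leaf (ForAll Γ' I) x → winF Γ' I (rootCtx Γ') x ≡ pl P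
    leaves x d (_ , none) with verdict inv-init d
    ... | plays _ m e = ⊥-elim (none m (exh-pos inv-init e))
    ... | waits _ _ (m , p) = ⊥-elim (none m p)
    ... | won w _ = w
    ... | lost s _ = ⊥-elim (ns s)

-- P can replay the path to any leaf of G_j by JUST moves and then choose STOP.

module Labels {n : ℕ} (Γ : Fin n → PGame) (I : Par → Bool)
  (closed : ∀ a → ¬ FV (ForAll (λ i → game (Γ i)) I) a) where

  private
    Γ' : Fin n → Game
    Γ' j = game (Γ j)

  open Play Γ' I
  open Root Γ'

  replay : ∀ {j a} y → Leaf (Γ' j) y → win (Γ' j) y ≡ par a → ¬ T (I a) →
    ∀ z y₀ ctx l → y₀ ++ z ≡ y → lk ctx l ≡ just (j , y₀) →
    Σ[ x ∈ List Move ] Leaf (FA ctx) x × winF Γ' I ctx x ≡ par a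
  replay {j} {a} y (py , at) w na [] y₀ ctx l e f with trans (sym (++-identityʳ y₀)) e
  ... | refl = STOP l ∷ [] ,
    ((par a , ((j , y) , f , at , w) , ((j , y , (py , at) , inj₁ w) , na) , refl) , λ { m (_ , _ , _ , ()) }) ,
    trans (winF-stop {ctx} {l} {[]} f) w
  replay {j} {a} y lf w na (m ∷ z) y₀ ctx l e f
    with replay y lf w na z (y₀ ∷ʳ m) (ctx ∷ʳ (j , y₀ ∷ʳ m)) (length ctx) (trans (++-assoc y₀ _ z) e) (lk-last ctx)
  ... | x , (px , none) , wx = JUST l (length ctx) ∷ m ∷ x ,
    ((refl , (j , y₀) , f , (λ at → at m pm) , pm , px) , ended) ,
    trans (winF-later {ctx} {l} {length ctx} {m} {x} f) wx
    where
    pm : pos (Γ' j) (y₀ ∷ʳ m)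
    pm = pos-prefix (Γ j) (y₀ ∷ʳ m) z (subst (pos (Γ' j)) (trans (sym e) (sym (++-assoc y₀ _ z))) (proj₁ lf))
    ended : ∀ m' → ¬ Pos ctx (JUST l (length ctx) ∷ m ∷ (x ∷ʳ m'))
    ended m' (_ , lp , f' , _ , _ , r) with lk-fun {xs = ctx} f f'
    ... | refl = none m' r

  leaf-param : ∀ {j a} y → Leaf (Γ' j) y → win (Γ' j) y ≡ par a → T (I a)
  leaf-param {j} {a} y lf w with I a in eq
  ... | true = tt
  ... | false with replay y lf w (λ t → subst T eq t) y [] (rootCtx Γ') (toℕ j) refl (rootCtx-lk j)
  ...   | x , lx , wx = closed a (x , lx , inj₁ wx)

-- From a lost run to an assignment and O-winning strategies in all η(G_j)

module Limit (lem : LEM) {n : ℕ} (Γ : Fin n → PGame) (I : Par → Bool) (sd : SelfDual I)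
  (closed : ∀ a → ¬ FV (ForAll (λ i → game (Γ i)) I) a) where

  open Machine lem Γ I
  open Play Γ' I
  open Root Γ'
  open Labels Γ I closed

  data Visited (l c : ℕ) (ctx : Ctx n) (J J' : List Triple) : Set where
    passed : Skip l c ctx J → Visited l c ctx J J'
    tookP  : ∀ j y m → NonAtomicAt ctx l (j , y) P → FirstFresh Γ I (j , y) l J m →
             J' ≡ J ∷ʳ (l , m , length ctx) → Visited l c ctx J J'
    tookO  : ∀ j y m → NonAtomicAt ctx l (j , y) O → J' ≡ J ∷ʳ (l , m , length ctx) →
             Visited l c ctx J J'

  -- What is used of a play of EXH lost by P: the local positions and the triples after
  -- t steps. A play that ends with DROP gives a constant run.
  record LostRun : Set where
    field
      ctx       : ℕ → Ctx n
      triples   : ℕ → List Triple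
      sound     : ∀ t → Sound (ctx t) (triples t)
      ctx-grows : ∀ t {l lp} → lk (ctx t) l ≡ just lp → lk (ctx (suc t)) l ≡ just lp
      triples-grow : ∀ t {x} → x ∈ triples t → x ∈ triples (suc t)
      fair      : ∀ t l → l < length (ctx t) → Σ[ t' ∈ ℕ ] t ≤ t' × Σ[ c ∈ ℕ ] length (ctx t) ≤ c ×
                    Visited l c (ctx t') (triples t') (triples (suc t'))
      lost      : ∀ i (q : ℕ → Move) (js : ℕ → ℕ) → js 0 ≡ toℕ i →
                    (∀ s → Σ[ t ∈ ℕ ] (js s , q s , js (suc s)) ∈ triples t) → ¬ winP (Γ' i) q

  module FromRun (R : LostRun) where
    open LostRun R renaming (sound to soundAt)

    ctx-mono : ∀ {t t' l lp} → t ≤′ t' → lk (ctx t) l ≡ just lp → lk (ctx t') l ≡ just lp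
    ctx-mono ≤′-refl e = e
    ctx-mono (≤′-step p) e = ctx-grows _ (ctx-mono p e)

    triples-mono : ∀ {t t' x} → t ≤′ t' → x ∈ triples t → x ∈ triples t'
    triples-mono ≤′-refl e = e
    triples-mono (≤′-step p) e = triples-grow _ (triples-mono p e)

    Loc : ℕ → LP n → Set
    Loc l lp = Σ[ t ∈ ℕ ] lk (ctx t) l ≡ just lp

    Tr : ℕ → Move → ℕ → Set
    Tr l m k = Σ[ t ∈ ℕ ] (l , m , k) ∈ triples t

    loc-≤ : ∀ {l lp t'} → (p : Loc l lp) → proj₁ p ≤ t' → lk (ctx t') l ≡ just lp
    loc-≤ (t , e) le = ctx-mono (≤⇒≤′ le) e

    loc-fun : ∀ {l a b} → Loc l a → Loc l b → a ≡ b
    loc-fun p@(t , _) q@(t' , _) =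
      lk-fun {xs = ctx (t ⊔ t')} (loc-≤ p (m≤m⊔n t t')) (loc-≤ q (m≤n⊔m t t'))

    tr-fun : ∀ {l m k k'} → Tr l m k → Tr l m k' → k ≡ k'
    tr-fun (t , p) (t' , q) =
      unique (soundAt (t ⊔ t')) (triples-mono (≤⇒≤′ (m≤m⊔n t t')) p) (triples-mono (≤⇒≤′ (m≤n⊔m t t')) q)

    tr-loc : ∀ {l m k j y} → Tr l m k → Loc l (j , y) → Loc k (j , y ∷ʳ m)
    tr-loc {l} (t , p) loc with triple (soundAt t) p
    ... | _ , j' , y' , e , e' with loc-fun {l} (t , e) loc
    ...   | refl = t , e'

    loc-pos : ∀ {l j y} → Loc l (j , y) → pos (Γ' j) y
    loc-pos (t , e) = entries (soundAt t) _ _ _ e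

    revisit : ∀ {l lp} (p : Loc l lp) t → proj₁ p ≤ t → Σ[ t' ∈ ℕ ] t ≤ t' × lk (ctx t') l ≡ just lp ×
      Σ[ c ∈ ℕ ] length (ctx t) ≤ c × Visited l c (ctx t') (triples t') (triples (suc t'))
    revisit {l} p t le with fair t l (lk-< (ctx t) (loc-≤ p le))
    ... | t' , le' , c , lc , v = t' , le' , loc-≤ p (≤-trans le le') , c , lc , v

    loc-end : ∀ {l lp} t → lk (ctx t) l ≡ just lp → Atomic Γ' lp → ∀ {c} →
      Visited l c (ctx t) (triples t) (triples (suc t)) →
      (∀ a j → ¬ EMcond Γ I (ctx t) c l a j) × ¬ ENDat Γ' (ctx t) l (pl P)
    loc-end {l} t e at (passed (atom _ ne np)) = ne , np
    loc-end {l} t e at (passed (allP j y na _)) = atomic-not {l} {0} {ctx t} {triples t} (_ , e , at) na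
    loc-end {l} t e at (passed (someO j y na _)) = atomic-not {l} {0} {ctx t} {triples t} (_ , e , at) na
    loc-end {l} t e at (tookP j y m na _ _) = atomic-not {l} {0} {ctx t} {triples t} (_ , e , at) na
    loc-end {l} t e at (tookO j y m na _) = atomic-not {l} {0} {ctx t} {triples t} (_ , e , at) na

    not-won : ∀ {l lp} → Loc l lp → ¬ IsEND Γ' lp (pl P)
    not-won p@(t , _) (at , w) with revisit p t ≤-refl
    ... | t' , le , e , c , lc , v = proj₂ (loc-end t' e at v) (_ , e , at , w)

    -- EM looks for a partner below the bound `c` of the pass only. Fairness therefore supplies a
    -- visit to `l` in a pass whose bound exceeds every index present once both positions exist;
    -- there the least partner would have triggered EM instead of a skip.
    no-clash : ∀ {l l' lp lp' a} → T (I a) → Loc l lp → IsEND Γ' lp (par a) → Loc l' lp' →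
      ¬ IsEND Γ' lp' (par (dual a))
    no-clash {l} {l'} {lp} {lp'} {a} ta p@(t , _) (at , w) p'@(t' , _) end'
      with revisit p (t ⊔ t') (m≤m⊔n t t')
    ... | t₁ , le , e , c , lc , v
      with least lem (λ j → ENDat Γ' (ctx t₁) j (par (dual a))) l'
             (lp' , loc-≤ p' (≤-trans (m≤n⊔m t t') le) , end')
    ...   | j , j≤l' , ej , min = proj₁ (loc-end t₁ e at v) a j
      ((lp , e , at , w) , ta , ≤-<-trans j≤l' (<-≤-trans (lk-< (ctx (t ⊔ t')) (loc-≤ p' (m≤n⊔m t t'))) lc) ,
        ej , min)

    Known : ℕ → Fin n → List Move → ℕ → ℕ → Set
    Known l j y K t = ∀ k → k < K → ∀ m → enum (Γ j) y k ≡ just m → InJ Γ I l m (triples t)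

    inJ-mono : ∀ {l m t t'} → t ≤ t' → InJ Γ I l m (triples t) → InJ Γ I l m (triples t')
    inJ-mono le p = let (k , q) = fromInJ p in toInJ (triples-mono (≤⇒≤′ le) q)

    inJ-last : ∀ {l m k J J'} → J' ≡ J ∷ʳ (l , m , k) → InJ Γ I l m J'
    inJ-last {J = J} refl = toInJ (∈-++⁺ʳ J (here refl))

    -- One more visit settles one more move. If the first `K` moves are known, a fresh move has
    -- number at least `K`: it is either move number `K`, or a later one, and then move number `K`
    -- had already been tried.
    learn : ∀ {l j y} (p : Loc l (j , y)) → ¬ Atomic Γ' (j , y) → turn (Γ' j) y ≡ P →
      ∀ K → Σ[ t ∈ ℕ ] proj₁ p ≤ t × Known l j y K t
    learn (t , _) na tu zero = t , ≤-refl , λ _ ()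
    learn {l} {j} {y} p na tu (suc K) with learn p na tu K
    ... | t , le , known with revisit p t le
    ...   | t' , le' , e , c , lc , v = suc t' , ≤-trans le (m≤n⇒m≤1+n le') , go v
      where
      old : ∀ {k m} → k < K → enum (Γ j) y k ≡ just m → InJ Γ I l m (triples t')
      old lt ek = inJ-mono le' (known _ lt _ ek)
      up : ∀ {m} → InJ Γ I l m (triples t') → InJ Γ I l m (triples (suc t'))
      up = inJ-mono (n≤1+n t')
      go : Visited l c (ctx t') (triples t') (triples (suc t')) → Known l j y (suc K) (suc t')
      go (passed (atom (lp , e' , at) _ _)) k lt m ek with lk-fun {xs = ctx t'} e e'
      ... | refl = ⊥-elim (na at)
      go (passed (allP j' y' (e' , _) all)) k lt m ek with lk-fun {xs = ctx t'} e e'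
      ... | refl = up (all m (enum-sound (Γ j) y k m (loc-pos p) ek))
      go (passed (someO j' y' (e' , _ , tu') _)) k lt m ek with lk-fun {xs = ctx t'} e e'
      ... | refl with trans (sym tu) tu'
      ...   | ()
      go (tookO j' y' m' (e' , _ , tu') _) k lt m ek with lk-fun {xs = ctx t'} e e'
      ... | refl with trans (sym tu) tu'
      ...   | ()
      go (tookP j' y' m' (e' , _) (k₀ , ek₀ , fresh , min) eq) k (s≤s lt) m ek with lk-fun {xs = ctx t'} e e'
      ... | refl with m≤n⇒m<n∨m≡n lt
      ...   | inj₁ lt' = up (old lt' ek)
      ...   | inj₂ refl with <-cmp k k₀
      ...     | tri< lt' _ _ = up (min k m lt' ek)
      ...     | tri≈ _ refl _ = subst (λ m → InJ Γ I l m (triples (suc t'))) (just-injective (trans (sym ek₀) ek))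
                                  (inJ-last {J = triples t'} eq)
      ...     | tri> _ _ gt = ⊥-elim (fresh (old gt ek₀))

    every-move : ∀ {l j y m} → Loc l (j , y) → turn (Γ' j) y ≡ P → pos (Γ' j) (y ∷ʳ m) → Σ[ k ∈ ℕ ] Tr l m k
    every-move {l} {j} {y} {m} p tu pm with enum-compl (Γ j) y m pm
    ... | K , eK with learn p (λ at → at m pm) tu (suc K)
    ...   | t , _ , known with fromInJ (known K ≤-refl m eK)
    ...     | k , q = k , t , q

    some-move : ∀ {l j y} → Loc l (j , y) → ¬ Atomic Γ' (j , y) → turn (Γ' j) y ≡ O →
      Σ[ m ∈ Move ] Σ[ k ∈ ℕ ] Tr l m k
    some-move {l} {j} {y} p@(t , _) na tu with revisit p t ≤-refl
    ... | t' , le' , e , c , lc , v = go v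
      where
      go : Visited l c (ctx t') (triples t') (triples (suc t')) → Σ[ m ∈ Move ] Σ[ k ∈ ℕ ] Tr l m k
      go (passed (atom (lp , e' , at) _ _)) with lk-fun {xs = ctx t'} e e'
      ... | refl = ⊥-elim (na at)
      go (passed (allP j' y' (e' , _ , tu') all)) with lk-fun {xs = ctx t'} e e'
      ... | refl with trans (sym tu) tu'
      ...   | ()
      go (passed (someO j' y' _ some)) with find (dne lem some)
      ... | (_ , m , k) , q , refl = m , k , t' , q
      go (tookP j' y' m (e' , _ , tu') _ eq) with lk-fun {xs = ctx t'} e e'
      ... | refl with trans (sym tu) tu'
      ...   | ()
      go (tookO j' y' m _ eq) with fromInJ (inJ-last {J = triples t'} eq)
      ... | k , q = m , k , suc t' , q

    Path : ℕ → List Move → ℕ → Set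
    Path l [] k = l ≡ k
    Path l (m ∷ y) k = Σ[ l' ∈ ℕ ] Tr l m l' × Path l' y k

    path-prefix : ∀ {l k} x y → Path l (x ++ y) k → Σ[ k' ∈ ℕ ] Path l x k'
    path-prefix [] y p = _ , refl
    path-prefix (m ∷ x) y (l' , t , p) = let (k' , p') = path-prefix x y p in k' , l' , t , p'

    path-snoc : ∀ {l m k k'} x → Path l x k → Tr k m k' → Path l (x ∷ʳ m) k'
    path-snoc [] refl t = _ , t , refl
    path-snoc (m ∷ x) (l' , t , p) t' = l' , t , path-snoc x p t'

    path-unsnoc : ∀ {l m k'} x → Path l (x ∷ʳ m) k' → Σ[ k ∈ ℕ ] Path l x k × Tr k m k'
    path-unsnoc [] (_ , t , refl) = _ , refl , t
    path-unsnoc (m ∷ x) (l' , t , p) = let (k , p' , t') = path-unsnoc x p in k , (l' , t , p') , t'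

    path-fun : ∀ {l k k'} x → Path l x k → Path l x k' → k ≡ k'
    path-fun [] refl refl = refl
    path-fun (m ∷ x) (l , t , p) (l' , t' , p') with tr-fun t t'
    ... | refl = path-fun x p p'

    path-loc : ∀ {l k j y} x → Path l x k → Loc l (j , y) → Loc k (j , y ++ x)
    path-loc {j = j} {y} [] refl loc = subst (λ z → Loc _ (j , z)) (sym (++-identityʳ y)) loc
    path-loc {k = k} {j} {y} (m ∷ x) (l' , t , p) loc =
      subst (λ z → Loc k (j , z)) (++-assoc y _ x) (path-loc x p (tr-loc t loc))

    σ : Fin n → List Move → Set
    σ j y = Σ[ k ∈ ℕ ] Path (toℕ j) y k

    loc : ∀ {j y} (p : σ j y) → Loc (proj₁ p) (j , y)
    loc {j} {y} (k , p) = path-loc y p (0 , root (soundAt 0) (rootCtx-lk j))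

    Seen : Par → Set
    Seen a = Σ[ l ∈ ℕ ] Σ[ lp ∈ LP n ] Loc l lp × IsEND Γ' lp (par a)

    -- A default that respects duality, for pairs of which neither member is met.
    sign : Par → Player
    sign (_ , true) = P
    sign (_ , false) = O

    η : Par → Player
    η a with lem {Seen a} | lem {Seen (dual a)}
    ... | yes _ | _ = O
    ... | no _ | yes _ = P
    ... | no _ | no _ = sign a

    dual-dual : ∀ a → dual (dual a) ≡ a
    dual-dual (k , true) = refl
    dual-dual (k , false) = refl

    sign-dual : ∀ a → sign (dual a) ≡ opp (sign a)
    sign-dual (k , true) = refl
    sign-dual (k , false) = refl

    η-assignment : IsAssignment I η
    η-assignment a ta with lem {Seen (dual a)} | lem {Seen (dual (dual a))} | lem {Seen a}
    ... | yes (_ , _ , p , e) | _ | yes (_ , _ , p' , e') = ⊥-elim (no-clash ta p' e' p e)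
    ... | yes _ | _ | no _ = refl
    ... | no _ | yes _ | yes _ = refl
    ... | no _ | yes s | no ns = ⊥-elim (ns (subst Seen (dual-dual a) s))
    ... | no _ | no ns | yes s = ⊥-elim (ns (subst Seen (sym (dual-dual a)) s))
    ... | no _ | no _ | no _ = sign-dual a

    η-seen : ∀ {a} → Seen a → η a ≡ O
    η-seen {a} s with lem {Seen a} | lem {Seen (dual a)}
    ... | yes _ | _ = refl
    ... | no ns | _ = ⊥-elim (ns s)

    -- A parameter outside `I` would survive in η(G_j) and deny O the leaf; `leaf-param` places it
    -- in `I`, and having been met it is sent to O.
    leaf-label : ∀ {j y} → σ j y → Leaf (Γ' j) y → assignLabel I η (win (Γ' j) y) ≡ pl O
    leaf-label {j} {y} s lf with win (Γ' j) y in w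
    ... | pl P = ⊥-elim (not-won (loc s) (proj₂ lf , w))
    ... | pl O = refl
    ... | par a with leaf-param y lf w
    ...   | ta with I a
    ...     | true = cong pl (η-seen (_ , _ , loc s , proj₂ lf , w))

    -- Each prefix of `q` brings its own path. Since paths are unique, the path of a longer prefix
    -- extends that of a shorter one, and the end indices form a single chain of triples, to which
    -- `lost` applies.
    σ-branch : ∀ {j} (q : ℕ → Move) → (∀ k → σ j (prefix q k)) → ¬ winP (Γ' j) q
    σ-branch {j} q all = lost j q (λ s → proj₁ (all s)) (sym (proj₂ (all 0))) link
      where
      link : ∀ s → Tr (proj₁ (all s)) (q s) (proj₁ (all (suc s)))
      link s with path-unsnoc (prefix q s)
                    (subst (λ x → Path (toℕ j) x (proj₁ (all (suc s)))) (prefix-snoc q s) (proj₂ (all (suc s))))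
      ... | k , p , t with path-fun (prefix q s) p (proj₂ (all s))
      ...   | refl = t

    O-wins : ∀ j → IsWinning O (assign I η (Γ' j)) (σ j)
    O-wins j = (((strategy , answers) , moves) , λ x → leaf-label) , σ-branch
      where
      strategy : IsStrategy (assign I η (Γ' j)) (σ j)
      strategy = (_ , refl) , (λ x y (k , p) → path-prefix x y p) , λ x s → loc-pos (loc s)
      answers : ∀ x → σ j x → NonLeaf (Γ' j) x → turn (Γ' j) x ≡ P → ∀ m → pos (Γ' j) (x ∷ʳ m) → σ j (x ∷ʳ m)
      answers x s _ tu m pm = let (k , t) = every-move (loc s) tu pm in k , path-snoc x (proj₂ s) t
      moves : ∀ x → σ j x → NonLeaf (Γ' j) x → turn (Γ' j) x ≡ O → ∃[ m ] σ j (x ∷ʳ m)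
      moves x s (_ , m' , pm') tu =
        let (m , k , t) = some-move (loc s) (λ at → at m' pm') tu in m , k , path-snoc x (proj₂ s) t

-- Lost runs from plays that end in DROP and from infinite plays

module Losing (lem : LEM) {n : ℕ} (Γ : Fin n → PGame) (I : Par → Bool) (sd : SelfDual I)
  (closed : ∀ a → ¬ FV (ForAll (λ i → game (Γ i)) I) a) where

  open Machine lem Γ I
  open Play Γ' I
  open Root Γ'
  open Strategy lem Γ I
  open Limit lem Γ I sd closed

  stuck-run : Stuck → LostRun
  stuck-run S = record
    { ctx = λ _ → ctx ; triples = λ _ → J ; sound = λ _ → snd
    ; ctx-grows = λ _ e → e ; triples-grow = λ _ p → p
    ; fair = λ t l lt → t , ≤-refl , length ctx , ≤-refl , passed (skips l lt)
    -- An infinite chain would satisfy `s ≤ js s`, yet all its indices after the first lie below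
    -- `length ctx`; `s = suc (length ctx)` is absurd.
    ; lost = λ i q js _ link _ → 1+n≰n (≤-trans (bound link (suc (length ctx))) (<⇒≤ (top link (length ctx))))  }
    where
    open Stuck S renaming (sound to snd)
    module _ {q : ℕ → Move} {js : ℕ → ℕ} (link : ∀ s → Σ[ t ∈ ℕ ] (js s , q s , js (suc s)) ∈ J) where
      bound : ∀ s → s ≤ js s
      bound zero = z≤n
      bound (suc s) = ≤-<-trans (bound s) (proj₁ (triple snd (proj₂ (link s))))
      top : ∀ s → js (suc s) < length ctx
      top s = let (_ , _ , _ , _ , e) = triple snd (proj₂ (link s)) in lk-< ctx e

  try-inv : ∀ {i ctx K a b r} → Try i ctx K (a ∷ b ∷ r) → a ≡ JUST i (length ctx) × K b r
  try-inv (try2 k) = refl , k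

  module Infinite (α : ℕ → Move) (branch : ∀ k → EXH Γ I (prefix α k)) (loses : ¬ winPF Γ' I α) where

    Played : ℕ → Move → ℕ → Set
    Played l m k = Σ[ s ∈ ℕ ] α (2 * s) ≡ JUST l k × α (suc (2 * s)) ≡ m

    -- A call of exh met along `α`, with the proof that the rest of `α` is a branch of it. `played`
    -- ties each triple to a round of `α`, which turns chains of triples into witnesses for `winPF`.
    record Conf : Set where
      field
        i c  : ℕ
        ctx  : Ctx n
        J    : List Triple
        u    : ℕ
        inv  : Inv i c ctx J
        rest : ∀ k → E i c ctx J (prefix (shift u α) k)
        played : ∀ {l m k} → (l , m , k) ∈ J → Played l m k

    module Cf = Conf

    data Step (K K' : Conf) : Set where
      restarted : Cf.i K ≡ Cf.c K → Cf.i K' ≡ 0 → Cf.c K' ≡ length (Cf.ctx K) → Step K K'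
      visited   : Cf.i K < Cf.c K → Cf.i K' ≡ suc (Cf.i K) → Cf.c K' ≡ Cf.c K →
                  Visited (Cf.i K) (Cf.c K) (Cf.ctx K) (Cf.J K) (Cf.J K') → Step K K'

    record Next (K : Conf) : Set where
      field
        next : Conf
        step : Step K next
        more-ctx : ∀ {l lp} → lk (Cf.ctx K) l ≡ just lp → lk (Cf.ctx next) l ≡ just lp
        more-J   : ∀ {x} → x ∈ Cf.J K → x ∈ Cf.J next
        longer   : length (Cf.ctx K) ≤ length (Cf.ctx next)

    add : ∀ K {j y m} → lk (Cf.ctx K) (Cf.i K) ≡ just (j , y) → Cf.i K < Cf.c K →
      shift (Cf.u K) α 0 ≡ JUST (Cf.i K) (length (Cf.ctx K)) → shift (Cf.u K) α 1 ≡ m →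
      Inv (suc (Cf.i K)) (Cf.c K) (Cf.ctx K ∷ʳ (j , y ∷ʳ m)) (Cf.J K ∷ʳ (Cf.i K , m , length (Cf.ctx K))) →
      (∀ k → Added (Cf.i K) (Cf.c K) (Cf.ctx K) (Cf.J K) (j , y) m (prefix (λ s → shift (Cf.u K) α (2 + s)) k)) →
      Visited (Cf.i K) (Cf.c K) (Cf.ctx K) (Cf.J K) (Cf.J K ∷ʳ (Cf.i K , m , length (Cf.ctx K))) → Next K
    add K {j} {y} {m} e l a₀ a₁ v r vis = record
      { next = record
          { i = suc i ; c = c ; ctx = ctx ∷ʳ (j , y ∷ʳ m) ; J = J ∷ʳ (i , m , length ctx) ; u = suc u ; inv = v
          ; rest = λ k → subst (E _ _ _ _) (shift-suc u α k) (r k) ; played = pl' }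
      ; step = visited l refl refl vis
      ; more-ctx = lk-++ ctx ; more-J = ∈-++⁺ˡ
      ; longer = subst (length ctx ≤_) (sym (length-snoc ctx)) (n≤1+n _) }
      where
      open Conf K
      pl' : ∀ {l m' k} → (l , m' , k) ∈ J ∷ʳ (i , m , length ctx) → Played l m' k
      pl' p with ∈-snoc⁻ J p
      ... | inj₁ q = played q
      ... | inj₂ refl = u , trans (cong α (sym (+-identityʳ (2 * u)))) a₀ , trans (cong α (+-comm 1 (2 * u))) a₁

    -- The action is fixed once and `toOut` applies it to all prefixes. Clauses that end the play
    -- contain no position of length two, so they are refuted by the prefix with two moves.
    advance : ∀ K → Next K
    advance K with action-exists (entries (sound (Cf.inv K))) (i≤c (Cf.inv K)) (c≤len (Cf.inv K))
      | (λ (A : Action _ _ _ _) k → toOut (entries (sound (Cf.inv K))) A (Cf.rest K k))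
    ... | restart e l | out = record
      { next = record { i = 0 ; c = length ctx ; ctx = ctx ; J = J ; u = u ; inv = inv-restart inv
                      ; rest = out (restart e l) ; played = played }
      ; step = restarted e refl refl ; more-ctx = λ e → e ; more-J = λ p → p ; longer = ≤-refl }
      where open Conf K
    ... | finish e l | out with out (finish e l) 2
    ...   | inj₁ ()
    ...   | inj₂ ()
    advance K | visit l (em a j e) | out with out (visit l (em a j e)) 2
    ...   | inj₁ ()
    ...   | inj₂ ()
    advance K | visit l (stop e) | out with out (visit l (stop e)) 2
    ...   | inj₁ ()
    ...   | inj₂ ()
    advance K | visit l (pass s) | out = record
      { next = record { i = suc i ; c = c ; ctx = ctx ; J = J ; u = u ; inv = inv-skip inv l s
                      ; rest = out (visit l (pass s)) ; played = played }
      ; step = visited l refl refl (passed s) ; more-ctx = λ e → e ; more-J = λ p → p ; longer = ≤-refl }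
      where open Conf K
    advance K | visit l (takeP j y m na f) | out =
      add K (proj₁ na) l (proj₁ (tries 0)) (proj₁ (proj₂ (tries 0))) (inv-takeP (Cf.inv K) l na f)
        (λ k → proj₂ (proj₂ (tries k))) (tookP j y m na f refl)
      where
      tries : ∀ k → _
      tries k = try-inv (out (visit l (takeP j y m na f)) (2 + k))
    advance K | visit l (takeO j y na nt) | out =
      add K (proj₁ na) l (proj₁ (tries 0)) refl (inv-takeO (Cf.inv K) l na nt (proj₁ (proj₂ (tries 0))))
        (λ k → proj₂ (proj₂ (tries k))) (tookO j y _ na refl)
      where
      tries : ∀ k → _
      tries k = try-inv (out (visit l (takeO j y na nt)) (2 + k))

    conf : ℕ → Conf
    conf zero = record { i = 0 ; c = n ; ctx = rootCtx Γ' ; J = [] ; u = 0 ; inv = inv-init ; rest = branch ; played = λ () }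
    conf (suc t) = Next.next (advance (conf t))

    -- `d` counts the visits left in the current pass. Waiting for its end is necessary because
    -- indices added during a pass lie beyond its bound; the restart raises the bound to the current
    -- length, which covers everything present at `t`.
    to-restart : ∀ d t → d + Cf.i (conf t) ≡ Cf.c (conf t) →
      Σ[ t' ∈ ℕ ] t ≤ t' × Cf.i (conf t') ≡ 0 × length (Cf.ctx (conf t)) ≤ Cf.c (conf t')
    to-restart d t e with Next.step (advance (conf t))
    ... | restarted _ i₀ cl = suc t , n≤1+n t , i₀ , ≤-reflexive (sym cl)
    to-restart zero t e | visited l _ _ _ = ⊥-elim (<-irrefl e l)
    to-restart (suc d) t e | visited _ is ce _
      with to-restart d (suc t) (trans (cong (d +_) is) (trans (+-suc d _) (trans e (sym ce))))
    ... | t' , le , i₀ , cl = t' , <⇒≤ le , i₀ , ≤-trans (Next.longer (advance (conf t))) cl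

    -- Within a pass each step raises `i` by one and keeps `c`, so the visit to `l` happens exactly
    -- `l` steps after the start.
    reach : ∀ t → Cf.i (conf t) ≡ 0 → ∀ l → l ≤ Cf.c (conf t) →
      Cf.i (conf (l + t)) ≡ l × Cf.c (conf (l + t)) ≡ Cf.c (conf t)
    reach t i₀ zero _ = i₀ , refl
    reach t i₀ (suc l) lt with reach t i₀ l (<⇒≤ lt)
    ... | il , cl with Next.step (advance (conf (l + t)))
    ...   | restarted e _ _ = ⊥-elim (<-irrefl (trans (sym il) (trans e cl)) lt)
    ...   | visited _ is ce _ = trans is (cong suc il) , trans ce cl

    visited-at : ∀ {l l' c ctx J J'} → l ≡ l' → Visited l c ctx J J' → Visited l' c ctx J J'
    visited-at refl v = v

    infinite-run : LostRun
    infinite-run = record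
      { ctx = λ t → Cf.ctx (conf t) ; triples = λ t → Cf.J (conf t) ; sound = λ t → sound (Cf.inv (conf t))
      ; ctx-grows = λ t → Next.more-ctx (advance (conf t)) ; triples-grow = λ t → Next.more-J (advance (conf t))
      ; fair = fair
      ; lost = λ i q js e link w → loses (i , q , js , e , (λ s → Cf.played (conf (proj₁ (link s))) (proj₂ (link s))) , w) }
      where
      fair : ∀ t l → l < length (Cf.ctx (conf t)) → Σ[ t' ∈ ℕ ] t ≤ t' × Σ[ c ∈ ℕ ] length (Cf.ctx (conf t)) ≤ c ×
        Visited l c (Cf.ctx (conf t')) (Cf.J (conf t')) (Cf.J (conf (suc t')))
      fair t l lt with to-restart (Cf.c (conf t) ∸ Cf.i (conf t)) t (m∸n+n≡m (i≤c (Cf.inv (conf t))))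
      ... | t₁ , le , i₀ , cl with reach t₁ i₀ l (<⇒≤ (<-≤-trans lt cl))
      ...   | il , ce with Next.step (advance (conf (l + t₁)))
      ...     | restarted e _ _ = ⊥-elim (<-irrefl (trans (sym il) (trans e ce)) (<-≤-trans lt cl))
      ...     | visited _ _ _ v = l + t₁ , ≤-trans le (m≤n+m t₁ l) , _ , subst (_ ≤_) (sym ce) cl , visited-at il v

  exh-wins : ¬ LostRun → IsWinning P (ForAll Γ' I) (EXH Γ I)
  exh-wins none = exh-partially-winning (λ s → none (stuck-run s)) , λ α b → dne lem λ l → none (Infinite.infinite-run α b l)

  opponent-wins : LostRun → HasWinning O (ForAll Γ' I)
  opponent-wins R = _ , Opponent.wins lem Γ' I sd η η-assignment (λ j → σ j , O-wins j)
    where open FromRun R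

-- Arithmetic

isz : ℕ → Bool
isz zero = true
isz (suc _) = false

zeroness : ℕ → ℕ
zeroness zero = 1
zeroness (suc _) = 0

oddness : ℕ → ℕ
oddness zero = 0
oddness (suc n) = zeroness (oddness n)

half : ℕ → ℕ
half zero = 0
half (suc n) = half n + oddness n

halves : ℕ → ℕ → ℕ
halves zero z = z
halves (suc r) z = half (halves r z)

-- The 2-adic valuation as an iteration: the counter rises while the quotient by its power of 2 is
-- even and then rests. Since `pair a b` is `2 ^ a` times an odd number and `a ≤ pair a b`,
-- iterating as often as the number itself says is enough.
valuation : ℕ → ℕ → ℕ
valuation zero z = 0
valuation (suc k) z = valuation k z + zeroness (oddness (halves (valuation k z) z))

unpair₁ unpair₂ : ℕ → ℕ
unpair₁ z = valuation z z
unpair₂ z = half (halves (unpair₁ z) z)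

oddness-+2 : ∀ n → oddness (2 + n) ≡ oddness n
oddness-+2 zero = refl
oddness-+2 (suc n) = cong zeroness (oddness-+2 n)

oddness-double : ∀ m → oddness (2 * m) ≡ 0
oddness-double zero = refl
oddness-double (suc m) = trans (cong oddness (*-suc 2 m)) (trans (oddness-+2 (2 * m)) (oddness-double m))

half-double : ∀ m → half (2 * m) ≡ m
half-double zero = refl
half-double (suc m) = trans (cong half (*-suc 2 m))
  (trans (cong₂ _+_ (trans (cong₂ _+_ (half-double m) (oddness-double m)) (+-identityʳ m)) (cong zeroness (oddness-double m)))
    (+-comm m 1))

half-odd : ∀ m → half (suc (2 * m)) ≡ m
half-odd m = trans (cong₂ _+_ (half-double m) (oddness-double m)) (+-identityʳ m)

module _ (a b : ℕ) where

  private
    odd z : ℕ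
    odd = suc (2 * b)
    z = 2 ^ a * odd

    halves-pow : ∀ r d → halves r (2 ^ (r + d) * odd) ≡ 2 ^ d * odd
    halves-pow zero d = refl
    halves-pow (suc r) d = trans
      (cong half (trans (cong (λ e → halves r (2 ^ e * odd)) (sym (+-suc r d)))
                   (trans (halves-pow r (suc d)) (*-assoc 2 (2 ^ d) odd))))
      (half-double (2 ^ d * odd))

    halves-top : halves a z ≡ odd
    halves-top = trans (cong (λ e → halves a (2 ^ e * odd)) (sym (+-identityʳ a)))
                   (trans (halves-pow a 0) (*-identityˡ odd))

    below : ∀ k → k ≤ a → valuation k z ≡ k
    below zero _ = refl
    below (suc k) lt with m≤n⇒∃[o]m+o≡n lt
    ... | d , eq rewrite below k (<⇒≤ lt) = trans (cong (λ e → k + zeroness (oddness e)) at-k)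
        (trans (cong (λ p → k + zeroness p) (oddness-double (2 ^ d * odd))) (+-comm k 1))
      where
      at-k : halves k z ≡ 2 * (2 ^ d * odd)
      at-k = trans (cong (λ e → halves k (2 ^ e * odd)) (trans (sym eq) (sym (+-suc k d))))
               (trans (halves-pow k (suc d)) (*-assoc 2 (2 ^ d) odd))

    above : ∀ e → valuation (e + a) z ≡ a
    above zero = below a ≤-refl
    above (suc e) rewrite above e | halves-top | oddness-double b = +-identityʳ a

    n<2^n : ∀ n → n < 2 ^ n
    n<2^n zero = s≤s z≤n
    n<2^n (suc n) = ≤-trans (+-mono-≤ (m^n>0 2 n) (n<2^n n)) (+-monoʳ-≤ (2 ^ n) (m≤m+n (2 ^ n) 0))

    a≤z : a ≤ z
    a≤z = ≤-trans (<⇒≤ (n<2^n a)) (m≤m*n (2 ^ a) odd)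

  unpair₁-pair : unpair₁ (pair a b) ≡ a
  unpair₁-pair = trans (cong (λ k → valuation k z) (sym (m∸n+n≡m a≤z))) (above (z ∸ a))

  unpair₂-pair : unpair₂ (pair a b) ≡ b
  unpair₂-pair = trans (cong (λ r → half (halves r z)) unpair₁-pair) (trans (cong half halves-top) (half-odd b))

  pair-≥ʳ : b ≤ pair a b
  pair-≥ʳ = ≤-trans (m≤n*m b 2) (≤-trans (n≤1+n _) (m≤n*m odd (2 ^ a) {{m^n≢0 2 a}}))

pair-injective : ∀ a b a' b' → pair a b ≡ pair a' b' → a ≡ a' × b ≡ b'
pair-injective a b a' b' e =
  trans (sym (unpair₁-pair a b)) (trans (cong unpair₁ e) (unpair₁-pair a' b')) ,
  trans (sym (unpair₂-pair a b)) (trans (cong unpair₂ e) (unpair₂-pair a' b'))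

-- Coded types

decodeTag : Move → ℕ
decodeTag (DROP _) = 0
decodeTag (EM _ _) = 1
decodeTag (STOP _) = 2
decodeTag (JUST _ _) = 3
decodeTag (nth _) = 4

decodeBody : Move → ℕ
decodeBody (DROP a) = a
decodeBody (EM a b) = pair a b
decodeBody (STOP a) = a
decodeBody (JUST a b) = pair a b
decodeBody (nth a) = a

codeMove-split : ∀ m → codeMove m ≡ decodeTag m + decodeBody m * 5
codeMove-split (DROP a) = *-comm 5 a
codeMove-split (EM a b) = cong suc (*-comm 5 (pair a b))
codeMove-split (STOP a) = cong (2 +_) (*-comm 5 a)
codeMove-split (JUST a b) = cong (3 +_) (*-comm 5 (pair a b))
codeMove-split (nth a) = cong (4 +_) (*-comm 5 a)

tag%5 : ∀ m → decodeTag m % 5 ≡ decodeTag m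
tag%5 (DROP _) = refl
tag%5 (EM _ _) = refl
tag%5 (STOP _) = refl
tag%5 (JUST _ _) = refl
tag%5 (nth _) = refl

codeMove-tag : ∀ m → codeMove m % 5 ≡ decodeTag m
codeMove-tag m = trans (cong (_% 5) (codeMove-split m)) (trans ([m+kn]%n≡m%n (decodeTag m) (decodeBody m) 5) (tag%5 m))

move-ext : ∀ m m' → decodeTag m ≡ decodeTag m' → decodeBody m ≡ decodeBody m' → m ≡ m'
move-ext (DROP _) (DROP _) _ refl = refl
move-ext (EM a b) (EM a' b') _ e with pair-injective a b a' b' e
... | refl , refl = refl
move-ext (STOP _) (STOP _) _ refl = refl
move-ext (JUST a b) (JUST a' b') _ e with pair-injective a b a' b' e
... | refl , refl = refl
move-ext (nth _) (nth _) _ refl = refl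

-- The remainder modulo 5 recovers the constructor; cancelling it leaves the code of the arguments.
codeMove-injective : ∀ {m m'} → codeMove m ≡ codeMove m' → m ≡ m'
codeMove-injective {m} {m'} e = move-ext m m' tag body
  where
  tag : decodeTag m ≡ decodeTag m'
  tag = trans (sym (codeMove-tag m)) (trans (cong (_% 5) e) (codeMove-tag m'))
  body : decodeBody m ≡ decodeBody m'
  body = *-cancelʳ-≡ _ _ 5 (+-cancelˡ-≡ (decodeTag m) _ _
    (trans (sym (codeMove-split m)) (trans e (trans (codeMove-split m') (cong (_+ decodeBody m' * 5) (sym tag))))))

infixr 4 _⊗_

-- A universe with one fixed coding for each type of data, so that programs compose along types and
-- their correctness is stated for the values rather than for codes.
data Ty : Set where
  nat bool move : Ty
  _⊗_ : Ty → Ty → Ty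
  list : Ty → Ty

El : Ty → Set
El nat = ℕ
El bool = Bool
El move = Move
El (A ⊗ B) = El A × El B
El (list A) = List (El A)

encList : {A : Set} → (A → ℕ) → List A → ℕ
encList f [] = 0
encList f (a ∷ as) = suc (pair (f a) (encList f as))

enc : ∀ A → El A → ℕ
enc nat n = n
enc bool b = codeBool b
enc move m = codeMove m
enc (A ⊗ B) (a , b) = pair (enc A a) (enc B b)
enc (list A) xs = encList (enc A) xs

encList-injective : ∀ {A : Set} {f : A → ℕ} → (∀ a b → f a ≡ f b → a ≡ b) → ∀ xs ys → encList f xs ≡ encList f ys → xs ≡ ys
encList-injective inj [] [] _ = refl
encList-injective {f = f} inj (x ∷ xs) (y ∷ ys) e with pair-injective (f x) (encList f xs) (f y) (encList f ys) (suc-injective e)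
... | p , q = cong₂ _∷_ (inj x y p) (encList-injective inj xs ys q)

-- The code of a list can serve as the number of steps of a fold over it. This breaks a circle,
-- since the length is itself obtained as a fold.
length≤encList : ∀ {A : Set} (f : A → ℕ) xs → length xs ≤ encList f xs
length≤encList f [] = z≤n
length≤encList f (x ∷ xs) = s≤s (≤-trans (length≤encList f xs) (pair-≥ʳ (f x) (encList f xs)))

encList-codeList : ∀ x → encList codeMove x ≡ codeList x
encList-codeList [] = refl
encList-codeList (m ∷ x) = cong (λ r → suc (pair (codeMove m) r)) (encList-codeList x)

-- Primitive recursive programs

module Programs where

  open import Data.Vec using (Vec; []; _∷_)

  p0 : ∀ {k} → PR (suc k)
  p0 = prj fz
  p1 : ∀ {k} → PR (suc (suc k))
  p1 = prj (fs fz)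
  p2 : ∀ {k} → PR (suc (suc (suc k)))
  p2 = prj (fs (fs fz))

  num : ∀ {k} → ℕ → PR k
  num zero = zer
  num (suc n) = cmp sc (num n ∷ [])

  addPR mulPR monusPR halvesPR pairPR : PR 2
  predPR zeronessPR oddnessPR halfPR powPR unpair₁PR unpair₂PR : PR 1
  addPR = rec p0 (cmp sc (p1 ∷ []))
  mulPR = rec zer (cmp addPR (p2 ∷ p1 ∷ []))
  predPR = rec zer p0
  monusPR = rec p0 (cmp predPR (p1 ∷ []))
  zeronessPR = rec (num 1) zer
  oddnessPR = rec zer (cmp zeronessPR (p1 ∷ []))
  halfPR = rec zer (cmp addPR (p1 ∷ cmp oddnessPR (p0 ∷ []) ∷ []))
  powPR = rec (num 1) (cmp mulPR (num 2 ∷ p1 ∷ []))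
  halvesPR = rec p0 (cmp halfPR (p1 ∷ []))
  pairPR = cmp mulPR (cmp powPR (p0 ∷ []) ∷ cmp sc (cmp mulPR (num 2 ∷ p1 ∷ []) ∷ []) ∷ [])
  unpair₁PR = cmp (rec zer (cmp addPR (p1 ∷ cmp zeronessPR (cmp oddnessPR (cmp halvesPR (p1 ∷ p2 ∷ []) ∷ []) ∷ []) ∷ [])))
    (p0 ∷ p0 ∷ [])
  unpair₂PR = cmp halfPR (cmp halvesPR (unpair₁PR ∷ p0 ∷ []) ∷ [])

  module _ (or : Oracles) where

    private
      ev : ∀ {k} → PR k → Vec ℕ k → ℕ
      ev = evalPR or

    num-eval : ∀ {k} n (xs : Vec ℕ k) → ev (num n) xs ≡ n
    num-eval zero xs = refl
    num-eval (suc n) xs = cong suc (num-eval n xs)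

    add-eval : ∀ {y x y' x'} → y ≡ y' → x ≡ x' → ev addPR (y ∷ x ∷ []) ≡ y' + x'
    add-eval {y} {x} refl refl = go y
      where
      go : ∀ y → ev addPR (y ∷ x ∷ []) ≡ y + x
      go zero = refl
      go (suc y) = cong suc (go y)

    mul-eval : ∀ {y x y' x'} → y ≡ y' → x ≡ x' → ev mulPR (y ∷ x ∷ []) ≡ y' * x'
    mul-eval {y} {x} refl refl = go y
      where
      go : ∀ y → ev mulPR (y ∷ x ∷ []) ≡ y * x
      go zero = refl
      go (suc y) = add-eval {x} refl (go y)

    pred-eval : ∀ {x x'} → x ≡ x' → ev predPR (x ∷ []) ≡ pred x'
    pred-eval {zero} refl = refl
    pred-eval {suc x} refl = refl

    monus-eval : ∀ {y x y' x'} → y ≡ y' → x ≡ x' → ev monusPR (y ∷ x ∷ []) ≡ x' ∸ y'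
    monus-eval {y} {x} refl refl = go y
      where
      go : ∀ y → ev monusPR (y ∷ x ∷ []) ≡ x ∸ y
      go zero = refl
      go (suc y) = trans (pred-eval (go y)) (pred[m∸n]≡m∸[1+n] x y)

    zeroness-eval : ∀ {x x'} → x ≡ x' → ev zeronessPR (x ∷ []) ≡ zeroness x'
    zeroness-eval {zero} refl = refl
    zeroness-eval {suc x} refl = refl

    oddness-eval : ∀ {x x'} → x ≡ x' → ev oddnessPR (x ∷ []) ≡ oddness x'
    oddness-eval {zero} refl = refl
    oddness-eval {suc x} refl = zeroness-eval (oddness-eval {x} refl)

    half-eval : ∀ {x x'} → x ≡ x' → ev halfPR (x ∷ []) ≡ half x'
    half-eval {zero} refl = refl
    half-eval {suc x} refl = add-eval (half-eval {x} refl) (oddness-eval {x} refl)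

    pow-eval : ∀ {x x'} → x ≡ x' → ev powPR (x ∷ []) ≡ 2 ^ x'
    pow-eval {zero} refl = refl
    pow-eval {suc x} refl = mul-eval {2} refl (pow-eval {x} refl)

    halves-eval : ∀ {r z r' z'} → r ≡ r' → z ≡ z' → ev halvesPR (r ∷ z ∷ []) ≡ halves r' z'
    halves-eval {zero} refl refl = refl
    halves-eval {suc r} {z} refl refl = half-eval {x' = halves r z} (halves-eval {r} refl refl)

    pair-eval : ∀ {a b a' b'} → a ≡ a' → b ≡ b' → ev pairPR (a ∷ b ∷ []) ≡ pair a' b'
    pair-eval {a} {b} refl refl = mul-eval {y' = 2 ^ a} (pow-eval {a} refl) (cong suc (mul-eval {2} {b} refl refl))

    unpair₁-eval : ∀ {z z'} → z ≡ z' → ev unpair₁PR (z ∷ []) ≡ unpair₁ z'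
    unpair₁-eval {z} refl = go z
      where
      go : ∀ k → iterPR or _ _ k (z ∷ []) ≡ valuation k z
      go zero = refl
      go (suc k) = add-eval (go k) (zeroness-eval (oddness-eval {x' = halves (valuation k z) z} (halves-eval (go k) refl)))

    unpair₂-eval : ∀ {z z'} → z ≡ z' → ev unpair₂PR (z ∷ []) ≡ unpair₂ z'
    unpair₂-eval {z} refl = half-eval {x' = halves (unpair₁ z) z} (halves-eval (unpair₁-eval {z} refl) refl)

  -- The program is fixed before the oracles, as `PrimRecRel` requires, and correctness holds for
  -- all oracles, whether or not they describe games.
  record Computable (A B : Ty) (f : Oracles → El A → El B) : Set where
    no-eta-equality
    constructor computable
    field
      program : PR 1
      correct : ∀ or a → evalPR or program (enc A a ∷ []) ≡ enc B (f or a)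
  open Computable public

  Fun : Ty → Ty → Set
  Fun A B = Oracles → El A → El B

  eqb ltb : ℕ → ℕ → Bool
  eqb x y = isz ((x ∸ y) + (y ∸ x))
  ltb x y = isz (suc x ∸ y)

  iter : ∀ {A : Set} → ℕ → (A → A) → A → A
  iter zero f z = z
  iter (suc k) f z = f (iter k f z)

  iter-shift : ∀ {A : Set} k (f : A → A) z → iter (suc k) f z ≡ iter k f (f z)
  iter-shift zero f z = refl
  iter-shift (suc k) f z = cong f (iter-shift k f z)

  hd : ∀ {A : Set} → A → List A → A
  hd d [] = d
  hd d (x ∷ _) = x

  tl : ∀ {A : Set} → List A → List A
  tl [] = []
  tl (_ ∷ xs) = xs

  null : ∀ {A : Set} → List A → Bool
  null [] = true
  null (_ ∷ _) = false

  get : ∀ {A : Set} → A → ℕ → List A → A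
  get d i xs = hd d (iter i tl xs)

  -- The candidate starts at 0, moves up until `p` holds and then rests; the value `b` results when
  -- no number below `b` passes.
  search : (ℕ → Bool) → ℕ → ℕ
  search p b = iter b (λ k → if p k then k else suc k) 0

  anyb : ∀ {A : Set} → (A → Bool) → List A → Bool
  anyb p = foldl (λ acc x → if p x then true else acc) false

  idC : ∀ {A} → Computable A A (λ _ a → a)
  idC = computable p0 λ _ _ → refl

  constC : ∀ {A} B (b : El B) → Computable A B (λ _ _ → b)
  constC B b = computable (num (enc B b)) λ or a → num-eval or (enc B b) _

  castC : ∀ {A B} {f g : Fun A B} → Computable A B f → (∀ or a → f or a ≡ g or a) → Computable A B g
  castC {B = B} F e = computable (program F) λ or a → trans (correct F or a) (cong (enc B) (e or a))

  encC : ∀ {A B} {f : Fun A B} → Computable A B f → Computable A nat (λ or a → enc B (f or a))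
  encC F = computable (program F) (correct F)

  infixr 9 _∘C_
  _∘C_ : ∀ {A B C} {g : Fun B C} {f : Fun A B} →
    Computable B C g → Computable A B f → Computable A C (λ or a → g or (f or a))
  G ∘C F = computable (cmp (program G) (program F ∷ [])) λ or a →
    trans (cong (λ z → evalPR or (program G) (z ∷ [])) (correct F or a)) (correct G or _)

  infixr 4 _,C_
  _,C_ : ∀ {A B C} {f : Fun A B} {g : Fun A C} →
    Computable A B f → Computable A C g → Computable A (B ⊗ C) (λ or a → (f or a , g or a))
  F ,C G = computable (cmp pairPR (program F ∷ program G ∷ [])) λ or a →
    pair-eval or (correct F or a) (correct G or a)

  fstC : ∀ {A B C} {f : Fun A (B ⊗ C)} → Computable A (B ⊗ C) f → Computable A B (λ or a → proj₁ (f or a))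
  fstC {B = B} {C} {f} F = computable (cmp unpair₁PR (program F ∷ [])) λ or a →
    trans (unpair₁-eval or (correct F or a)) (unpair₁-pair (enc B (proj₁ (f or a))) (enc C (proj₂ (f or a))))

  sndC : ∀ {A B C} {f : Fun A (B ⊗ C)} → Computable A (B ⊗ C) f → Computable A C (λ or a → proj₂ (f or a))
  sndC {B = B} {C} {f} F = computable (cmp unpair₂PR (program F ∷ [])) λ or a →
    trans (unpair₂-eval or (correct F or a)) (unpair₂-pair (enc B (proj₁ (f or a))) (enc C (proj₂ (f or a))))

  ifC : ∀ {A B} {b : Fun A bool} {f g : Fun A B} → Computable A bool b → Computable A B f → Computable A B g →
    Computable A B (λ or a → if b or a then f or a else g or a)
  ifC {B = B} {b} {f} {g} H F G = computable
    (cmp addPR (cmp mulPR (program H ∷ program F ∷ []) ∷ cmp mulPR (cmp zeronessPR (program H ∷ []) ∷ program G ∷ []) ∷ []))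
    λ or a → trans (add-eval or (mul-eval or (correct H or a) (correct F or a))
                      (mul-eval or (zeroness-eval or (correct H or a)) (correct G or a)))
               (choose (b or a) (f or a) (g or a))
    where
    choose : ∀ c x y → codeBool c * enc B x + zeroness (codeBool c) * enc B y ≡ enc B (if c then x else y)
    choose true x y = trans (+-identityʳ _) (+-identityʳ _)
    choose false x y = +-identityʳ _

  notC : ∀ {A} {f : Fun A bool} → Computable A bool f → Computable A bool (λ or a → if f or a then false else true)
  notC F = ifC F (constC bool false) (constC bool true)

  iterC : ∀ {A B} {n : Fun A nat} {z : Fun A B} {s : Fun (A ⊗ B) B} →
    Computable A nat n → Computable A B z → Computable (A ⊗ B) B s →
    Computable A B (λ or a → iter (n or a) (λ b → s or (a , b)) (z or a))
  iterC {A} {B} {n} {z} {s} N Z S = computable (cmp (rec (program Z) body) (program N ∷ p0 ∷ []))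
    λ or a → trans (cong (λ k → iterPR or (program Z) body k (enc A a ∷ [])) (correct N or a)) (go or a (n or a))
    where
    body : PR 3
    body = cmp (program S) (cmp pairPR (p2 ∷ p1 ∷ []) ∷ [])
    go : ∀ or a k → iterPR or (program Z) body k (enc A a ∷ []) ≡ enc B (iter k (λ b → s or (a , b)) (z or a))
    go or a zero = correct Z or a
    go or a (suc k) = trans (cong (λ w → evalPR or (program S) (w ∷ []))
      (pair-eval or {enc A a} refl (go or a k))) (correct S or _)

  module _ {A B : Ty} where

    consC : {f : Fun A B} {g : Fun A (list B)} → Computable A B f → Computable A (list B) g →
      Computable A (list B) (λ or a → f or a ∷ g or a)
    consC F G = computable (cmp sc (program (F ,C G) ∷ [])) λ or a → cong suc (correct (F ,C G) or a)

    nullC : {f : Fun A (list B)} → Computable A (list B) f → Computable A bool (λ or a → null (f or a))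
    nullC {f} F = computable (cmp zeronessPR (program F ∷ [])) λ or a →
      trans (zeroness-eval or (correct F or a)) (go (f or a))
      where
      go : ∀ xs → zeroness (enc (list B) xs) ≡ codeBool (null xs)
      go [] = refl
      go (_ ∷ _) = refl

    tlC : {f : Fun A (list B)} → Computable A (list B) f → Computable A (list B) (λ or a → tl (f or a))
    tlC {f} F = computable (cmp unpair₂PR (cmp predPR (program F ∷ []) ∷ [])) λ or a →
      trans (unpair₂-eval or (pred-eval or (correct F or a))) (go (f or a))
      where
      go : ∀ xs → unpair₂ (pred (enc (list B) xs)) ≡ enc (list B) (tl xs)
      go [] = refl
      go (x ∷ xs) = unpair₂-pair (enc B x) (enc (list B) xs)

    hdC : (d : El B) {f : Fun A (list B)} → Computable A (list B) f → Computable A B (λ or a → hd d (f or a))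
    hdC d {f} F = computable (program D) λ or a → trans (correct D or a) (head-code (f or a))
      where
      headCode : List (El B) → ℕ
      headCode xs = if null xs then enc B d else unpair₁ (pred (enc (list B) xs))
      D : Computable A nat (λ or a → headCode (f or a))
      D = ifC (nullC F) (constC nat (enc B d)) (computable (cmp unpair₁PR (cmp predPR (program F ∷ []) ∷ [])) λ or a →
            unpair₁-eval or (pred-eval or (correct F or a)))
      head-code : ∀ xs → headCode xs ≡ enc B (hd d xs)
      head-code [] = refl
      head-code (x ∷ xs) = unpair₁-pair (enc B x) (enc (list B) xs)

  module _ {A : Ty} {f g : Fun A nat} (F : Computable A nat f) (G : Computable A nat g) where

    addC : Computable A nat (λ or a → f or a + g or a)
    addC = computable (cmp addPR (program F ∷ program G ∷ [])) λ or a →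
      add-eval or (correct F or a) (correct G or a)

    mulC : Computable A nat (λ or a → f or a * g or a)
    mulC = computable (cmp mulPR (program F ∷ program G ∷ [])) λ or a →
      mul-eval or (correct F or a) (correct G or a)

    monusC : Computable A nat (λ or a → f or a ∸ g or a)
    monusC = computable (cmp monusPR (program G ∷ program F ∷ [])) λ or a →
      monus-eval or (correct G or a) (correct F or a)

  module _ {A : Ty} {f : Fun A nat} (F : Computable A nat f) where

    sucC : Computable A nat (λ or a → suc (f or a))
    sucC = computable (cmp sc (program F ∷ [])) λ or a → cong suc (correct F or a)

    predC : Computable A nat (λ or a → pred (f or a))
    predC = computable (cmp predPR (program F ∷ [])) λ or a → pred-eval or (correct F or a)

    oddnessC : Computable A nat (λ or a → oddness (f or a))
    oddnessC = computable (cmp oddnessPR (program F ∷ [])) λ or a → oddness-eval or (correct F or a)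

    iszC : Computable A bool (λ or a → isz (f or a))
    iszC = computable (cmp zeronessPR (program F ∷ [])) λ or a →
      trans (zeroness-eval or (correct F or a)) (go (f or a))
      where
      go : ∀ x → zeroness x ≡ codeBool (isz x)
      go zero = refl
      go (suc _) = refl

    oracleC : ∀ o → Computable A nat (λ or a → or o (f or a))
    oracleC o = computable (cmp (orc o) (program F ∷ [])) λ or a → cong (or o) (correct F or a)

    private
      5f : Computable A nat (λ or a → 5 * f or a)
      5f = mulC (constC nat 5) F

    DROPc : Computable A move (λ or a → DROP (f or a))
    DROPc = computable (program 5f) (correct 5f)

    STOPc : Computable A move (λ or a → STOP (f or a))
    STOPc = computable (program (addC (constC nat 2) 5f)) (correct (addC (constC nat 2) 5f))

  module _ {A : Ty} {f g : Fun A nat} (F : Computable A nat f) (G : Computable A nat g) where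

    eqC : Computable A bool (λ or a → eqb (f or a) (g or a))
    eqC = iszC (addC (monusC F G) (monusC G F))

    ltC : Computable A bool (λ or a → ltb (f or a) (g or a))
    ltC = iszC (monusC (sucC F) G)

    private
      5pair : Computable A nat (λ or a → 5 * pair (f or a) (g or a))
      5pair = mulC (constC nat 5) (encC (F ,C G))

    EMc : Computable A move (λ or a → EM (f or a) (g or a))
    EMc = computable (program (addC (constC nat 1) 5pair)) (correct (addC (constC nat 1) 5pair))

    JUSTc : Computable A move (λ or a → JUST (f or a) (g or a))
    JUSTc = computable (program (addC (constC nat 3) 5pair)) (correct (addC (constC nat 3) 5pair))

  searchC : ∀ {A} {p : Fun (A ⊗ nat) bool} {n : Fun A nat} → Computable (A ⊗ nat) bool p → Computable A nat n →
    Computable A nat (λ or a → search (λ k → p or (a , k)) (n or a))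
  searchC Q N = castC (iterC N (constC nat 0) (ifC Q (sndC idC) (sucC (sndC idC)))) λ _ _ → refl

  getC : ∀ {A B} (d : El B) {i : Fun A nat} {f : Fun A (list B)} → Computable A nat i → Computable A (list B) f →
    Computable A B (λ or a → get d (i or a) (f or a))
  getC d N F = castC (hdC d (iterC N F (tlC (sndC idC)))) λ _ _ → refl

  module _ {A B C : Ty} where

    -- One step of a left fold on the pair of accumulator and unread rest. It idles on an empty
    -- rest, so every number of iterations that is at least the length yields the fold; recursion on
    -- numbers suffices.
    consume : (El C → El B → El C) → El B → El (C ⊗ list B) → El (C ⊗ list B)
    consume g d s = if null (proj₂ s) then s else (g (proj₁ s) (hd d (proj₂ s)) , tl (proj₂ s))

    consume-foldl : ∀ g d k z xs → length xs ≤ k → iter k (consume g d) (z , xs) ≡ (foldl g z xs , [])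
    consume-foldl g d zero z [] _ = refl
    consume-foldl g d (suc k) z [] _ = cong (consume g d) (consume-foldl g d k z [] z≤n)
    consume-foldl g d (suc k) z (x ∷ xs) (s≤s le) =
      trans (iter-shift k (consume g d) (z , x ∷ xs)) (consume-foldl g d k (g z x) xs le)

    consumeC : (d : El B) {g : Fun (A ⊗ C ⊗ B) C} → Computable (A ⊗ C ⊗ B) C g →
      Computable (A ⊗ C ⊗ list B) (C ⊗ list B) (λ or s → consume (λ c b → g or (proj₁ s , (c , b))) d (proj₂ s))
    consumeC d {g} G = castC (ifC (nullC rest) state ((G ∘C (fstC idC ,C (fstC state ,C hdC d rest))) ,C tlC rest)) λ _ _ → refl
      where
      state : Computable (A ⊗ C ⊗ list B) (C ⊗ list B) (λ _ s → proj₂ s)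
      state = castC (sndC idC) λ _ _ → refl
      rest : Computable (A ⊗ C ⊗ list B) (list B) (λ _ s → proj₂ (proj₂ s))
      rest = castC (sndC state) λ _ _ → refl

    foldlC : (d : El B) {g : Fun (A ⊗ C ⊗ B) C} {z : Fun A C} {f : Fun A (list B)} →
      Computable (A ⊗ C ⊗ B) C g → Computable A C z → Computable A (list B) f →
      Computable A C (λ or a → foldl (λ c b → g or (a , (c , b))) (z or a) (f or a))
    foldlC d {g} {z} {f} G Z F = castC (fstC (iterC (encC F) (Z ,C F) (consumeC d {g} G))) folded
      where
      folded : ∀ or a → proj₁ (iter (enc (list B) (f or a)) (consume (λ c b → g or (a , (c , b))) d) (z or a , f or a)) ≡
        foldl (λ c b → g or (a , (c , b))) (z or a) (f or a)
      folded or a = cong proj₁ (consume-foldl _ d (enc (list B) (f or a)) (z or a) (f or a) (length≤encList (enc B) (f or a)))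

  module _ {A B : Ty} (d : El B) {f : Fun A (list B)} (F : Computable A (list B) f) where

    lengthC : Computable A nat (λ or a → length (f or a))
    lengthC = castC (foldlC d (sucC (fstC (sndC idC))) (constC nat 0) F) λ or a → go 0 (f or a)
      where
      go : ∀ k (xs : List (El B)) → foldl (λ c _ → suc c) k xs ≡ k + length xs
      go k [] = sym (+-identityʳ k)
      go k (x ∷ xs) = trans (go (suc k) xs) (sym (+-suc k (length xs)))

    reverseC : Computable A (list B) (λ or a → reverse (f or a))
    reverseC = castC (foldlC d (consC (sndC (sndC idC)) (fstC (sndC idC))) (constC (list B) []) F) λ _ _ → refl

    anyC : {p : Fun (A ⊗ B) bool} → Computable (A ⊗ B) bool p → Computable A bool (λ or a → anyb (λ b → p or (a , b)) (f or a))
    anyC Q = castC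
      (foldlC d (ifC (Q ∘C (fstC idC ,C sndC (sndC idC))) (constC bool true) (fstC (sndC idC))) (constC bool false) F) λ _ _ → refl

  snocC : ∀ {A B} (d : El B) {f : Fun A (list B)} {g : Fun A B} → Computable A (list B) f → Computable A B g →
    Computable A (list B) (λ or a → f or a ∷ʳ g or a)
  snocC d {f} {g} F G = castC (reverseC d (consC G (reverseC d F))) λ or a →
    trans (unfold-reverse (g or a) (reverse (f or a))) (cong (_∷ʳ g or a) (reverse-involutive (f or a)))

  computes : ∀ {f : Fun (list move) bool} (F : Computable (list move) bool f) or x →
    evalPR or (program F) (codeList x ∷ []) ≡ codeBool (f or x)
  computes F or x = trans (cong (λ k → evalPR or (program F) (k ∷ [])) (sym (encList-codeList x))) (correct F or x)

open Programs

-- A machine deciding membership in EXH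

loc trip conf : Ty
loc = nat ⊗ list move
trip = nat ⊗ move ⊗ nat
-- (i , c , local positions , J , remaining moves)
conf = nat ⊗ nat ⊗ list loc ⊗ list trip ⊗ list move

noLoc : El loc
noLoc = 0 , []

noTrip : El trip
noTrip = 0 , nth 0 , 0

kid : Oracles → El loc → ℕ → ℕ
kid or (j , y) k = or o3 (enc (nat ⊗ list move ⊗ nat) (j , y , k))

turnCode labelCode : Oracles → El loc → ℕ
turnCode or lp = or o1 (enc loc lp)
labelCode or lp = or o2 (enc loc lp)

-- Child number 0 is enough to test, since an enumeration that has stopped never resumes.
atomicB : Oracles → El loc → Bool
atomicB or lp = isz (kid or lp 0)

-- The parameter `(k , b)` has code `2 + (2 * k + codeBool b)`, and duality flips the last bit.
dualCode : ℕ → ℕ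
dualCode v = if isz (oddness v) then suc v else pred v

cur : El conf → El loc
cur (i , c , ctx , J , r) = get noLoc i ctx

clashB : Oracles → El (conf ⊗ nat) → Bool
clashB or ((i , c , ctx , J , r) , j) =
  if atomicB or (get noLoc j ctx)
  then eqb (labelCode or (get noLoc j ctx)) (dualCode (labelCode or (get noLoc i ctx)))
  else false

partner : Oracles → El conf → ℕ
partner or s = search (λ j → clashB or (s , j)) (proj₁ (proj₂ s))

usedB : El ((conf ⊗ nat) ⊗ trip) → Bool
usedB (((i , _) , e) , (l , m , k)) = if eqb l i then eqb (suc (codeMove m)) e else false

settledB : Oracles → El (conf ⊗ nat) → Bool
settledB or (s@(i , c , ctx , J , r) , k) =
  if isz (kid or (cur s) k) then true
  else if anyb (λ t → usedB ((s , kid or (cur s) k) , t)) J then false else true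

-- The value 0 says that all children have been tried; otherwise it is the successor of the code of
-- the first fresh move. The bound `length J` suffices because distinct tried children occupy
-- distinct entries of `J`.
fresh : Oracles → El conf → ℕ
fresh or s@(i , c , ctx , J , r) = kid or (cur s) (search (λ k → settledB or (s , k)) (length J))

triedB : Oracles → El conf → Bool
triedB or (i , c , ctx , J , r) = anyb (λ t → eqb (proj₁ t) i) J

restartS skipS : El conf → El conf
restartS (i , c , ctx , J , r) = 0 , length ctx , ctx , J , r
skipS (i , c , ctx , J , r) = suc i , c , ctx , J , r

next₁ : El conf → Move
next₁ (i , c , ctx , J , r) = hd (nth 0) r
next₂ : El conf → Move
next₂ (i , c , ctx , J , r) = hd (nth 0) (tl r)

addS : El conf → El conf
addS s@(i , c , ctx , J , r) =
  suc i , c , ctx ∷ʳ (proj₁ (cur s) , proj₂ (cur s) ∷ʳ next₂ s) , J ∷ʳ (i , next₂ s , length ctx) , tl (tl r)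

-- status: 0 running, 1 accepted, 2 rejected
result : Ty
result = nat ⊗ conf

finishS : El conf → Move → El result
finishS s@(i , c , ctx , J , r) M =
  (if null r then 1 else if eqb (codeMove (next₁ s)) (codeMove M) then (if null (tl r) then 1 else 2) else 2) , s

takeS : El conf → Bool → El result
takeS s@(i , c , ctx , J , r) ok =
  if null r then (1 , s)
  else if eqb (codeMove (next₁ s)) (codeMove (JUST i (length ctx)))
  then (if null (tl r) then (1 , s) else if ok then (0 , addS s) else (2 , s))
  else (2 , s)

-- Codes 0 and 1 stand for P and O, so the partner `j` is consulted only for parameters, where
-- `dualCode` is meaningful. A search that fails returns `c`, whence the test `ltb j c`.
leafCase : El conf → ℕ → ℕ → El result
leafCase s@(i , c , ctx , J , r) label j =
  if isz label then finishS s (STOP i)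
  else if isz (pred label) then (0 , skipS s)
  else if ltb j c then finishS s (EM i j)
  else (0 , skipS s)

atEnd atLeaf atP atO : Oracles → El conf → El result
atEnd or s@(i , c , ctx , J , r) =
  if ltb c (length ctx) then (0 , restartS s) else finishS s (DROP (length ctx))
atLeaf or s = leafCase s (labelCode or (cur s)) (partner or s)
atP or s =
  if isz (fresh or s) then (0 , skipS s) else takeS s (eqb (suc (codeMove (next₂ s))) (fresh or s))
atO or s =
  if triedB or s then (0 , skipS s)
  else takeS s (eqb (or o0 (enc loc (proj₁ (cur s) , proj₂ (cur s) ∷ʳ next₂ s))) 1)

stepCase : Oracles → El conf → Bool → Bool → Bool → El result
stepCase or s end leaf P-turn = if end then atEnd or s else if leaf then atLeaf or s else if P-turn then atP or s else atO or s

opaque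

  stepS : Oracles → El conf → El result
  stepS or s@(i , c , ctx , J , r) = stepCase or s (eqb i c) (atomicB or (cur s)) (isz (turnCode or (cur s)))

  stepS-case : ∀ or s {b₁ b₂ b₃} → eqb (proj₁ s) (proj₁ (proj₂ s)) ≡ b₁ → atomicB or (cur s) ≡ b₂ →
    isz (turnCode or (cur s)) ≡ b₃ → stepS or s ≡ stepCase or s b₁ b₂ b₃
  stepS-case or s refl refl refl = refl

runS : Oracles → El result → El result
runS or s = if isz (proj₁ s) then stepS or (proj₂ s) else s

-- On a list of `k` moves there are never more than `n + k` local positions, so `2 * (n + k) + 2`
-- covers a pass with its restart. A further pass needs a new local position, hence moves read from
-- the list: `suc k` such amounts are enough.
fuel : ℕ → ℕ → ℕ
fuel n k = (2 * (n + k) + 2) * suc k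

decideS : (n : ℕ) → El conf → Oracles → List Move → Bool
decideS n (i , c , ctx , J , _) or x = eqb (proj₁ (iter (fuel n (length x)) (runS or) (0 , i , c , ctx , J , x))) 1

-- Programs for the components, tests and steps of the machine

module _ {A : Ty} {s : Fun A conf} (S : Computable A conf s) where

  iC : Computable A nat (λ or a → proj₁ (s or a))
  iC = castC (fstC S) λ _ _ → refl
  cC : Computable A nat (λ or a → proj₁ (proj₂ (s or a)))
  cC = castC (fstC (sndC S)) λ _ _ → refl
  ctxC : Computable A (list loc) (λ or a → proj₁ (proj₂ (proj₂ (s or a))))
  ctxC = castC (fstC (sndC (sndC S))) λ _ _ → refl
  JC : Computable A (list trip) (λ or a → proj₁ (proj₂ (proj₂ (proj₂ (s or a)))))
  JC = castC (fstC (sndC (sndC (sndC S)))) λ _ _ → refl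
  restC : Computable A (list move) (λ or a → proj₂ (proj₂ (proj₂ (proj₂ (s or a)))))
  restC = castC (sndC (sndC (sndC (sndC S)))) λ _ _ → refl

  curC : Computable A loc (λ or a → cur (s or a))
  curC = castC (getC noLoc iC ctxC) λ _ _ → refl
  lenC : Computable A nat (λ or a → length (proj₁ (proj₂ (proj₂ (s or a)))))
  lenC = castC (lengthC noLoc ctxC) λ _ _ → refl
  next₁C : Computable A move (λ or a → next₁ (s or a))
  next₁C = castC (hdC (nth 0) restC) λ _ _ → refl
  next₂C : Computable A move (λ or a → next₂ (s or a))
  next₂C = castC (hdC (nth 0) (tlC restC)) λ _ _ → refl

module _ {A : Ty} {lp : Fun A loc} (L : Computable A loc lp) where

  kidC : {k : Fun A nat} → Computable A nat k → Computable A nat (λ or a → kid or (lp or a) (k or a))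
  kidC K = castC (oracleC (encC (fstC L ,C sndC L ,C K)) o3) λ _ _ → refl
  turnC : Computable A nat (λ or a → turnCode or (lp or a))
  turnC = castC (oracleC (encC L) o1) λ _ _ → refl
  labelC : Computable A nat (λ or a → labelCode or (lp or a))
  labelC = castC (oracleC (encC L) o2) λ _ _ → refl
  atomicC : Computable A bool (λ or a → atomicB or (lp or a))
  atomicC = castC (iszC (kidC (constC nat 0))) λ _ _ → refl

dualC : ∀ {A} {v : Fun A nat} → Computable A nat v → Computable A nat (λ or a → dualCode (v or a))
dualC V = castC (ifC (iszC (oddnessC V)) (sucC V) (predC V)) λ _ _ → refl

stateC : Computable conf conf (λ _ s → s)
stateC = idC

clashC : Computable (conf ⊗ nat) bool clashB
clashC = castC (ifC (atomicC other) (eqC (labelC other) (dualC (labelC (curC (fstC idC))))) (constC bool false)) λ _ _ → refl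
  where
  other : Computable (conf ⊗ nat) loc (λ _ p → get noLoc (proj₂ p) (proj₁ (proj₂ (proj₂ (proj₁ p)))))
  other = castC (getC noLoc (sndC idC) (ctxC (fstC idC))) λ _ _ → refl

partnerC : Computable conf nat partner
partnerC = castC (searchC clashC (cC stateC)) λ _ _ → refl

usedC : Computable ((conf ⊗ nat) ⊗ trip) bool (λ _ → usedB)
usedC = castC (ifC (eqC (fstC (sndC idC)) (iC (fstC (fstC idC))))
  (eqC (sucC (encC (fstC (sndC (sndC idC))))) (sndC (fstC idC))) (constC bool false)) λ _ _ → refl

settledC : Computable (conf ⊗ nat) bool settledB
settledC = castC (ifC (iszC child) (constC bool true)
    (notC (anyC noTrip (JC (fstC idC)) (usedC ∘C ((fstC (fstC idC) ,C (child ∘C fstC idC)) ,C sndC idC))))) λ _ _ → refl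
  where
  child : Computable (conf ⊗ nat) nat (λ or p → kid or (cur (proj₁ p)) (proj₂ p))
  child = castC (kidC (curC (fstC idC)) (sndC idC)) λ _ _ → refl

freshC : Computable conf nat fresh
freshC = castC (kidC (curC stateC) (searchC settledC (lengthC noTrip (JC stateC)))) λ _ _ → refl

triedC : Computable conf bool triedB
triedC = castC (anyC noTrip (JC stateC) (eqC (fstC (sndC idC)) (iC (fstC idC)))) λ _ _ → refl

restartC : Computable conf conf (λ _ → restartS)
restartC = castC (constC nat 0 ,C lenC stateC ,C ctxC stateC ,C JC stateC ,C restC stateC) λ _ _ → refl

skipC : Computable conf conf (λ _ → skipS)
skipC = castC (sucC (iC stateC) ,C cC stateC ,C ctxC stateC ,C JC stateC ,C restC stateC) λ _ _ → refl

extendC : Computable conf loc (λ _ s → proj₁ (cur s) , proj₂ (cur s) ∷ʳ next₂ s)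
extendC = castC (fstC (curC stateC) ,C snocC (nth 0) (sndC (curC stateC)) (next₂C stateC)) λ _ _ → refl

addSC : Computable conf conf (λ _ → addS)
addSC = castC (sucC (iC stateC) ,C cC stateC ,C snocC noLoc (ctxC stateC) extendC ,C
  snocC noTrip (JC stateC) (iC stateC ,C next₂C stateC ,C lenC stateC) ,C tlC (tlC (restC stateC))) λ _ _ → refl

finishC : {M : Fun conf move} → Computable conf move M → Computable conf result (λ or s → finishS s (M or s))
finishC M = castC (ifC (nullC (restC stateC)) (constC nat 1)
  (ifC (eqC (encC (next₁C stateC)) (encC M))
    (ifC (nullC (tlC (restC stateC))) (constC nat 1) (constC nat 2)) (constC nat 2)) ,C stateC) λ _ _ → refl

takeC : {ok : Fun conf bool} → Computable conf bool ok → Computable conf result (λ or s → takeS s (ok or s))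
takeC OK = castC (ifC (nullC (restC stateC)) (constC nat 1 ,C stateC)
  (ifC (eqC (encC (next₁C stateC)) (encC (JUSTc (iC stateC) (lenC stateC))))
    (ifC (nullC (tlC (restC stateC))) (constC nat 1 ,C stateC)
      (ifC OK (constC nat 0 ,C addSC) (constC nat 2 ,C stateC)))
    (constC nat 2 ,C stateC))) λ _ _ → refl

moveOn : Computable conf result (λ _ s → 0 , skipS s)
moveOn = castC (constC nat 0 ,C skipC) λ _ _ → refl

atEndC : Computable conf result atEnd
atEndC = castC (ifC (ltC (cC stateC) (lenC stateC)) (constC nat 0 ,C restartC) (finishC (DROPc (lenC stateC)))) λ _ _ → refl

atLeafC : Computable conf result atLeaf
atLeafC = castC (ifC (iszC (labelC (curC stateC))) (finishC (STOPc (iC stateC)))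
  (ifC (iszC (predC (labelC (curC stateC)))) moveOn
    (ifC (ltC partnerC (cC stateC)) (finishC (EMc (iC stateC) partnerC)) moveOn))) λ _ _ → refl

atPC : Computable conf result atP
atPC = castC (ifC (iszC freshC) moveOn (takeC (eqC (sucC (encC (next₂C stateC))) freshC))) λ _ _ → refl

atOC : Computable conf result atO
atOC = castC (ifC triedC moveOn (takeC (eqC (oracleC (encC extendC) o0) (constC nat 1)))) λ _ _ → refl

opaque
  unfolding stepS

  stepC : Computable conf result stepS
  stepC = castC (ifC (eqC (iC stateC) (cC stateC)) atEndC
    (ifC (atomicC (curC stateC)) atLeafC (ifC (iszC (turnC (curC stateC))) atPC atOC))) λ _ _ → refl

runC : Computable result result runS
runC = castC (ifC (iszC (fstC idC)) (stepC ∘C sndC idC) idC) λ _ _ → refl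

fuelC : ∀ n → Computable (list move) nat (λ _ x → fuel n (length x))
fuelC n = castC (mulC (addC (mulC (constC nat 2) (addC (constC nat n) len)) (constC nat 2)) (sucC len)) λ _ _ → refl
  where
  len : Computable (list move) nat (λ _ x → length x)
  len = lengthC (nth 0) idC

decideC : ∀ n s → Computable (list move) bool (decideS n s)
decideC n (i , c , ctx , J , r) = castC (eqC (fstC (iterC (fuelC n)
    (constC nat 0 ,C constC nat i ,C constC nat c ,C constC (list loc) ctx ,C constC (list trip) J ,C idC)
    (runC ∘C sndC idC))) (constC nat 1)) λ _ _ → refl

-- Boolean tests, bounded search and codes of labels

eqb-true : ∀ {x y} → x ≡ y → eqb x y ≡ true
eqb-true {x} refl = cong isz (cong₂ _+_ (n∸n≡0 x) (n∸n≡0 x))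

eqb-sound : ∀ {x y} → eqb x y ≡ true → x ≡ y
eqb-sound {x} {y} e = ≤-antisym (m∸n≡0⇒m≤n (m+n≡0⇒m≡0 (x ∸ y) (z e))) (m∸n≡0⇒m≤n (m+n≡0⇒n≡0 (x ∸ y) (z e)))
  where
  z : ∀ {k} → isz k ≡ true → k ≡ 0
  z {zero} _ = refl

¬true⇒false : ∀ {b} → ¬ (b ≡ true) → b ≡ false
¬true⇒false {true} h = ⊥-elim (h refl)
¬true⇒false {false} _ = refl

eqb-false : ∀ {x y} → ¬ (x ≡ y) → eqb x y ≡ false
eqb-false h = ¬true⇒false λ e → h (eqb-sound e)

ltb-true : ∀ {x y} → x < y → ltb x y ≡ true
ltb-true l = cong isz (m≤n⇒m∸n≡0 l)

ltb-irrefl : ∀ x → ltb x x ≡ false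
ltb-irrefl x = cong isz (m+n∸n≡m 1 x)

module _ (p : ℕ → Bool) where

  search-none : ∀ b → (∀ k → k < b → p k ≡ false) → search p b ≡ b
  search-none zero h = refl
  search-none (suc b) h rewrite search-none b (λ k l → h k (m≤n⇒m≤1+n l)) | h b ≤-refl = refl

  search-first : ∀ b k → p k ≡ true → (∀ k' → k' < k → p k' ≡ false) → k ≤ b → search p b ≡ k
  search-first b k pk h le = subst (λ b → search p b ≡ k) (m∸n+n≡m le) (go (b ∸ k))
    where
    go : ∀ e → search p (e + k) ≡ k
    go zero = search-none k h
    go (suc e) rewrite go e | pk = refl

module _ {A : Set} (p : A → Bool) where

  private
    any-from : Bool → List A → Bool
    any-from = foldl (λ acc x → if p x then true else acc)

    stays : ∀ xs → any-from true xs ≡ true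
    stays [] = refl
    stays (x ∷ xs) with p x
    ... | true = stays xs
    ... | false = stays xs

  anyb-true : ∀ {acc xs} → Any (λ x → p x ≡ true) xs → any-from acc xs ≡ true
  anyb-true {xs = x ∷ xs} (here e) rewrite e = stays xs
  anyb-true {xs = x ∷ xs} (there a) = anyb-true a

  anyb-false : ∀ {xs} → ¬ Any (λ x → p x ≡ true) xs → anyb p xs ≡ false
  anyb-false {[]} h = refl
  anyb-false {x ∷ xs} h with p x in e
  ... | true = ⊥-elim (h (here e))
  ... | false = anyb-false (λ a → h (there a))

oddness-bit : ∀ k b → oddness (2 * k + codeBool b) ≡ codeBool b
oddness-bit k false = trans (cong oddness (+-identityʳ (2 * k))) (oddness-double k)
oddness-bit k true = trans (cong oddness (+-comm (2 * k) 1)) (cong zeroness (oddness-double k))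

half-bit : ∀ k b → half (2 * k + codeBool b) ≡ k
half-bit k false = trans (cong half (+-identityʳ (2 * k))) (half-double k)
half-bit k true = trans (cong half (+-comm (2 * k) 1)) (half-odd k)

codeBool-injective : ∀ b b' → codeBool b ≡ codeBool b' → b ≡ b'
codeBool-injective true true _ = refl
codeBool-injective false false _ = refl

codeLabel-par-injective : ∀ {x a} → codeLabel x ≡ codeLabel (par a) → x ≡ par a
codeLabel-par-injective {pl P} ()
codeLabel-par-injective {pl O} ()
codeLabel-par-injective {par (k , b)} {k' , b'} e = cong par (cong₂ _,_
    (trans (sym (half-bit k b)) (trans (cong half e') (half-bit k' b')))
    (codeBool-injective b b' (trans (sym (oddness-bit k b)) (trans (cong oddness e') (oddness-bit k' b')))))
  where
  e' : 2 * k + codeBool b ≡ 2 * k' + codeBool b'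
  e' = suc-injective (suc-injective e)

dualCode-par : ∀ a → dualCode (codeLabel (par a)) ≡ codeLabel (par (dual a))
dualCode-par (k , false) rewrite oddness-+2 (2 * k + 0) | oddness-bit k false = cong (2 +_) (sym (+-suc (2 * k) 0))
dualCode-par (k , true) rewrite oddness-+2 (2 * k + 1) | oddness-bit k true = cong suc (+-suc (2 * k) 0)

get-map : ∀ {A B : Set} (f : A → B) d (xs : List A) {l a} → lk xs l ≡ just a → get d l (map f xs) ≡ f a
get-map f d (x ∷ xs) {zero} refl = refl
get-map f d (x ∷ xs) {suc l} e = trans (cong (hd d) (iter-shift l tl (f x ∷ map f xs))) (get-map f d xs e)

-- Correctness of the machine

module Decide (lem : LEM) {n : ℕ} (Γ : Fin n → PGame) (I : Par → Bool)
  (closed : ∀ a → ¬ FV (ForAll (λ i → game (Γ i)) I) a) (or : Oracles) (ag : Agrees Γ or) where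

  open Machine lem Γ I
  open Labels Γ I closed
  open Root Γ'

  ⟪_⟫ : LP n → El loc
  ⟪ j , y ⟫ = toℕ j , y

  St : ℕ → ℕ → Ctx n → List Triple → List Move → El conf
  St i c ctx J r = i , c , map ⟪_⟫ ctx , J , r

  len-map : ∀ ctx → length (map ⟪_⟫ ctx) ≡ length ctx
  len-map = length-map ⟪_⟫

  module _ {j : Fin n} {y : List Move} (py : pos (Γ' j) y) where

    kid-enum : ∀ k → kid or ⟪ j , y ⟫ k ≡ codeMaybe (enum (Γ j) y k)
    kid-enum k = trans (cong (λ z → or o3 (pair (toℕ j) (pair z k))) (encList-codeList y))
      (proj₂ (proj₂ (proj₂ ag)) j y k py)

    kid-just : ∀ {k m} → enum (Γ j) y k ≡ just m → kid or ⟪ j , y ⟫ k ≡ suc (codeMove m)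
    kid-just {k} e = trans (kid-enum k) (cong codeMaybe e)

    kid-nothing : ∀ {k} → enum (Γ j) y k ≡ nothing → kid or ⟪ j , y ⟫ k ≡ 0
    kid-nothing {k} e = trans (kid-enum k) (cong codeMaybe e)

    turn-code : ¬ Atomic Γ' (j , y) → turnCode or ⟪ j , y ⟫ ≡ codePlayer (turn (Γ' j) y)
    turn-code na = trans (cong (λ z → or o1 (pair (toℕ j) z)) (encList-codeList y))
      (proj₁ (proj₂ ag) j y (py , dne lem λ none → na λ m p → none (m , p)))

    label-code : Atomic Γ' (j , y) → labelCode or ⟪ j , y ⟫ ≡ codeLabel (win (Γ' j) y)
    label-code at = trans (cong (λ z → or o2 (pair (toℕ j) z)) (encList-codeList y))
      (proj₁ (proj₂ (proj₂ ag)) j y (py , at))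

    nothing-after : ∀ d {k} → enum (Γ j) y k ≡ nothing → enum (Γ j) y (d + k) ≡ nothing
    nothing-after zero e = e
    nothing-after (suc d) e = enum-stop (Γ j) y _ (nothing-after d e)

    atomic-code : Atomic Γ' (j , y) → atomicB or ⟪ j , y ⟫ ≡ true
    atomic-code at with enum (Γ j) y 0 in e
    ... | nothing = cong isz (kid-nothing e)
    ... | just m = ⊥-elim (at m (enum-sound (Γ j) y 0 m py e))

    nonatomic-code : ¬ Atomic Γ' (j , y) → atomicB or ⟪ j , y ⟫ ≡ false
    nonatomic-code na with enum (Γ j) y 0 in e
    ... | just m = cong isz (kid-just e)
    ... | nothing = ⊥-elim (na no-child)
      where
      no-child : ∀ m → ¬ pos (Γ' j) (y ∷ʳ m)
      no-child m p with enum-compl (Γ j) y m p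
      ... | k , e' with trans (sym e') (subst (λ k → enum (Γ j) y k ≡ nothing) (+-identityʳ k) (nothing-after k e))
      ...   | ()

  pos-code : ∀ j y → (pos (Γ' j) y → eqb (or o0 (enc loc ⟪ j , y ⟫)) 1 ≡ true) ×
    (¬ pos (Γ' j) y → eqb (or o0 (enc loc ⟪ j , y ⟫)) 1 ≡ false)
  pos-code j y = (λ p → eqb-true (trans e (proj₁ (proj₁ ag j y) p))) ,
    λ np → cong (λ v → eqb v 1) (trans e (proj₂ (proj₁ ag j y) np))
    where
    e : or o0 (enc loc ⟪ j , y ⟫) ≡ or o0 (pair (toℕ j) (codeList y))
    e = cong (λ z → or o0 (pair (toℕ j) z)) (encList-codeList y)

  module At {i c : ℕ} {ctx : Ctx n} {J : List Triple} (v : Inv i c ctx J) (r : List Move) where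

    s : El conf
    s = St i c ctx J r

    en : Entries ctx
    en = entries (sound v)

    module _ {j y} (e : lk ctx i ≡ just (j , y)) where

      cur-lk : cur s ≡ ⟪ j , y ⟫
      cur-lk = get-map ⟪_⟫ noLoc ctx e

      py : pos (Γ' j) y
      py = en _ _ _ e

    module _ {a} (ei : ENDat Γ' ctx i (par a)) where

      dual-code : dualCode (labelCode or (cur s)) ≡ codeLabel (par (dual a))
      dual-code = let (lp , e , at , w) = ei in trans (cong dualCode (trans (cong (labelCode or) (cur-lk e))
                                (trans (label-code (py e) at) (cong codeLabel w)))) (dualCode-par a)

      clash-true : ∀ {j} → ENDat Γ' ctx j (par (dual a)) → clashB or (s , j) ≡ true
      clash-true {j} (lp , e , at , w)
        rewrite get-map ⟪_⟫ noLoc ctx e | atomic-code (en _ _ _ e) at | dual-code =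
          eqb-true (trans (label-code (en _ _ _ e) at) (cong codeLabel w))

      -- The bound on `j` keeps the lookup inside the context; beyond it `get` would return the
      -- default `noLoc`, which is no local position of the call.
      clash-sound : ∀ {j} → j < c → clashB or (s , j) ≡ true → ENDat Γ' ctx j (par (dual a))
      clash-sound {j} l h with lk-defined ctx (<-≤-trans l (c≤len v))
      ... | lp , e with lem {Atomic Γ' lp}
      ...   | yes at rewrite get-map ⟪_⟫ noLoc ctx e | atomic-code (en _ _ _ e) at | dual-code =
                lp , e , at , codeLabel-par-injective (trans (sym (label-code (en _ _ _ e) at)) (eqb-sound h))
      ...   | no na rewrite get-map ⟪_⟫ noLoc ctx e | nonatomic-code (en _ _ _ e) na with h
      ...     | ()

      partner-first : ∀ {j} → j < c → ENDat Γ' ctx j (par (dual a)) →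
        (∀ j' → j' < j → ¬ ENDat Γ' ctx j' (par (dual a))) → partner or s ≡ j
      partner-first {j} l ej min = search-first _ c j (clash-true ej)
        (λ j' l' → ¬true⇒false λ h → min j' l' (clash-sound (<-trans l' l) h)) (<⇒≤ l)

      partner-none : (∀ j → j < c → ¬ ENDat Γ' ctx j (par (dual a))) → partner or s ≡ c
      partner-none none = search-none _ c λ j l → ¬true⇒false λ h → none j l (clash-sound l h)

    used-true : ∀ {m} → InJ Γ I i m J → anyb (λ t → usedB ((s , suc (codeMove m)) , t)) J ≡ true
    used-true {m} p = anyb-true _ (Any.map (λ {t} → used {t}) p)
      where
      used : ∀ {t} → proj₁ t ≡ i × proj₁ (proj₂ t) ≡ m → usedB ((s , suc (codeMove m)) , t) ≡ true
      used (refl , refl) rewrite eqb-true {i} refl = eqb-true {suc (codeMove m)} refl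

    used-false : ∀ {m} → ¬ InJ Γ I i m J → anyb (λ t → usedB ((s , suc (codeMove m)) , t)) J ≡ false
    used-false {m} np = anyb-false _ λ p → np (Any.map (λ {t} → used {t}) p)
      where
      used : ∀ {t} → usedB ((s , suc (codeMove m)) , t) ≡ true → proj₁ t ≡ i × proj₁ (proj₂ t) ≡ m
      used {l , m' , k} h with eqb l i in q
      ... | true = eqb-sound q , codeMove-injective (suc-injective (eqb-sound h))

    module _ {j y} (e : lk ctx i ≡ just (j , y)) where

      settled-fresh : ∀ {k m} → enum (Γ j) y k ≡ just m → ¬ InJ Γ I i m J → settledB or (s , k) ≡ true
      settled-fresh {k} ek np rewrite cur-lk e | kid-just (py e) {k} ek | used-false np = refl

      settled-used : ∀ {k m} → enum (Γ j) y k ≡ just m → InJ Γ I i m J → settledB or (s , k) ≡ false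
      settled-used {k} ek p rewrite cur-lk e | kid-just (py e) {k} ek | used-true p = refl

      settled-stop : ∀ {k} → enum (Γ j) y k ≡ nothing → settledB or (s , k) ≡ true
      settled-stop {k} ek rewrite cur-lk e | kid-nothing (py e) {k} ek = refl

      Used : ℕ → Set
      Used k = Σ[ m ∈ Move ] enum (Γ j) y k ≡ just m × InJ Γ I i m J

      -- Pigeonhole: an entry of `J` determines its move, and the enumeration never repeats a move,
      -- so different numbers lead to different entries.
      used-bound : ∀ K → (∀ k → k < K → Used k) → K ≤ length J
      used-bound K used = injective⇒≤ {f = f} inj
        where
        at : ∀ x → Used (toℕ {K} x)
        at x = used (toℕ x) (toℕ<n x)
        f : Fin K → Fin (length J)
        f x = index (proj₂ (proj₂ (at x)))
        move-at : ∀ x → proj₁ (proj₂ (lookup J (f x))) ≡ proj₁ (at x)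
        move-at x = proj₂ (lookup-index (proj₂ (proj₂ (at x))))
        inj : ∀ {x x'} → f x ≡ f x' → x ≡ x'
        inj {x} {x'} q = toℕ-injective (enum-inj (Γ j) y _ _ _ (proj₁ (proj₂ (at x)))
          (trans (proj₁ (proj₂ (at x'))) (cong just (trans (sym (move-at x'))
            (trans (cong (λ z → proj₁ (proj₂ (lookup J z))) (sym q)) (move-at x))))))

      fresh-at : ∀ {k} → settledB or (s , k) ≡ true → (∀ k' → k' < k → Used k') →
        fresh or s ≡ kid or ⟪ j , y ⟫ k
      fresh-at {k} h used = cong₂ (kid or) (cur-lk e)
        (search-first _ (length J) k h (λ k' l → let (m , ek , p) = used k' l in settled-used ek p) (used-bound k used))

      fresh-found : ∀ {m} → FirstFresh Γ I (j , y) i J m → fresh or s ≡ suc (codeMove m)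
      fresh-found (k , ek , np , min) = trans (fresh-at (settled-fresh ek np) used) (kid-just (py e) ek)
        where
        used : ∀ k' → k' < k → Used k'
        used k' l with enum (Γ j) y k' in e'
        ... | just m' = m' , refl , min k' m' l e'
        ... | nothing with trans (sym ek) (subst (λ k → enum (Γ j) y k ≡ nothing) (m∸n+n≡m (<⇒≤ l))
                             (nothing-after (py e) (k ∸ k') e'))
        ...   | ()

      -- If the enumeration never stopped, `suc (length J)` children would all be listed in `J`,
      -- against `used-bound`. So it stops, and the search halts at the first number without a
      -- child, whose code is 0.
      fresh-none : (∀ m → pos (Γ' j) (y ∷ʳ m) → InJ Γ I i m J) → fresh or s ≡ 0
      fresh-none all with lem {Σ[ k ∈ ℕ ] enum (Γ j) y k ≡ nothing}
      ... | no none = ⊥-elim (1+n≰n (used-bound (suc (length J)) λ k _ → used k))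
        where
        used : ∀ k → Used k
        used k with enum (Γ j) y k in e'
        ... | just m = m , refl , all m (enum-sound (Γ j) y k m (py e) e')
        ... | nothing = ⊥-elim (none (k , e'))
      ... | yes (K , eK) with least lem (λ k → enum (Γ j) y k ≡ nothing) K eK
      ...   | k , _ , ek , min = trans (fresh-at (settled-stop ek) used) (kid-nothing (py e) ek)
        where
        used : ∀ k' → k' < k → Used k'
        used k' l with enum (Γ j) y k' in e'
        ... | just m = m , refl , all m (enum-sound (Γ j) y k' m (py e) e')
        ... | nothing = ⊥-elim (min k' l e')

    tried-true : ¬ NoTriple Γ I i J → triedB or s ≡ true
    tried-true h = anyb-true _ (Any.map (λ q → eqb-true q) (dne lem h))

    tried-false : NoTriple Γ I i J → triedB or s ≡ false
    tried-false h = anyb-false _ λ p → h (Any.map (λ q → eqb-sound q) p)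

    step-restart : i ≡ c → c < length ctx → stepS or s ≡ (0 , St 0 (length ctx) ctx J r)
    step-restart q l = trans (stepS-case or s (eqb-true q) refl refl) end
      where
      end : atEnd or s ≡ (0 , St 0 (length ctx) ctx J r)
      end rewrite len-map ctx | ltb-true l = refl

    step-finish : i ≡ c → c ≡ length ctx → stepS or s ≡ finishS s (DROP (length ctx))
    step-finish q l = trans (stepS-case or s (eqb-true q) refl refl) end
      where
      end : atEnd or s ≡ finishS s (DROP (length ctx))
      end rewrite len-map ctx | l | ltb-irrefl (length ctx) = refl

    module _ (l : i < c) where

      i≢c : eqb i c ≡ false
      i≢c = eqb-false (<⇒≢ l)

      step-atomic : AtomicAt Γ' ctx i → stepS or s ≡ atLeaf or s
      step-atomic (lp , e , at) =
        stepS-case or s i≢c (trans (cong (atomicB or) (cur-lk e)) (atomic-code (py e) at)) refl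

      turn-at : ∀ {j y g} → NonAtomicAt ctx i (j , y) g → turnCode or (cur s) ≡ codePlayer g
      turn-at (e , na , t) = trans (cong (turnCode or) (cur-lk e)) (trans (turn-code (py e) na) (cong codePlayer t))

      step-P : ∀ {j y} → NonAtomicAt ctx i (j , y) P → stepS or s ≡ atP or s
      step-P p@(e , na , _) =
        stepS-case or s i≢c (trans (cong (atomicB or) (cur-lk e)) (nonatomic-code (py e) na)) (cong isz (turn-at p))

      step-O : ∀ {j y} → NonAtomicAt ctx i (j , y) O → stepS or s ≡ atO or s
      step-O p@(e , na , _) =
        stepS-case or s i≢c (trans (cong (atomicB or) (cur-lk e)) (nonatomic-code (py e) na)) (cong isz (turn-at p))

      label-at : ∀ {x} → ENDat Γ' ctx i x → labelCode or (cur s) ≡ codeLabel x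
      label-at (lp , e , at , w) = trans (cong (labelCode or) (cur-lk e)) (trans (label-code (py e) at) (cong codeLabel w))

      step-stop : ENDat Γ' ctx i (pl P) → stepS or s ≡ finishS s (STOP i)
      step-stop e = trans (step-atomic (end-atomic {i} {c} {ctx} {J} e)) leaf
        where
        leaf : atLeaf or s ≡ finishS s (STOP i)
        leaf = cong (λ v → leafCase s v (partner or s)) (label-at e)

      step-em : ∀ {a j} → EMcond Γ I ctx c i a j → stepS or s ≡ finishS s (EM i j)
      step-em {a} {j} (ei , ta , lj , ej , min) = trans (step-atomic (end-atomic {i} {c} {ctx} {J} ei)) leaf
        where
        leaf : atLeaf or s ≡ finishS s (EM i j)
        leaf = trans (cong₂ (leafCase s) (label-at ei) (partner-first ei lj ej min))
          (cong (λ b → if b then finishS s (EM i j) else (0 , skipS s)) (ltb-true lj))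

      no-partner : ∀ {a} → ENDat Γ' ctx i (par a) → (∀ a j → ¬ EMcond Γ I ctx c i a j) → partner or s ≡ c
      no-partner {a} ei@(lp , e , at , w) ne = partner-none ei none
        where
        none : ∀ j → j < c → ¬ ENDat Γ' ctx j (par (dual a))
        none j l ej with least lem (λ j → ENDat Γ' ctx j (par (dual a))) j ej
        -- The machine does not test membership in `I`, whereas `EMcond` demands it; `leaf-param`
        -- supplies it for the label found here.
        ... | j' , le , ej' , min = ne a j' (ei , leaf-param _ (py e , at) w , ≤-<-trans le l , ej' , min)

      step-pass : Skip i c ctx J → stepS or s ≡ (0 , St (suc i) c ctx J r)
      step-pass (atom (lp , e , at) ne np) = trans (step-atomic (lp , e , at)) leaf
        where
        leaf : atLeaf or s ≡ (0 , St (suc i) c ctx J r)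
        leaf with win (Γ' (proj₁ lp)) (proj₂ lp) in w
        ... | pl P = ⊥-elim (np (lp , e , at , w))
        ... | pl O = cong (λ v → leafCase s v (partner or s)) (label-at (lp , e , at , w))
        ... | par a = trans (cong₂ (leafCase s) (label-at (lp , e , at , w)) (no-partner (lp , e , at , w) ne))
                        (cong (λ b → if b then finishS s (EM i c) else (0 , skipS s)) (ltb-irrefl c))
      step-pass (allP j y na all) = trans (step-P na) quiet
        where
        quiet : atP or s ≡ (0 , St (suc i) c ctx J r)
        quiet rewrite fresh-none (proj₁ na) all = refl
      step-pass (someO j y na some) = trans (step-O na) quiet
        where
        quiet : atO or s ≡ (0 , St (suc i) c ctx J r)
        quiet rewrite tried-true some = refl

      step-takeP : ∀ {j y m} → NonAtomicAt ctx i (j , y) P → FirstFresh Γ I (j , y) i J m →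
        stepS or s ≡ takeS s (eqb (suc (codeMove (next₂ s))) (suc (codeMove m)))
      step-takeP {m = m} na f = trans (step-P na) busy
        where
        busy : atP or s ≡ takeS s (eqb (suc (codeMove (next₂ s))) (suc (codeMove m)))
        busy rewrite fresh-found (proj₁ na) f = refl

      step-takeO : ∀ {j y} → NonAtomicAt ctx i (j , y) O → NoTriple Γ I i J →
        stepS or s ≡ takeS s (eqb (or o0 (enc loc ⟪ j , y ∷ʳ next₂ s ⟫)) 1)
      step-takeO {j} {y} na nt = trans (step-O na) busy
        where
        busy : atO or s ≡ takeS s (eqb (or o0 (enc loc ⟪ j , y ∷ʳ next₂ s ⟫)) 1)
        busy rewrite tried-false nt | cur-lk (proj₁ na) = refl

-- The machine halts within its fuel and decides EXH

module Decision (lem : LEM) {n : ℕ} (Γ : Fin n → PGame) (I : Par → Bool)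
  (closed : ∀ a → ¬ FV (ForAll (λ i → game (Γ i)) I) a) (or : Oracles) (ag : Agrees Γ or) where

  open Machine lem Γ I
  open Root Γ'
  open Decide lem Γ I closed or ag

  data DecidedBy (res : El result) (Q : Set) : Set where
    accepted : Q → proj₁ res ≡ 1 → DecidedBy res Q
    rejected : ¬ Q → proj₁ res ≡ 2 → DecidedBy res Q

  decided-map : ∀ {res Q Q'} → (Q → Q') → (Q' → Q) → DecidedBy res Q → DecidedBy res Q'
  decided-map f g (accepted q e) = accepted (f q) e
  decided-map f g (rejected nq e) = rejected (λ q' → nq (g q')) e

  halted : ∀ f k s → iter f (runS or) (suc k , s) ≡ (suc k , s)
  halted zero k s = refl
  halted (suc f) k s = cong (runS or) (halted f k s)

  Run : ℕ → El result → El result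
  Run f = iter f (runS or)

  run-step : ∀ f {s res} → stepS or s ≡ res → Run (suc f) (0 , s) ≡ Run f res
  run-step f {s} e = trans (iter-shift f (runS or) (0 , s)) (cong (Run f) e)

  accept : ∀ f s {Q} → Q → DecidedBy (Run f (1 , s)) Q
  accept f s q = accepted q (cong proj₁ (halted f 0 s))

  reject : ∀ f s {Q} → ¬ Q → DecidedBy (Run f (2 , s)) Q
  reject f s nq = rejected nq (cong proj₁ (halted f 1 s))

  decide-finish : ∀ f {i c ctx J} r M {Q} → (r ≡ [] ⊎ r ≡ M ∷ [] → Q) → (Q → r ≡ [] ⊎ r ≡ M ∷ []) →
    DecidedBy (Run f (finishS (St i c ctx J r) M)) Q
  decide-finish f [] M to from = accept f _ (to (inj₁ refl))
  decide-finish f {i} {c} {ctx} {J} (a ∷ r) M to from with codeMove a ≟ codeMove M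
  ... | no ne rewrite eqb-false ne = reject f _ λ q → no-match (from q)
    where
    no-match : ¬ (a ∷ r ≡ [] ⊎ a ∷ r ≡ M ∷ [])
    no-match (inj₂ refl) = ne refl
  ... | yes e rewrite eqb-true e with r
  ...   | [] = accept f _ (to (inj₂ (cong (_∷ []) (codeMove-injective e))))
  ...   | b ∷ r' = reject f _ λ q → no-match (from q)
    where
    no-match : ¬ (a ∷ b ∷ r' ≡ [] ⊎ a ∷ b ∷ r' ≡ M ∷ [])
    no-match (inj₂ ())

  Decided : ℕ → ℕ → ℕ → Ctx n → List Triple → List Move → Set
  Decided f i c ctx J r = DecidedBy (Run f (0 , St i c ctx J r)) (E i c ctx J r)

  addS-St : ∀ {i c ctx J j y b r'} → lk ctx i ≡ just (j , y) →
    addS (St i c ctx J (JUST i (length ctx) ∷ b ∷ r')) ≡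
    St (suc i) c (ctx ∷ʳ (j , y ∷ʳ b)) (J ∷ʳ (i , b , length ctx)) r'
  addS-St {i} {c} {ctx} {J} {j} {y} {b} {r'} e
    rewrite get-map ⟪_⟫ noLoc ctx e | len-map ctx | map-++ ⟪_⟫ ctx ((j , y ∷ʳ b) ∷ []) = refl

  matched : El conf → List Move → Bool → El result
  matched s r ok = if null r then (1 , s) else if ok then (0 , addS s) else (2 , s)

  taken : ∀ f {i c ctx J} a r ok {t} {Q : Set} →
    eqb (codeMove a) (codeMove (JUST i (length (map ⟪_⟫ ctx)))) ≡ t →
    DecidedBy (Run f (if t then matched (St i c ctx J (a ∷ r)) r ok else (2 , St i c ctx J (a ∷ r)))) Q →
    DecidedBy (Run f (takeS (St i c ctx J (a ∷ r)) ok)) Q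
  taken f a r ok refl d = d

  -- Serves both cases of TRYALL: `K` is what the clause asks of the answer and the rest, `ok` the
  -- machine's test of the answer. Lists that stop before an answer are settled here, so `cont` is
  -- left with at least two moves.
  decide-take : ∀ f {i c ctx J j y} r ok {K : Move → List Move → Set} {Q : Set} → lk ctx i ≡ just (j , y) →
    (Try i ctx K r → Q) → (Q → Try i ctx K r) →
    (∀ b r' → r ≡ JUST i (length ctx) ∷ b ∷ r' →
      (ok ≡ true × DecidedBy (Run f (0 , St (suc i) c (ctx ∷ʳ (j , y ∷ʳ b)) (J ∷ʳ (i , b , length ctx)) r')) (K b r')) ⊎
      (ok ≡ false × ¬ K b r')) →
    DecidedBy (Run f (takeS (St i c ctx J r) ok)) Q
  decide-take f [] ok e to from cont = accept f _ (to try0)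
  decide-take f {i} {c} {ctx} {J} {j} {y} (a ∷ r) ok {K} {Q} e to from cont
    with codeMove a ≟ codeMove (JUST i (length ctx))
  ... | no ne = taken f a r ok (eqb-false λ q → ne (trans q (cong (λ l → codeMove (JUST i l)) (len-map ctx))))
        (reject f _ λ q → no-match (from q))
    where
    no-match : ¬ Try i ctx K (a ∷ r)
    no-match try1 = ne refl
    no-match (try2 _) = ne refl
  ... | yes q with codeMove-injective {a} {JUST i (length ctx)} q
  ...   | refl = taken f a r ok (eqb-true (cong (λ l → codeMove (JUST i l)) (sym (len-map ctx)))) (go r to from cont)
    where
    strip : ∀ {b r'} → Try i ctx K (JUST i (length ctx) ∷ b ∷ r') → K b r'
    strip (try2 k) = k
    go : ∀ r → (Try i ctx K (a ∷ r) → Q) → (Q → Try i ctx K (a ∷ r)) →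
      (∀ b r' → a ∷ r ≡ JUST i (length ctx) ∷ b ∷ r' →
        (ok ≡ true × DecidedBy (Run f (0 , St (suc i) c (ctx ∷ʳ (j , y ∷ʳ b)) (J ∷ʳ (i , b , length ctx)) r')) (K b r')) ⊎
        (ok ≡ false × ¬ K b r')) →
      DecidedBy (Run f (matched (St i c ctx J (a ∷ r)) r ok)) Q
    go [] to from cont = accept f _ (to try1)
    go (b ∷ r') to from cont with cont b r' refl
    ... | inj₁ (refl , d) = subst (λ s → DecidedBy (Run f (0 , s)) Q) (sym (addS-St {i} {c} {ctx} {J} {j} {y} {b} {r'} e))
            (decided-map (λ k → to (try2 k)) (λ t → strip (from t)) d)
    ... | inj₂ (refl , nk) = reject f _ λ t → nk (strip (from t))

  module _ (L : ℕ) where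

    B : ℕ
    B = 2 * L + 2

    -- Enough fuel: d = c − i steps remain in the current pass, and e pays for a
    -- restart if new local positions have appeared since the pass began.
    record Fuel (f d e : ℕ) (i c : ℕ) (ctx : Ctx n) (r : List Move) : Set where
      field
        steps  : d + i ≡ c
        extra  : c ≡ length ctx ⊎ suc L ≤ e
        size   : length ctx + length r ≤ L
        budget : length r * B + (e + d) < f

    fuel-skip : ∀ {f d e i c ctx r} → i < c → Fuel (suc f) d e i c ctx r → Σ[ d' ∈ ℕ ] Fuel f d' e (suc i) c ctx r
    fuel-skip {d = zero} l F = ⊥-elim (<-irrefl (Fuel.steps F) l)
    fuel-skip {d = suc d} {e} {i} {r = r} l F = d , record
      { steps = trans (+-suc d i) steps ; extra = extra ; size = size
      ; budget = ≤-trans (≤-reflexive (sym (trans (cong (length r * B +_) (+-suc e d)) (+-suc _ (e + d))))) (s≤s⁻¹ budget) }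
      where open Fuel F

    -- A restart presupposes that the context has outgrown `c`, so the reserve `e` is at least
    -- `suc L`. It pays for the restart and for a pass over at most `L` positions.
    fuel-restart : ∀ {f d e i c ctx r} → c < length ctx → Fuel (suc f) d e i c ctx r →
      Fuel f (length ctx) 0 0 (length ctx) ctx r
    fuel-restart {d = d} {e} {ctx = ctx} {r} l F = record
      { steps = +-identityʳ _ ; extra = inj₁ refl ; size = size
      ; budget = <-≤-trans (+-monoʳ-< (length r * B) (enough extra)) (s≤s⁻¹ budget) }
      where
      open Fuel F
      enough : _ ⊎ suc L ≤ e → length ctx < e + d
      enough (inj₁ q) = ⊥-elim (<-irrefl q l)
      enough (inj₂ le) = ≤-trans (s≤s (≤-trans (m≤m+n _ _) size)) (≤-trans le (m≤m+n e d))

    -- The two moves read release `2 * B`; since `suc L ≤ B`, this renews the reserve for the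
    -- restart that the new local position will cause.
    fuel-take : ∀ {f d e i c ctx a b r lp} → i < c → Fuel (suc f) d e i c ctx (a ∷ b ∷ r) →
      Σ[ d' ∈ ℕ ] Fuel f d' (suc L) (suc i) c (ctx ∷ʳ lp) r
    fuel-take {d = zero} l F = ⊥-elim (<-irrefl (Fuel.steps F) l)
    fuel-take {f} {suc d} {e} {i} {ctx = ctx} {r = r} l F = d , record
      { steps = trans (+-suc d i) steps ; extra = inj₂ ≤-refl
      ; size = ≤-trans (≤-reflexive (cong (_+ length r) (length-snoc ctx)))
                 (≤-trans (s≤s (+-monoʳ-≤ (length ctx) (n≤1+n _))) (≤-trans (≤-reflexive (sym (+-suc _ _))) size))
      ; budget = ≤-trans spend (s≤s⁻¹ budget) }
      where
      open Fuel F
      L<B : suc L ≤ B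
      L<B = ≤-trans (s≤s (m≤n*m L 2)) (≤-trans (n≤1+n _) (≤-reflexive (+-comm 2 (2 * L))))
      spend : length r * B + (suc L + d) < (B + (B + length r * B)) + (e + suc d)
      spend = ≤-trans
        (≤-reflexive (trans (sym (+-suc _ _)) (trans (cong (length r * B +_) (sym (+-suc (suc L) d)))
          (trans (sym (+-assoc (length r * B) (suc L) (suc d))) (cong (_+ suc d) (+-comm (length r * B) (suc L)))))))
        (+-mono-≤ (+-mono-≤ L<B (m≤n+m _ B)) (m≤n+m (suc d) e))

    IH : ℕ → Set
    IH f = ∀ {d e i c ctx J} r → Inv i c ctx J → Fuel f d e i c ctx r → Decided f i c ctx J r

    continueP : ∀ {f d e i c ctx J j y m r} → IH f → Inv i c ctx J → i < c → NonAtomicAt ctx i (j , y) P →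
      FirstFresh Γ I (j , y) i J m → Fuel (suc f) d e i c ctx r → ∀ b r' → r ≡ JUST i (length ctx) ∷ b ∷ r' →
      let ok = eqb (suc (codeMove (next₂ (St i c ctx J r)))) (suc (codeMove m))
          K = b ≡ m × Added i c ctx J (j , y) m r' in
      (ok ≡ true × DecidedBy (Run f (0 , St (suc i) c (ctx ∷ʳ (j , y ∷ʳ b)) (J ∷ʳ (i , b , length ctx)) r')) K) ⊎
      (ok ≡ false × ¬ K)
    continueP {m = m} ih v l na x F b r' refl with codeMove b ≟ codeMove m
    ... | no ne = inj₂ (eqb-false (λ q → ne (suc-injective q)) , λ k → ne (cong codeMove (proj₁ k)))
    ... | yes q with codeMove-injective {b} {m} q
    ...   | refl = inj₁ (eqb-true {suc (codeMove m)} refl ,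
              decided-map (refl ,_) proj₂ (ih r' (inv-takeP v l na x) (proj₂ (fuel-take l F))))

    continueO : ∀ {f d e i c ctx J j y r} → IH f → Inv i c ctx J → i < c → NonAtomicAt ctx i (j , y) O →
      NoTriple Γ I i J → Fuel (suc f) d e i c ctx r → ∀ b r' → r ≡ JUST i (length ctx) ∷ b ∷ r' →
      let ok = eqb (or o0 (enc loc ⟪ j , y ∷ʳ next₂ (St i c ctx J r) ⟫)) 1
          K = pos (Γ' j) (y ∷ʳ b) × Added i c ctx J (j , y) b r' in
      (ok ≡ true × DecidedBy (Run f (0 , St (suc i) c (ctx ∷ʳ (j , y ∷ʳ b)) (J ∷ʳ (i , b , length ctx)) r')) K) ⊎
      (ok ≡ false × ¬ K)
    continueO {j = j} {y} ih v l na x F b r' refl with lem {pos (Γ' j) (y ∷ʳ b)}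
    ... | no np = inj₂ (proj₂ (pos-code j (y ∷ʳ b)) np , λ k → np (proj₁ k))
    ... | yes p = inj₁ (proj₁ (pos-code j (y ∷ʳ b)) p ,
              decided-map (p ,_) proj₂ (ih r' (inv-takeO v l na x p) (proj₂ (fuel-take l F))))

    -- The clause in force is found by excluded middle; the step lemmas show that the machine, which
    -- sees only the oracle answers, takes the same clause. Induction is on the fuel because skips
    -- and restarts leave the list unchanged.
    decided : ∀ f {d e i c ctx J} r → Inv i c ctx J → Fuel f d e i c ctx r → Decided f i c ctx J r
    decided zero r v F with Fuel.budget F
    ... | ()
    decided (suc f) {i = i} {c} {ctx} {J} r v F = go (action-exists en (i≤c v) (c≤len v))
      where
      open At v r
      by : ∀ {res} → stepS or s ≡ res → DecidedBy (Run f res) (E i c ctx J r) → Decided (suc f) i c ctx J r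
      by e = subst (λ z → DecidedBy z (E i c ctx J r)) (sym (run-step f e))
      go : Action i c ctx J → Decided (suc f) i c ctx J r
      go A@(restart q l) = by (step-restart q l)
        (decided-map (fromOut A) (toOut en A) (decided f r (inv-restart v) (fuel-restart l F)))
      go A@(finish q l) = by (step-finish q l) (decide-finish f r _ (fromOut A) (toOut en A))
      go A@(visit l (em a j x)) = by (step-em l x) (decide-finish f r _ (fromOut A) (toOut en A))
      go A@(visit l (stop x)) = by (step-stop l x) (decide-finish f r _ (fromOut A) (toOut en A))
      go A@(visit l (pass x)) = by (step-pass l x)
        (decided-map (fromOut A) (toOut en A) (decided f r (inv-skip v l x) (proj₂ (fuel-skip l F))))
      go A@(visit l (takeP j y m na x)) = by (step-takeP l na x)
        (decide-take f r _ (proj₁ na) (fromOut A) (toOut en A) (continueP (decided f) v l na x F))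
      go A@(visit l (takeO j y na x)) = by (step-takeO l na x)
        (decide-take f r _ (proj₁ na) (fromOut A) (toOut en A) (continueO (decided f) v l na x F))

  module _ (x : List Move) where

    private
      L : ℕ
      L = n + length x

      start : Fuel L (fuel n (length x)) n 0 0 n (rootCtx Γ') x
      start = record
        { steps = +-identityʳ n ; extra = inj₁ (sym rootCtx-length) ; size = ≤-reflexive (cong (_+ length x) rootCtx-length)
        ; budget = <-≤-trans (+-monoʳ-< (length x * B L) n<B)
            (≤-reflexive (trans (+-comm (length x * B L) (B L)) (*-comm (suc (length x)) (B L)))) }
        where
        n<B : n < B L
        n<B = ≤-trans (s≤s (≤-trans (m≤m+n n (length x)) (m≤n*m L 2))) (≤-trans (n≤1+n _) (≤-reflexive (+-comm 2 (2 * L))))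

    in-EXH : (EXH Γ I x → decideS n (St 0 n (rootCtx Γ') [] []) or x ≡ true) ×
      (¬ EXH Γ I x → decideS n (St 0 n (rootCtx Γ') [] []) or x ≡ false)
    in-EXH with decided L (fuel n (length x)) x inv-init start
    ... | accepted d e = (λ _ → cong (λ k → eqb k 1) e) , λ nd → ⊥-elim (nd d)
    ... | rejected nd e = (λ d → ⊥-elim (nd d)) , λ _ → cong (λ k → eqb k 1) e

exh-primRec : LEM → ∀ {n} (Γ : Fin n → PGame) (I : Par → Bool) →
  (∀ a → ¬ FV (ForAll (λ i → game (Γ i)) I) a) → PrimRecRel Γ (EXH Γ I)
exh-primRec lem {n} Γ I closed = program decider , λ or ag x →
  let (yes! , no!) = Decision.in-EXH lem Γ I closed or ag x in
  (λ d → trans (computes decider or x) (cong codeBool (yes! d))) ,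
  (λ nd → trans (computes decider or x) (cong codeBool (no! nd)))
  where
  start : El conf
  start = 0 , n , map (λ lp → toℕ (proj₁ lp) , proj₂ lp) (rootCtx (λ i → game (Γ i))) , [] , []
  decider : Computable (list move) bool (decideS n start)
  decider = decideC n start

-- Determinacy and the equivalence of (a), (b) and (c)

mainTheorem4 : (∀ {ℓ : Level} → ExcludedMiddle ℓ) →
    (n : ℕ) (Γ : Fin n → PGame) (I : Par → Bool) → SelfDual I →
    (∀ a → ¬ FV (ForAll (λ i → game (Γ i)) I) a) →
    Determined (ForAll (λ i → game (Γ i)) I)
    × ((∀ η → IsAssignment I η → ∀ i → Determined (assign I η (game (Γ i)))) →
    (HasWinning P (ForAll (λ i → game (Γ i)) I) →
    PrimRecRel Γ (EXH Γ I) × IsWinning P (ForAll (λ i → game (Γ i)) I) (EXH Γ I))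
    × (PrimRecRel Γ (EXH Γ I) × IsWinning P (ForAll (λ i → game (Γ i)) I) (EXH Γ I) →
    HasWinning P (ForAll (λ i → game (Γ i)) I))
    × (HasWinning P (ForAll (λ i → game (Γ i)) I) →
    ∀ η → IsAssignment I η → Σ[ i ∈ Fin n ] HasWinning P (assign I η (game (Γ i))))
    × ((∀ η → IsAssignment I η → Σ[ i ∈ Fin n ] HasWinning P (assign I η (game (Γ i)))) →
    HasWinning P (ForAll (λ i → game (Γ i)) I)))
mainTheorem4 lem n Γ I sd closed = determined , λ det → a→b , b→a , a→c det , c→a
  where
  open Losing lem Γ I sd closed
  open Limit lem Γ I sd closed

  G : Game
  G = ForAll (λ i → game (Γ i)) I

  determined : Determined G
  determined with lem {P = LostRun}
  ... | yes R = O , opponent-wins R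
  ... | no none = P , EXH Γ I , exh-wins none

  a→b : HasWinning P G → PrimRecRel Γ (EXH Γ I) × IsWinning P G (EXH Γ I)
  a→b (σ , w) = exh-primRec lem Γ I closed ,
    -- A lost run would give O a winning strategy alongside the given `σ`.
    exh-wins λ R → Exclusive.exclusive lem G w (proj₂ (opponent-wins R))

  b→a : PrimRecRel Γ (EXH Γ I) × IsWinning P G (EXH Γ I) → HasWinning P G
  b→a (_ , w) = EXH Γ I , w

  -- If P had no winning strategy in any η(G_i), determinacy would give O one in each of them;
  -- combined they win ∀I.Γ for O, against `σ`.
  a→c : (∀ η → IsAssignment I η → ∀ i → Determined (assign I η (game (Γ i)))) →
    HasWinning P G → ∀ η → IsAssignment I η → Σ[ i ∈ Fin n ] HasWinning P (assign I η (game (Γ i)))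
  a→c det (σ , w) η asg with lem {P = Σ[ i ∈ Fin n ] HasWinning P (assign I η (game (Γ i)))}
  ... | yes i = i
  ... | no none = ⊥-elim (Exclusive.exclusive lem G w (Opponent.wins lem _ I sd η asg τ))
    where
    τ : ∀ j → HasWinning O (assign I η (game (Γ j)))
    τ j with det η asg j
    ... | P , v = ⊥-elim (none (j , v))
    ... | O , v = v

  -- The hypothesis is applied to the assignment read off a supposed lost run, under which O wins
  -- every η(G_j).
  c→a : (∀ η → IsAssignment I η → Σ[ i ∈ Fin n ] HasWinning P (assign I η (game (Γ i)))) → HasWinning P G
  c→a wins = EXH Γ I , exh-wins λ R →
    let (i , σ , w) = wins (FromRun.η R) (FromRun.η-assignment R) in
    Exclusive.exclusive lem _ w (FromRun.O-wins R i)
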